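{- Let $\mathcal{G}=(H,\sigma,\alpha,h_0)$ be a rooted combinatorial map whose underlying graph $G=(V,E)$ has at least one edge, let $v_0$ be its root-vertex, let $T_G$ be its Tutte polynomial and let $[x^i]P(x)$ denote the coefficient of $x^i$ in a polynomial $P$. For every $i\ge 0$: $[x^i]T_G(1+x,2)$ (resp. $[x^i]T_G(1+x,1)$, $[x^i]T_G(1+x,0)$) is the number of orientations (resp. minimal orientations, acyclic orientations) of $G$ having exactly $i+1$ non-empty root-components; and $[x^i]T_G(x,2)$ (resp. $[x^i]T_G(x,1)$, $[x^i]T_G(x,0)$) is the number of $v_0$-connected orientations (resp. minimal $v_0$-connected orientations, acyclic $v_0$-connected orientations) having exactly $i+1$ non-empty root-strong-components.
   Context: Tutte polynomial: $T_G(x,y)=\sum_{S\subseteq E}(x-1)^{c(S)-1}(y-1)^{|S|+c(S)-|V|}$. A rooted combinatorial map is $\mathcal{G}=(H,\sigma,\alpha,h_0)$ with $H$ a finite set of half-edges, $\sigma$ a permutation, $\alpha$ a fixed-point-free involution, $\langle\sigma,\alpha\rangle$ transitive on $H$, root $h_0$; underlying graph: vertices the cycles of $\sigma$, edges the pairs $\{h,\alpha(h)\}$; $v_0$ is the vertex containing $h_0$. Subgraphs are spanning, identified with edge sets. An orientation assigns to each edge $\{h,h'\}$ an ordered pair $(h,h')$ (tail $h$, head $h'$); $v_0$-connected means every vertex is reachable from $v_0$; acyclic means no directed cycle. For a spanning tree $T$: edges in $T$ are internal, others external; the motion function $t(h)=\sigma\alpha(h)$ if the edge of $h$ is internal, $\sigma(h)$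 otherwise, is a cyclic permutation of $H$; the $(\mathcal{G},T)$-order on $H$ is $h_0<t(h_0)<\dots<t^{|H|-1}(h_0)$, edges compared via their smaller half-edge. Fundamental cycle of external $e$: set of $e'$ with $T-e'+e$ a spanning tree; fundamental cocycle of internal $e$: set of $e'$ with $T-e+e'$ a spanning tree; an edge is $(\mathcal{G},T)$-active if minimal in its fundamental cycle/cocycle. $[T^-,T^+]$: subgraphs obtained from $T$ by removing some internal active edges and adding some external active edges; each subgraph lies in exactly one. $\Phi(S)$ for $S\in[T^-,T^+]$: for $e=\{h_1,h_2\}$, $h_1<h_2$, $\Phi(S)(e)=(h_1,h_2)$ if either ($e\in T$ and its fundamental cocycle contains no edge of $S\triangle T$) or ($e\notin T$ and its fundamental cycle contains some edge of $S\triangle T$); otherwise $(h_2,h_1)$; $\Phi$ is a bijection onto orientations. For an orientation $\mathcal{O}$ let $T_{\mathcal{O}}$ be the spanning tree with $\Phi^{ -1}(\mathcal{O})\in[T_{\mathcal{O}}^-,T_{\mathcal{O}}^+]$ and compare edges/half-edges in the $(\mathcal{G},T_{\mathcal{O}})$-order. $\mathcal{O}$ is minimal if no $\mathcal{O}$-directed cycle has a tail as its smallest half-edge. Root-components of $\mathcal{O}$: $V_0$ is the set of vertices reachable from $v_0$; if $W_k=V_0\cup\dots\cup V_k\ne V$, let $e_k$ be the minimal edge with one endpoint in $W_k$ and the other endpoint $v_k\notin W_k$, and let $V_{k+1}$ be the set of vertices outside $W_k$ reachable from $v_k$. Root-strong-components of a $v_0$-connected $\mathcal{O}$: $U_0$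 is the set of vertices from which $v_0$ is reachable; if $W_k=U_0\cup\dots\cup U_k\ne V$, let $e_k$ be the minimal edge with one endpoint in $W_k$ and the other $v_k\notin W_k$, and let $U_{k+1}$ be the set of vertices outside $W_k$ from which $v_k$ is reachable. -}

module Defs where

open import Data.Nat using (ℕ; zero; suc; _+_; _∸_; _⊓_; _≤_; _<_; _≡ᵇ_; _≤ᵇ_; _<ᵇ_)
open import Data.Bool using (Bool; true; false; not; _∧_; _∨_; _xor_; if_then_else_)
open import Data.Fin using (Fin; toℕ) renaming (_≟_ to _≟F_)
open import Data.Fin.Permutation using (Permutation′; _⟨$⟩ʳ_; _⟨$⟩ˡ_)
open import Data.Integer using (ℤ; +_; -_) renaming (_+_ to _+ℤ_; _*_ to _*ℤ_; _-_ to _-ℤ_; _^_ to _^ℤ_)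
open import Data.List using (List; []; _∷_; _∷ʳ_; length; map; foldr; filterᵇ; takeWhileᵇ; allFin; upTo; concatMap)
open import Data.Bool.ListAction using (any; all)
open import Data.List.Membership.Propositional using (_∈_)
open import Data.List.Relation.Unary.All using (All)
open import Data.List.Relation.Unary.Any using (Any)
open import Data.List.Relation.Unary.AllPairs using (AllPairs)
open import Data.List.Relation.Unary.Linked using (Linked)
open import Data.List.Relation.Unary.Unique.Propositional using (Unique)
open import Data.Vec using (Vec; []; _∷_; lookup; tabulate)
open import Data.Product using (Σ; _×_; ∃; ∃-syntax; _,_)
open import Function.Bundles using (_⇔_)
open import Relation.Binary.PropositionalEquality using (_≡_; _≢_)
open import Relation.Binary.Construct.Closure.ReflexiveTransitive using (Star)
open import Relation.Nullary using (¬_)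
open import Relation.Nullary.Decidable using (⌊_⌋)

-- Univariate integer polynomials, as coefficient lists (constant term first)

Poly : Set
Poly = List ℤ

_+P_ : Poly → Poly → Poly
[] +P q = q
(a ∷ p) +P [] = a ∷ p
(a ∷ p) +P (b ∷ q) = (a +ℤ b) ∷ (p +P q)

scaleP : ℤ → Poly → Poly
scaleP c = map (c *ℤ_)

_*P_ : Poly → Poly → Poly
[] *P q = []
(a ∷ p) *P q = scaleP a q +P (+ 0 ∷ (p *P q))

constP : ℤ → Poly
constP c = c ∷ []

_^P_ : Poly → ℕ → Poly
p ^P zero = constP (+ 1)
p ^P suc k = p *P (p ^P k)

sumP : List Poly → Poly
sumP = foldr _+P_ []

coeff : Poly → ℕ → ℤ
coeff [] i = + 0
coeff (a ∷ p) zero = a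
coeff (a ∷ p) (suc i) = coeff p i

onePlusX : Poly
onePlusX = + 1 ∷ + 1 ∷ []

varX : Poly
varX = + 0 ∷ + 1 ∷ []

allVecs : (m : ℕ) → List (Vec Bool m)
allVecs zero = [] ∷ []
allVecs (suc m) = concatMap (λ v → (false ∷ v) ∷ (true ∷ v) ∷ []) (allVecs m)

count : ∀ {A : Set} → (A → Bool) → List A → ℕ
count p xs = length (filterᵇ p xs)

iter : ∀ {A : Set} → (A → A) → ℕ → A → A
iter f zero a = a
iter f (suc k) a = f (iter f k a)

HasCount : ∀ {A : Set} → (A → Set) → ℕ → Set
HasCount {A} P k = Σ (List A) λ L → Unique L × (∀ a → (a ∈ L) ⇔ P a) × length L ≡ k

data MapStep {n : ℕ} (σ : Permutation′ n) (α : Fin n → Fin n) (h : Fin n) : Fin n → Set where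
  byσ  : MapStep σ α h (σ ⟨$⟩ʳ h)
  byσ⁻ : MapStep σ α h (σ ⟨$⟩ˡ h)
  byα  : MapStep σ α h (α h)

record RootedMap (n : ℕ) : Set where
  field
    σ        : Permutation′ n
    α        : Fin n → Fin n
    α-invol  : ∀ h → α (α h) ≡ h
    α-fpf    : ∀ h → α h ≢ h
    transitive : ∀ h h' → Star (MapStep σ α) h h'
    h₀       : Fin n

module MapDefs {n : ℕ} (M : RootedMap n) where
  open RootedMap M

  σf : Fin n → Fin n
  σf h = σ ⟨$⟩ʳ h

  H : List (Fin n)
  H = allFin n

  _==_ : Fin n → Fin n → Bool
  a == b = ⌊ a ≟F b ⌋

  -- h and h' lie in the same cycle of σ (i.e. at the same vertex)
  sameV : Fin n → Fin n → Bool
  sameV h h' = any (λ k → iter σf k h == h') (upTo n)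

  -- reachability along a step relation between half-edges (paths have < n steps)
  closure : (Fin n → Fin n → Bool) → ℕ → Fin n → Fin n → Bool
  closure st zero h h' = h == h'
  closure st (suc k) h h' = closure st k h h' ∨ any (λ m → closure st k h m ∧ st m h') H

  reach : (Fin n → Fin n → Bool) → Fin n → Fin n → Bool
  reach st = closure st n

  -- number of classes of a (symmetric, reflexive-transitive) relation = number of minimal representatives
  numClasses : (Fin n → Fin n → Bool) → ℕ
  numClasses r = count (λ h → all (λ h' → not (r h h') ∨ (toℕ h ≤ᵇ toℕ h')) H) H

  numV : ℕ
  numV = numClasses sameV

  -- Subgraphs (spanning, = edge sets) are the α-invariant subsets of H
  isSubgraph : Vec Bool n → Bool
  isSubgraph S = all (λ h → not (lookup S h xor lookup S (α h))) H

  allSubgraphs : List (Vec Bool n)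
  allSubgraphs = filterᵇ isSubgraph (allVecs n)

  numE : Vec Bool n → ℕ
  numE S = count (λ h → lookup S h ∧ (toℕ h <ᵇ toℕ (α h))) H

  ustep : Vec Bool n → Fin n → Fin n → Bool
  ustep S h h' = sameV h h' ∨ (lookup S h ∧ (α h == h'))

  numComp : Vec Bool n → ℕ
  numComp S = numClasses (reach (ustep S))

  tutteAt : Poly → ℤ → Poly
  tutteAt X y = sumP (map term allSubgraphs)
    where
    term : Vec Bool n → Poly
    term S = ((X +P constP (- + 1)) ^P (numComp S ∸ 1))
             *P constP ((y -ℤ + 1) ^ℤ (numE S + numComp S ∸ numV))

  -- Orientations: O h = true iff h is the tail of its edge

  isOrientation : Vec Bool n → Bool
  isOrientation O = all (λ h → lookup O h xor lookup O (α h)) H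

  dstep : Vec Bool n → Fin n → Fin n → Bool
  dstep O h h' = sameV h h' ∨ (lookup O h ∧ (α h == h'))

  reachD : Vec Bool n → Fin n → Fin n → Bool
  reachD O = reach (dstep O)

  v0Connected : Vec Bool n → Bool
  v0Connected O = all (λ h → reachD O h₀ h) H

  -- an O-directed cycle, given by the list of tails of its edges h ∷ rest in cyclic order,
  -- through pairwise distinct vertices
  DirectedCycle : Vec Bool n → Fin n → List (Fin n) → Set
  DirectedCycle O h rest =
    All (λ a → lookup O a ≡ true) (h ∷ rest)
    × Linked (λ a b → sameV (α a) b ≡ true) ((h ∷ rest) ∷ʳ h)
    × AllPairs (λ a b → sameV a b ≡ false) (h ∷ rest)

  Acyclic : Vec Bool n → Set
  Acyclic O = ∀ h rest → ¬ DirectedCycle O h rest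

  isSpanningTree : Vec Bool n → Bool
  isSpanningTree T = isSubgraph T ∧ (numComp T ≡ᵇ 1) ∧ (numE T + 1 ≡ᵇ numV)

  motion : Vec Bool n → Fin n → Fin n
  motion T h = if lookup T h then σf (α h) else σf h

  -- position of h in the (G,T)-order: least k with t^k(h₀) = h
  pos : Vec Bool n → Fin n → ℕ
  pos T h = length (takeWhileᵇ (λ k → not (iter (motion T) k h₀ == h)) (upTo n))

  edgeRank : Vec Bool n → Fin n → ℕ
  edgeRank T h = pos T h ⊓ pos T (α h)

  sameEdge : Fin n → Fin n → Bool
  sameEdge x h = (x == h) ∨ (x == α h)

  addRemove : Vec Bool n → Fin n → Fin n → Vec Bool n
  addRemove T e e' = tabulate λ x → (lookup T x ∨ sameEdge x e) ∧ not (sameEdge x e')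

  removeAdd : Vec Bool n → Fin n → Fin n → Vec Bool n
  removeAdd T e e' = tabulate λ x → (lookup T x ∧ not (sameEdge x e)) ∨ sameEdge x e'

  inFundCycle : Vec Bool n → Fin n → Fin n → Bool
  inFundCycle T e e' = isSpanningTree (addRemove T e e')

  inFundCocycle : Vec Bool n → Fin n → Fin n → Bool
  inFundCocycle T e e' = isSpanningTree (removeAdd T e e')

  fund : Vec Bool n → Fin n → Fin n → Bool
  fund T e e' = if lookup T e then inFundCocycle T e e' else inFundCycle T e e'

  active : Vec Bool n → Fin n → Bool
  active T e = all (λ e' → not (fund T e e') ∨ (edgeRank T e ≤ᵇ edgeRank T e')) H

  inInterval : Vec Bool n → Vec Bool n → Bool
  inInterval T S = isSpanningTree T ∧ isSubgraph S
                   ∧ all (λ h → not (lookup S h xor lookup T h) ∨ active T h) H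

  Φ : Vec Bool n → Vec Bool n → Vec Bool n
  Φ T S = tabulate λ h → not ((pos T h <ᵇ pos T (α h)) xor cond h)
    where
    meetsΔ : Fin n → Bool
    meetsΔ h = any (λ h' → fund T h h' ∧ (lookup S h' xor lookup T h')) H
    cond : Fin n → Bool
    cond h = if lookup T h then not (meetsΔ h) else meetsΔ h

  TreeOf : Vec Bool n → Vec Bool n → Set
  TreeOf O T = ∃[ S ] (inInterval T S ≡ true × Φ T S ≡ O)

  SmallestIsTail : Vec Bool n → List (Fin n) → Set
  SmallestIsTail T C = Any (λ a → All (λ b → (pos T a ≤ pos T b) × (pos T a < pos T (α b))) C) C

  MinimalWrt : Vec Bool n → Vec Bool n → Set
  MinimalWrt T O = ∀ h rest → DirectedCycle O h rest → ¬ SmallestIsTail T (h ∷ rest)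

  minCrossing : Vec Bool n → (Fin n → Bool) → List (Fin n) → Fin n → Fin n
  minCrossing T W [] best = best
  minCrossing T W (h ∷ hs) best =
    if (W h ∧ not (W (α h))) ∧ (edgeRank T h <ᵇ edgeRank T best)
    then minCrossing T W hs h else minCrossing T W hs best

  firstCrossing : (Fin n → Bool) → List (Fin n) → List (Fin n)
  firstCrossing W [] = []
  firstCrossing W (h ∷ hs) = if W h ∧ not (W (α h)) then h ∷ [] else firstCrossing W hs

  -- grow: given current W_k and the vertex v_k (as a half-edge), the new W_{k+1}
  countParts : Vec Bool n → ((Fin n → Bool) → Fin n → Fin n → Bool) → ℕ → (Fin n → Bool) → ℕ
  countParts T grow zero W = 1
  countParts T grow (suc f) W with firstCrossing W H
  ... | [] = 1
  ... | h ∷ _ = suc (countParts T grow f (λ x → grow W (α (minCrossing T W H h)) x))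

  numRootComps : Vec Bool n → Vec Bool n → ℕ
  numRootComps T O =
    countParts T (λ W v x → W x ∨ (reachD O v x ∧ not (W x))) n (λ x → reachD O h₀ x)

  numRootStrongComps : Vec Bool n → Vec Bool n → ℕ
  numRootStrongComps T O =
    countParts T (λ W v x → W x ∨ (reachD O x v ∧ not (W x))) n (λ x → reachD O x h₀)

  RC : ℕ → Vec Bool n → Set
  RC i O = ∃[ T ] (TreeOf O T × numRootComps T O ≡ suc i)

  RSC : ℕ → Vec Bool n → Set
  RSC i O = ∃[ T ] (TreeOf O T × numRootStrongComps T O ≡ suc i)

  Minimal : Vec Bool n → Set
  Minimal O = ∃[ T ] (TreeOf O T × MinimalWrt T O)

  CoeffsCount : Poly → (ℕ → Vec Bool n → Set) → Set
  CoeffsCount P Q = ∀ i → ∃[ k ] (HasCount (Q i) k × coeff P i ≡ + k)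

{-# OPTIONS --safe #-}
module Submission where

-- Fix a spanning tree T. Cutting the tour of T at an internal edge {b, αb} with b visited first leaves
-- the arc of half-edges visited from just after b up to αb: it is the component of T - {b, αb} that
-- avoids the root, called subtree b below, and an edge lies in the fundamental cocycle of b iff exactly
-- one of its half-edges is in subtree b.
-- Orient internal edges from their first to their second half-edge and external edges backwards. Then
-- the fundamental cocycle (cycle) of an edge is directed iff the edge is active, and Φ reverses the
-- union of the fundamental cycles and cocycles of the active edges toggled between T and S.
--
-- Φ is injective: at the first half-edge where the tours of two preimages of an orientation disagree,
-- a directed cycle of one meets a directed cut of the other. Every subgraph S lies in some interval:
-- read the tour backwards, and exchange an inactive edge on which T and S disagree for a smaller edge
-- of its fundamental cycle or cocycle. This changes neither the later part of the tour nor the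
-- activities there. There are as many orientations as subgraphs, so Φ is bijective and the intervals
-- are disjoint.
--
-- In the orientation of S no edge enters subtree b for a toggled internal b, while untoggled internal
-- edges can be followed downwards; hence the root-components are the vertex sets of the components of
-- S. If no internal edge is toggled, a similar argument with reversed reachability gives one
-- root-strong-component for the root and one for each active internal edge. A toggled external edge has
-- a directed fundamental cycle, of which it is the minimal edge, with the smaller half-edge as tail; if
-- no external edge is toggled, the minimal edge of a directed cycle is external, active, and has its
-- larger half-edge as tail. The coefficients follow by summing over the states of the active edges one
-- at a time.

open import Defs
open import Data.Bool using (Bool; true; false; not; _∧_; _∨_; _xor_; if_then_else_; T?) renaming (T to IsTrue)
open import Data.Bool.ListAction using (and; or; any; all)
import Data.Bool.Properties as 𝔹ₚ
open import Data.Empty using (⊥; ⊥-elim)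
open import Data.Fin using (Fin; toℕ; fromℕ<)
open import Data.Fin.Permutation using (_⟨$⟩ˡ_; inverseˡ; inverseʳ)
import Data.Fin.Properties as Finₚ
open import Data.Integer using (ℤ; +_; -_) renaming (_+_ to _+ℤ_; _*_ to _*ℤ_; _-_ to _-ℤ_; _^_ to _^ℤ_)
import Data.Integer.Properties as ℤₚ
open import Data.Integer.Solver using (module +-*-Solver)
open import Data.List using (List; []; _∷_; _++_; _∷ʳ_; _ʳ++_; length; map; foldr; filterᵇ; takeWhileᵇ; allFin; upTo; applyUpTo; concatMap)
open import Data.List.Extrema.Nat using (argmin; argmin-all; f[argmin]≤f[⊤]; f[argmin]≤f[xs])
open import Data.List.Membership.Propositional using (_∈_; find; lose)
open import Data.List.Membership.Propositional.Properties using (∈-allFin; ∈-∃++; ∈-++⁻; ∈-++⁺ˡ; ∈-++⁺ʳ; ∈-filter⁺; ∈-filter⁻; ∈-map⁺; ∈-map⁻; ∈-upTo⁺)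
open import Data.List.Membership.Propositional.Properties.WithK using (unique∧set⇒bag)
import Data.List.Properties as Listₚ
open import Data.List.Relation.Binary.BagAndSetEquality using (∼bag⇒↭)
open import Data.List.Relation.Binary.Permutation.Propositional using (_↭_; ↭⇒↭ₛ)
import Data.List.Relation.Binary.Permutation.Propositional.Properties as ↭ₚ
open import Data.List.Relation.Binary.Permutation.Setoid.Properties using (foldr-commMonoid)
open import Data.List.Relation.Unary.All using (All; []; _∷_)
import Data.List.Relation.Unary.All as All
import Data.List.Relation.Unary.All.Properties as Allₚ
open import Data.List.Relation.Unary.AllPairs using (AllPairs; []; _∷_)
import Data.List.Relation.Unary.AllPairs as AllPairs
import Data.List.Relation.Unary.AllPairs.Properties as AllPairsₚ
open import Data.List.Relation.Unary.Any using (here; there; any?)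
import Data.List.Relation.Unary.Any as Any
import Data.List.Relation.Unary.Any.Properties as Anyₚ
open import Data.List.Relation.Unary.Linked using (Linked; [-]; _∷_)
open import Data.List.Relation.Unary.Unique.Propositional using (Unique)
import Data.List.Relation.Unary.Unique.Propositional.Properties as Uniqueₚ
open import Data.Nat as ℕ using (ℕ; zero; suc; _+_; _∸_; _≤_; _<_; z≤n; s≤s; _≤ᵇ_; _<ᵇ_; _≡ᵇ_)
open import Data.Nat.Induction using (<-wellFounded; Acc; acc)
import Data.Nat.Properties as ℕₚ
open import Data.Product using (_×_; ∃; _,_; proj₁; proj₂)
open import Data.Sum using (_⊎_; inj₁; inj₂; [_,_]′; swap)
open import Data.Unit using (⊤; tt)
open import Data.Vec using (Vec; []; _∷_; lookup; tabulate)
open import Data.Vec.Properties using (lookup∘tabulate; tabulate-cong; tabulate∘lookup; ≡-dec)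
open import Function using (_∘_; id)
open import Function.Bundles using (_⇔_; mk⇔; module Equivalence)
open import Function.Construct.Composition using (_⇔-∘_)
open import Function.Construct.Identity using (⇔-id)
open import Function.Definitions using (Injective)
open import Relation.Binary.Construct.Closure.ReflexiveTransitive using (Star; ε; _◅_)
open import Relation.Binary.Definitions using (tri<; tri≈; tri>)
open import Relation.Binary.PropositionalEquality using (_≡_; _≢_; refl; sym; trans; cong; cong₂; subst; subst₂; setoid; module ≡-Reasoning)
open import Relation.Nullary using (Dec; yes; no)
open import Relation.Nullary.Decidable using (decidable-stable)
open import Relation.Nullary.Reflects using (Reflects; ofʸ; ofⁿ; det; fromEquivalence)

≢true⇒false : ∀ {a} → a ≢ true → a ≡ false
≢true⇒false = 𝔹ₚ.¬-not

≢false⇒true : ∀ {a} → a ≢ false → a ≡ true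
≢false⇒true = 𝔹ₚ.¬-not

true⊎false : ∀ a → a ≡ true ⊎ a ≡ false
true⊎false true = inj₁ refl
true⊎false false = inj₂ refl

true-ext : ∀ {a b} → (a ≡ true → b ≡ true) → (b ≡ true → a ≡ true) → a ≡ b
true-ext f g = 𝔹ₚ.⇔→≡ {z = true} (mk⇔ f g)

∧⁺ : ∀ {a b} → a ≡ true → b ≡ true → a ∧ b ≡ true
∧⁺ refl refl = refl

∧⁻ˡ : ∀ {a b} → a ∧ b ≡ true → a ≡ true
∧⁻ˡ = 𝔹ₚ.∧-conicalˡ _ _

∧⁻ʳ : ∀ a {b} → a ∧ b ≡ true → b ≡ true
∧⁻ʳ a = 𝔹ₚ.∧-conicalʳ a _

∨⁺ˡ : ∀ {a b} → a ≡ true → a ∨ b ≡ true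
∨⁺ˡ refl = refl

∨⁺ʳ : ∀ a {b} → b ≡ true → a ∨ b ≡ true
∨⁺ʳ a refl = 𝔹ₚ.∨-zeroʳ a

∨⁻ : ∀ a {b} → a ∨ b ≡ true → a ≡ true ⊎ b ≡ true
∨⁻ true _ = inj₁ refl
∨⁻ false p = inj₂ p

not⁺ : ∀ {a} → a ≡ false → not a ≡ true
not⁺ refl = refl

not⁻ : ∀ {a} → not a ≡ true → a ≡ false
not⁻ = 𝔹ₚ.not-injective

not-sym : ∀ {a b} → a ≡ not b → b ≡ not a
not-sym {b = b} refl = sym (𝔹ₚ.not-involutive b)

≡not-cases : ∀ {a b} → a ≡ not b → (a ≡ true × b ≡ false) ⊎ (a ≡ false × b ≡ true)
≡not-cases {b = true} refl = inj₂ (refl , refl)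
≡not-cases {b = false} refl = inj₁ (refl , refl)

implies⁺ : ∀ {a b} → (a ≡ true → b ≡ true) → not a ∨ b ≡ true
implies⁺ {true} f = f refl
implies⁺ {false} f = refl

implies⁻ : ∀ {a b} → not a ∨ b ≡ true → a ≡ true → b ≡ true
implies⁻ p refl = p

¬implies⁻ : ∀ {a b} → not a ∨ b ≡ false → a ≡ true × b ≡ false
¬implies⁻ {true} p = refl , p

xor⁺ : ∀ {a b} → a ≡ not b → a xor b ≡ true
xor⁺ {b = true} refl = refl
xor⁺ {b = false} refl = refl

xor⁻ : ∀ {a b} → a xor b ≡ true → a ≡ not b
xor⁻ {true} {false} _ = refl
xor⁻ {false} {true} _ = refl

xnor⁺ : ∀ {a b} → a ≡ b → not (a xor b) ≡ true
xnor⁺ {a} refl = cong not (𝔹ₚ.xor-same a)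

xnor⁻ : ∀ {a b} → not (a xor b) ≡ true → a ≡ b
xnor⁻ {true} {true} _ = refl
xnor⁻ {false} {false} _ = refl

xor-cancel : ∀ a b → (a xor b) xor b ≡ a
xor-cancel a b = trans (𝔹ₚ.xor-assoc a b b) (trans (cong (a xor_) (𝔹ₚ.xor-same b)) (𝔹ₚ.xor-identityʳ a))

xor-cancelʳ : ∀ {a b} c → a xor c ≡ b xor c → a ≡ b
xor-cancelʳ {a} {b} c e = trans (sym (xor-cancel a c)) (trans (cong (_xor c) e) (xor-cancel b c))

module _ {P : Set} where

  reflects-true⁺ : ∀ {b} → Reflects P b → P → b ≡ true
  reflects-true⁺ r p = det r (ofʸ p)

  reflects-true⁻ : ∀ {b} → Reflects P b → b ≡ true → P
  reflects-true⁻ (ofʸ p) _ = p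

  reflects-false⁺ : ∀ {b} → Reflects P b → (P → ⊥) → b ≡ false
  reflects-false⁺ r ¬p = det r (ofⁿ ¬p)

  reflects-false⁻ : ∀ {b} → Reflects P b → b ≡ false → P → ⊥
  reflects-false⁻ (ofⁿ ¬p) _ = ¬p

<ᵇ⁺ : ∀ {m k} → m < k → (m <ᵇ k) ≡ true
<ᵇ⁺ = reflects-true⁺ (ℕₚ.<ᵇ-reflects-< _ _)

<ᵇ⁻ : ∀ {m k} → (m <ᵇ k) ≡ true → m < k
<ᵇ⁻ = reflects-true⁻ (ℕₚ.<ᵇ-reflects-< _ _)

≮ᵇ⁺ : ∀ {m k} → k ≤ m → (m <ᵇ k) ≡ false
≮ᵇ⁺ k≤m = reflects-false⁺ (ℕₚ.<ᵇ-reflects-< _ _) (ℕₚ.≤⇒≯ k≤m)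

≮ᵇ⁻ : ∀ {m k} → (m <ᵇ k) ≡ false → k ≤ m
≮ᵇ⁻ e = ℕₚ.≮⇒≥ (reflects-false⁻ (ℕₚ.<ᵇ-reflects-< _ _) e)

≤ᵇ⁺ : ∀ {m k} → m ≤ k → (m ≤ᵇ k) ≡ true
≤ᵇ⁺ = reflects-true⁺ (ℕₚ.≤ᵇ-reflects-≤ _ _)

≤ᵇ⁻ : ∀ {m k} → (m ≤ᵇ k) ≡ true → m ≤ k
≤ᵇ⁻ = reflects-true⁻ (ℕₚ.≤ᵇ-reflects-≤ _ _)

≰ᵇ⁻ : ∀ {m k} → (m ≤ᵇ k) ≡ false → k < m
≰ᵇ⁻ e = ℕₚ.≰⇒> (reflects-false⁻ (ℕₚ.≤ᵇ-reflects-≤ _ _) e)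

≡ᵇ-reflects-≡ : ∀ m k → Reflects (m ≡ k) (m ≡ᵇ k)
≡ᵇ-reflects-≡ m k = fromEquivalence (ℕₚ.≡ᵇ⇒≡ m k) (ℕₚ.≡⇒≡ᵇ m k)

≡ᵇ⁺ : ∀ {m k} → m ≡ k → (m ≡ᵇ k) ≡ true
≡ᵇ⁺ = reflects-true⁺ (≡ᵇ-reflects-≡ _ _)

≡ᵇ⁻ : ∀ {m k} → (m ≡ᵇ k) ≡ true → m ≡ k
≡ᵇ⁻ = reflects-true⁻ (≡ᵇ-reflects-≡ _ _)

lookup-ext : ∀ {A : Set} {n} {v w : Vec A n} → (∀ x → lookup v x ≡ lookup w x) → v ≡ w
lookup-ext {v = v} {w} v≗w = trans (sym (tabulate∘lookup v)) (trans (tabulate-cong v≗w) (tabulate∘lookup w))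

module _ {A : Set} (p : A → Bool) where

  private
    to : ∀ {b} → IsTrue b → b ≡ true
    to = Equivalence.to 𝔹ₚ.T-≡
    from : ∀ {b} → b ≡ true → IsTrue b
    from = Equivalence.from 𝔹ₚ.T-≡

  all⁺ : ∀ xs → (∀ {x} → x ∈ xs → p x ≡ true) → all p xs ≡ true
  all⁺ xs h = to (Allₚ.all⁻ p (All.tabulate (from ∘ h)))

  all⁻ : ∀ {xs x} → all p xs ≡ true → x ∈ xs → p x ≡ true
  all⁻ {xs} e i = to (All.lookup (Allₚ.all⁺ p xs (from e)) i)

  any⁺ : ∀ {xs x} → x ∈ xs → p x ≡ true → any p xs ≡ true
  any⁺ i e = to (Anyₚ.any⁺ p (Any.map (λ { refl → from e }) i))

  any⁻ : ∀ xs → any p xs ≡ true → ∃ λ x → x ∈ xs × p x ≡ true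
  any⁻ xs e = let x , i , px = find (Anyₚ.any⁻ p xs (from e)) in x , i , to px

  ¬all⁻ : ∀ xs → all p xs ≡ false → ∃ λ x → x ∈ xs × p x ≡ false
  ¬all⁻ (y ∷ ys) e with p y in py
  ... | false = y , here refl , py
  ... | true = let x , i , px = ¬all⁻ ys e in x , there i , px

  ∈-filterᵇ⁺ : ∀ {xs x} → x ∈ xs → p x ≡ true → x ∈ filterᵇ p xs
  ∈-filterᵇ⁺ i e = ∈-filter⁺ (T? ∘ p) i (from e)

  ∈-filterᵇ⁻ : ∀ xs {x} → x ∈ filterᵇ p xs → x ∈ xs × p x ≡ true
  ∈-filterᵇ⁻ xs i = let j , e = ∈-filter⁻ (T? ∘ p) {xs = xs} i in j , to e

  filterᵇ-unique : ∀ {xs} → Unique xs → Unique (filterᵇ p xs)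
  filterᵇ-unique = Uniqueₚ.filter⁺ (T? ∘ p)

module _ {n : ℕ} (p : Fin n → Bool) where

  allFin⁺ : (∀ x → p x ≡ true) → all p (allFin n) ≡ true
  allFin⁺ h = all⁺ p (allFin n) (λ {x} _ → h x)

  allFin⁻ : all p (allFin n) ≡ true → ∀ x → p x ≡ true
  allFin⁻ e x = all⁻ p e (∈-allFin x)

  anyFin⁺ : ∀ x → p x ≡ true → any p (allFin n) ≡ true
  anyFin⁺ x = any⁺ p (∈-allFin x)

  anyFin⁻ : any p (allFin n) ≡ true → ∃ λ x → p x ≡ true
  anyFin⁻ e = let x , _ , px = any⁻ p (allFin n) e in x , px

  ¬allFin⁻ : all p (allFin n) ≡ false → ∃ λ x → p x ≡ false
  ¬allFin⁻ e = let x , _ , px = ¬all⁻ p (allFin n) e in x , px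

allFin-unique : ∀ {n} → Unique (allFin n)
allFin-unique = Uniqueₚ.allFin⁺ _

module _ {A : Set} where

  argmin-∈ : ∀ (f : A → ℕ) x xs → ∃ λ m → m ∈ (x ∷ xs) × (∀ {y} → y ∈ (x ∷ xs) → f m ≤ f y)
  argmin-∈ f x xs = argmin f x xs , argmin-all f (here refl) (All.tabulate there) , λ where
    (here refl) → f[argmin]≤f[⊤] {f = f} x xs
    (there i) → All.lookup (f[argmin]≤f[xs] {f = f} x xs) i

  least-satisfying : ∀ (f : A → ℕ) (p : A → Bool) xs → (∀ {x} → x ∈ xs → p x ≡ false) ⊎
    (∃ λ m → p m ≡ true × (∀ {x} → x ∈ xs → p x ≡ true → f m ≤ f x))
  least-satisfying f p xs with filterᵇ p xs in eq
  ... | [] = inj₁ (λ i → ≢true⇒false (λ e → Anyₚ.¬Any[] (subst (_ ∈_) eq (∈-filterᵇ⁺ p i e))))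
  ... | y ∷ ys with argmin-∈ f y ys
  ... | m , i , least = inj₂ (m , proj₂ (∈-filterᵇ⁻ p xs (subst (m ∈_) (sym eq) i)) ,
          λ j e → least (subst (_ ∈_) eq (∈-filterᵇ⁺ p j e)))

  unique⇒AllPairs : ∀ {R : A → A → Set} {xs} → Unique xs → (∀ {x y} → x ∈ xs → y ∈ xs → x ≢ y → R x y) → AllPairs R xs
  unique⇒AllPairs {xs = []} _ h = []
  unique⇒AllPairs {xs = x ∷ xs} (x∉ ∷ u) h =
    All.tabulate (λ i → h (here refl) (there i) (All.lookup x∉ i)) ∷ unique⇒AllPairs u (λ i j → h (there i) (there j))

  pigeonhole-≤ : ∀ (R : A → A → Set) {xs ys} → (∀ {x} → x ∈ xs → ∃ λ y → y ∈ ys × R x y) →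
                 AllPairs (λ x x′ → ∀ {y} → R x y → R x′ y → ⊥) xs → length xs ≤ length ys
  pigeonhole-≤ R {[]} total [] = z≤n
  pigeonhole-≤ R {x ∷ xs} {ys} total (disjoint ∷ disjoints) with total (here refl)
  ... | y , y∈ys , rxy with ∈-∃++ y∈ys
  ... | us , vs , refl = subst (suc (length xs) ≤_) (sym length-ys) (s≤s (pigeonhole-≤ R total′ disjoints))
    where
    length-ys : length (us ++ y ∷ vs) ≡ suc (length (us ++ vs))
    length-ys = trans (Listₚ.length-++ us) (trans (ℕₚ.+-suc _ _) (cong suc (sym (Listₚ.length-++ us))))
    total′ : ∀ {x′} → x′ ∈ xs → ∃ λ y′ → y′ ∈ us ++ vs × R x′ y′
    total′ i with total (there i)
    ... | y′ , y′∈ , r with ∈-++⁻ us y′∈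
    ... | inj₁ j = y′ , ∈-++⁺ˡ j , r
    ... | inj₂ (here refl) = ⊥-elim (All.lookup disjoint i rxy r)
    ... | inj₂ (there j) = y′ , ∈-++⁺ʳ us j , r

  unique⊆⇒length-≤ : ∀ {xs ys : List A} → Unique xs → (∀ {x} → x ∈ xs → x ∈ ys) → length xs ≤ length ys
  unique⊆⇒length-≤ u xs⊆ys = pigeonhole-≤ _≡_ (λ {x} i → x , xs⊆ys i , refl)
    (unique⇒AllPairs u (λ _ _ x≢x′ x≡y x′≡y → x≢x′ (trans x≡y (sym x′≡y))))

map-unique : ∀ {A B : Set} (f : A → B) {xs} → Unique xs → (∀ {x y} → x ∈ xs → y ∈ xs → f x ≡ f y → x ≡ y) →
             Unique (map f xs)
map-unique f [] inj = []
map-unique f {x ∷ xs} (x∉ ∷ u) inj =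
  Allₚ.map⁺ (All.tabulate (λ i e → All.lookup x∉ i (inj (here refl) (there i) e)))
  ∷ map-unique f u (λ i j → inj (there i) (there j))

𝟙 : Bool → ℕ
𝟙 true = 1
𝟙 false = 0

module _ {A : Set} where

  count-∷ : ∀ (p : A → Bool) x xs → count p (x ∷ xs) ≡ 𝟙 (p x) + count p xs
  count-∷ p x xs with p x
  ... | true = refl
  ... | false = refl

  count-cong : ∀ {p q : A → Bool} xs → (∀ {x} → x ∈ xs → p x ≡ q x) → count p xs ≡ count q xs
  count-cong [] h = refl
  count-cong {p} {q} (x ∷ xs) h = begin
    count p (x ∷ xs)        ≡⟨ count-∷ p x xs ⟩
    𝟙 (p x) + count p xs    ≡⟨ cong₂ (λ b k → 𝟙 b + k) (h (here refl)) (count-cong xs (h ∘ there)) ⟩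
    𝟙 (q x) + count q xs    ≡⟨ count-∷ q x xs ⟨
    count q (x ∷ xs)        ∎
    where open ≡-Reasoning

  count-split : ∀ (r p q : A → Bool) xs → (∀ x → 𝟙 (r x) ≡ 𝟙 (p x) + 𝟙 (q x)) → count r xs ≡ count p xs + count q xs
  count-split r p q [] h = refl
  count-split r p q (x ∷ xs) h = begin
    count r (x ∷ xs)                                    ≡⟨ count-∷ r x xs ⟩
    𝟙 (r x) + count r xs                                ≡⟨ cong₂ _+_ (h x) (count-split r p q xs h) ⟩
    (𝟙 (p x) + 𝟙 (q x)) + (count p xs + count q xs)     ≡⟨ interchange (𝟙 (p x)) (𝟙 (q x)) _ _ ⟩
    (𝟙 (p x) + count p xs) + (𝟙 (q x) + count q xs)     ≡⟨ cong₂ _+_ (count-∷ p x xs) (count-∷ q x xs) ⟨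
    count p (x ∷ xs) + count q (x ∷ xs)                 ∎
    where
    open ≡-Reasoning
    open import Algebra.Properties.CommutativeSemigroup ℕₚ.+-commutativeSemigroup using (interchange)

  count-none⁺ : ∀ {p : A → Bool} {xs} → (∀ {x} → x ∈ xs → p x ≡ false) → count p xs ≡ 0
  count-none⁺ {p} h = cong length
    (Listₚ.filter-none (T? ∘ p) (All.tabulate (λ i t → 𝔹ₚ.not-¬ (Equivalence.to 𝔹ₚ.T-≡ t) (h i))))

  count-none⁻ : ∀ (p : A → Bool) {xs} → count p xs ≡ 0 → ∀ {x} → x ∈ xs → p x ≡ false
  count-none⁻ p {xs} e i = ≢true⇒false λ px → ℕₚ.<-irrefl (sym e)
    (Listₚ.filter-some (T? ∘ p) (lose i (Equivalence.from 𝔹ₚ.T-≡ px)))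

  count-filterᵇ : ∀ (p q : A → Bool) xs → count p (filterᵇ q xs) ≡ count (λ x → p x ∧ q x) xs
  count-filterᵇ p q [] = refl
  count-filterᵇ p q (x ∷ xs) with q x
  ... | false rewrite 𝔹ₚ.∧-zeroʳ (p x) = count-filterᵇ p q xs
  ... | true rewrite 𝔹ₚ.∧-identityʳ (p x) with p x
  ... | true = cong suc (count-filterᵇ p q xs)
  ... | false = count-filterᵇ p q xs

  count-⊆-filterᵇ : ∀ {p q : A → Bool} xs → (∀ {x} → p x ≡ true → q x ≡ true) → count p (filterᵇ q xs) ≡ count p xs
  count-⊆-filterᵇ {p} {q} xs p⊆q =
    trans (count-filterᵇ p q xs) (count-cong xs (λ _ → true-ext ∧⁻ˡ (λ e → ∧⁺ e (p⊆q e))))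

  count-mono : ∀ {p q : A → Bool} xs → (∀ {x} → p x ≡ true → q x ≡ true) → count p xs ≤ count q xs
  count-mono {p} {q} xs p⊆q = subst (_≤ count q xs) (count-⊆-filterᵇ xs p⊆q)
    (Listₚ.length-filter (T? ∘ p) (filterᵇ q xs))

  count-strict : ∀ {p q : A → Bool} {xs y} → (∀ {x} → p x ≡ true → q x ≡ true) →
                 y ∈ xs → p y ≡ false → q y ≡ true → count p xs < count q xs
  count-strict {p} {q} {xs} p⊆q y∈ py qy = subst (_< count q xs) (count-⊆-filterᵇ xs p⊆q)
    (Listₚ.filter-notAll (T? ∘ p) (filterᵇ q xs)
      (lose (∈-filterᵇ⁺ q y∈ qy) (λ t → 𝔹ₚ.not-¬ (Equivalence.to 𝔹ₚ.T-≡ t) py)))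

  count-injection : ∀ (f : A → A) {p q : A → Bool} {xs ys} → Unique xs →
    (∀ {x} → x ∈ xs → p x ≡ true → f x ∈ ys × q (f x) ≡ true) →
    (∀ {x y} → p x ≡ true → p y ≡ true → f x ≡ f y → x ≡ y) → count p xs ≤ count q ys
  count-injection f {p} {q} {xs} {ys} u maps inj = subst (_≤ count q ys) (Listₚ.length-map f (filterᵇ p xs))
    (unique⊆⇒length-≤
      (map-unique f (filterᵇ-unique p u) (λ i j → inj (proj₂ (∈-filterᵇ⁻ p xs i)) (proj₂ (∈-filterᵇ⁻ p xs j)))) image)
    where
    image : ∀ {z} → z ∈ map f (filterᵇ p xs) → z ∈ filterᵇ q ys
    image j with ∈-map⁻ f j
    ... | x , i , refl = let x∈ , px = ∈-filterᵇ⁻ p xs i ; fx∈ , qfx = maps x∈ px in ∈-filterᵇ⁺ q fx∈ qfx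

  count-unique : ∀ {p : A → Bool} {xs y} → Unique xs → y ∈ xs → p y ≡ true → (∀ {x} → p x ≡ true → x ≡ y) →
                 count p xs ≡ 1
  count-unique {p} {xs} u y∈ py only = ℕₚ.≤-antisym
    (unique⊆⇒length-≤ {ys = _ ∷ []} (filterᵇ-unique p u) (λ i → here (only (proj₂ (∈-filterᵇ⁻ p xs i)))))
    (unique⊆⇒length-≤ ([] ∷ []) (λ { (here refl) → ∈-filterᵇ⁺ p y∈ py }))

  count-ʳ++ : ∀ (p : A → Bool) xs ys → count p (xs ʳ++ ys) ≡ count p xs + count p ys
  count-ʳ++ p [] ys = refl
  count-ʳ++ p (x ∷ xs) ys = begin
    count p (xs ʳ++ (x ∷ ys))               ≡⟨ count-ʳ++ p xs (x ∷ ys) ⟩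
    count p xs + count p (x ∷ ys)           ≡⟨ cong (λ k → count p xs + k) (count-∷ p x ys) ⟩
    count p xs + (𝟙 (p x) + count p ys)     ≡⟨ x∙yz≈y∙xz (count p xs) (𝟙 (p x)) _ ⟩
    𝟙 (p x) + (count p xs + count p ys)     ≡⟨ ℕₚ.+-assoc (𝟙 (p x)) _ _ ⟨
    𝟙 (p x) + count p xs + count p ys       ≡⟨ cong (_+ count p ys) (count-∷ p x xs) ⟨
    count p (x ∷ xs) + count p ys           ∎
    where
    open ≡-Reasoning
    open import Algebra.Properties.CommutativeSemigroup ℕₚ.+-commutativeSemigroup using (x∙yz≈y∙xz)

count-allFin-≤ : ∀ {n} (p : Fin n → Bool) → count p (allFin n) ≤ n
count-allFin-≤ {n} p = subst (count p (allFin n) ≤_) (Listₚ.length-tabulate {n = n} id)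
  (Listₚ.length-filter (T? ∘ p) (allFin n))

module _ {A : Set} (f : A → A) where

  iter-+ : ∀ j k x → iter f (j + k) x ≡ iter f j (iter f k x)
  iter-+ zero k x = refl
  iter-+ (suc j) k x = cong f (iter-+ j k x)

  iter-reduce : ∀ {m x} → iter f (suc m) x ≡ x → ∀ k → ∃ λ j → j ≤ m × iter f j x ≡ iter f k x
  iter-reduce loop zero = 0 , z≤n , refl
  iter-reduce loop (suc k) with iter-reduce loop k
  ... | j , j≤m , e with ℕₚ.m≤n⇒m<n∨m≡n j≤m
  ... | inj₁ j<m = suc j , j<m , cong f e
  ... | inj₂ refl = 0 , z≤n , trans (sym loop) (cong f e)

iter-cong : ∀ {A : Set} {f g : A → A} → (∀ x → f x ≡ g x) → ∀ k x → iter f k x ≡ iter g k x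
iter-cong f≗g zero x = refl
iter-cong {g = g} f≗g (suc k) x = trans (f≗g _) (cong g (iter-cong f≗g k x))

module Orbit {n : ℕ} (f : Fin n → Fin n) (f-injective : Injective _≡_ _≡_ f) where

  _∼_ : Fin n → Fin n → Set
  x ∼ y = ∃ λ k → iter f k x ≡ y

  iter-injective : ∀ k {x y} → iter f k x ≡ iter f k y → x ≡ y
  iter-injective zero e = e
  iter-injective (suc k) e = iter-injective k (f-injective e)

  period : ∀ x → ∃ λ m → m < n × iter f (suc m) x ≡ x
  period x with Finₚ.pigeonhole {n} {suc n} (ℕₚ.n<1+n n) (λ i → iter f (toℕ i) x)
  ... | i , j , i<j , e = m , m<n , iter-injective (toℕ i) (begin
      iter f (toℕ i) (iter f (suc m) x)   ≡⟨ iter-+ f (toℕ i) (suc m) x ⟨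
      iter f (toℕ i + suc m) x            ≡⟨ cong (λ k → iter f k x) i+1+m≡j ⟩
      iter f (toℕ j) x                    ≡⟨ e ⟨
      iter f (toℕ i) x                    ∎)
    where
    open ≡-Reasoning
    m : ℕ
    m = toℕ j ∸ suc (toℕ i)
    i+1+m≡j : toℕ i + suc m ≡ toℕ j
    i+1+m≡j = trans (ℕₚ.+-suc (toℕ i) m) (ℕₚ.m+[n∸m]≡n i<j)
    m<n : m < n
    m<n = ℕₚ.≤-trans (ℕₚ.m≤n+m (suc m) (toℕ i)) (subst (_≤ n) (sym i+1+m≡j) (Finₚ.toℕ≤pred[n] j))

  ∼-refl : ∀ {x} → x ∼ x
  ∼-refl = 0 , refl

  ∼-step : ∀ {x} → x ∼ f x
  ∼-step = 1 , refl

  ∼-trans : ∀ {x y z} → x ∼ y → y ∼ z → x ∼ z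
  ∼-trans {x} (j , refl) (k , refl) = k + j , iter-+ f k j x

  ∼-unstep : ∀ x → f x ∼ x
  ∼-unstep x with period x
  ... | m , _ , loop = m , trans (sym (iter-+ f m 1 x)) (trans (cong (λ k → iter f k x) (ℕₚ.+-comm m 1)) loop)

  ∼-sym : ∀ {x y} → x ∼ y → y ∼ x
  ∼-sym (zero , refl) = ∼-refl
  ∼-sym {x} (suc k , refl) = ∼-trans (∼-unstep (iter f k x)) (∼-sym (k , refl))

  ∼-bounded : ∀ {x y} → x ∼ y → ∃ λ k → k < n × iter f k x ≡ y
  ∼-bounded {x} (k , refl) with period x
  ... | m , m<n , loop = let j , j≤m , e = iter-reduce f loop k in j , ℕₚ.≤-<-trans j≤m m<n , e

injective⇒surjective : ∀ {n} {f : Fin n → Fin n} → Injective _≡_ _≡_ f → ∀ y → ∃ λ x → f x ≡ y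
injective⇒surjective {f = f} f-injective y = let m , _ , loop = Orbit.period f f-injective y in iter f m y , loop

takeWhileᵇ-applyUpTo : ∀ {A : Set} (p : A → Bool) (f : ℕ → A) {m i} → i < m → p (f i) ≡ false →
  let j = length (takeWhileᵇ p (applyUpTo f m)) in j ≤ i × p (f j) ≡ false
takeWhileᵇ-applyUpTo p f {suc m} {i} i<m e with p (f 0) in p0
takeWhileᵇ-applyUpTo p f {suc m} {i} i<m e | false = z≤n , p0
takeWhileᵇ-applyUpTo p f {suc m} {zero} i<m e | true = ⊥-elim (𝔹ₚ.not-¬ p0 e)
takeWhileᵇ-applyUpTo p f {suc m} {suc i} (s≤s i<m) e | true =
  let j≤i , pj = takeWhileᵇ-applyUpTo p (f ∘ suc) i<m e in s≤s j≤i , pj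

extend : ∀ {m} → List (Vec Bool m) → List (Vec Bool (suc m))
extend = concatMap (λ v → (false ∷ v) ∷ (true ∷ v) ∷ [])

∈-extend⁺ : ∀ {m} b {v : Vec Bool m} {vs} → v ∈ vs → (b ∷ v) ∈ extend vs
∈-extend⁺ false (here refl) = here refl
∈-extend⁺ true (here refl) = there (here refl)
∈-extend⁺ b (there i) = there (there (∈-extend⁺ b i))

∈-extend⁻ : ∀ {m b} {v : Vec Bool m} vs → (b ∷ v) ∈ extend vs → v ∈ vs
∈-extend⁻ (w ∷ vs) (here refl) = here refl
∈-extend⁻ (w ∷ vs) (there (here refl)) = here refl
∈-extend⁻ (w ∷ vs) (there (there i)) = there (∈-extend⁻ vs i)

extend-unique : ∀ {m} {vs : List (Vec Bool m)} → Unique vs → Unique (extend vs)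
extend-unique [] = []
extend-unique {vs = v ∷ vs} (v∉ ∷ u) =
  ((λ ()) ∷ All.tabulate (fresh false)) ∷ All.tabulate (fresh true) ∷ extend-unique u
  where
  fresh : ∀ b {w} → w ∈ extend vs → (b ∷ v) ≢ w
  fresh b i refl = All.lookup v∉ (∈-extend⁻ vs i) refl

∈-allVecs : ∀ {m} (v : Vec Bool m) → v ∈ allVecs m
∈-allVecs [] = here refl
∈-allVecs (b ∷ v) = ∈-extend⁺ b (∈-allVecs v)

allVecs-unique : ∀ m → Unique (allVecs m)
allVecs-unique zero = [] ∷ []
allVecs-unique (suc m) = extend-unique (allVecs-unique m)

⟦_⟧ : Bool → ℤ
⟦ true ⟧ = + 1
⟦ false ⟧ = + 0

⟦⟧-∧ : ∀ a b → ⟦ a ⟧ *ℤ ⟦ b ⟧ ≡ ⟦ a ∧ b ⟧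
⟦⟧-∧ true b = ℤₚ.*-identityˡ ⟦ b ⟧
⟦⟧-∧ false b = refl

0^ : ∀ k → (+ 0) ^ℤ k ≡ ⟦ k ≡ᵇ 0 ⟧
0^ zero = refl
0^ (suc k) = refl

sumOver : ∀ {A : Set} → (A → ℤ) → List A → ℤ
sumOver f xs = foldr _+ℤ_ (+ 0) (map f xs)

module _ {A : Set} where

  sumOver-cong : ∀ {f g : A → ℤ} xs → (∀ {x} → x ∈ xs → f x ≡ g x) → sumOver f xs ≡ sumOver g xs
  sumOver-cong [] h = refl
  sumOver-cong (x ∷ xs) h = cong₂ _+ℤ_ (h (here refl)) (sumOver-cong xs (h ∘ there))

  sumOver-+ : ∀ (f g : A → ℤ) xs → sumOver (λ x → f x +ℤ g x) xs ≡ sumOver f xs +ℤ sumOver g xs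
  sumOver-+ f g [] = refl
  sumOver-+ f g (x ∷ xs) = trans (cong (f x +ℤ g x +ℤ_) (sumOver-+ f g xs)) (interchange (f x) (g x) _ _)
    where open import Algebra.Properties.CommutativeSemigroup ℤₚ.+-commutativeSemigroup using (interchange)

  sumOver-↭ : ∀ (f : A → ℤ) {xs ys} → xs ↭ ys → sumOver f xs ≡ sumOver f ys
  sumOver-↭ f xs↭ys = foldr-commMonoid (setoid ℤ) ℤₚ.+-0-isCommutativeMonoid (↭⇒↭ₛ (↭ₚ.map⁺ f xs↭ys))

  sumOver-map : ∀ (f : A → ℤ) (τ : A → A) xs → sumOver f (map τ xs) ≡ sumOver (f ∘ τ) xs
  sumOver-map f τ xs = cong (foldr _+ℤ_ (+ 0)) (sym (Listₚ.map-∘ xs))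

  sumOver-indicator : ∀ (χ : A → Bool) xs → sumOver (λ x → ⟦ χ x ⟧) xs ≡ + count χ xs
  sumOver-indicator χ [] = refl
  sumOver-indicator χ (x ∷ xs) with χ x
  ... | true = cong (+ 1 +ℤ_) (sumOver-indicator χ xs)
  ... | false = trans (ℤₚ.+-identityˡ _) (sumOver-indicator χ xs)

  module _ {τ : A → A} {xs : List A} (xs-unique : Unique xs)
    (τ-closed : ∀ {x} → x ∈ xs → τ x ∈ xs) (τ-involutive : ∀ {x} → x ∈ xs → τ (τ x) ≡ x) where

    involution-↭ : map τ xs ↭ xs
    involution-↭ = ∼bag⇒↭ (unique∧set⇒bag (map-unique τ xs-unique τ-injective) xs-unique (λ {z} → mk⇔ to from))
      where
      τ-injective : ∀ {x y} → x ∈ xs → y ∈ xs → τ x ≡ τ y → x ≡ y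
      τ-injective i j e = trans (sym (τ-involutive i)) (trans (cong τ e) (τ-involutive j))
      to : ∀ {z} → z ∈ map τ xs → z ∈ xs
      to i with ∈-map⁻ τ i
      ... | _ , j , refl = τ-closed j
      from : ∀ {z} → z ∈ xs → z ∈ map τ xs
      from i = subst (_∈ map τ xs) (τ-involutive i) (∈-map⁺ τ (τ-closed i))

    sumOver-double : ∀ f → + 2 *ℤ sumOver f xs ≡ sumOver (λ x → f x +ℤ f (τ x)) xs
    sumOver-double f = begin
      + 2 *ℤ sumOver f xs                 ≡⟨ solve 1 (λ a → con (+ 2) :* a := a :+ a) refl (sumOver f xs) ⟩
      sumOver f xs +ℤ sumOver f xs        ≡⟨ cong (sumOver f xs +ℤ_) (sumOver-↭ f involution-↭) ⟨
      sumOver f xs +ℤ sumOver f (map τ xs)   ≡⟨ cong (sumOver f xs +ℤ_) (sumOver-map f τ xs) ⟩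
      sumOver f xs +ℤ sumOver (f ∘ τ) xs  ≡⟨ sumOver-+ f (f ∘ τ) xs ⟨
      sumOver (λ x → f x +ℤ f (τ x)) xs   ∎
      where
      open ≡-Reasoning
      open +-*-Solver

    sumOver-involution : ∀ {f g} → (∀ {x} → x ∈ xs → f x +ℤ f (τ x) ≡ g x +ℤ g (τ x)) → sumOver f xs ≡ sumOver g xs
    sumOver-involution {f} {g} paired = ℤₚ.*-cancelˡ-≡ (+ 2) (sumOver f xs) (sumOver g xs)
      (trans (sumOver-double f) (trans (sumOver-cong xs paired) (sym (sumOver-double g))))

record ToggleSystem {A E : Set} (states : List A) (elements : List E)
                    (toggled active : A → E → Bool) (flip : E → A → A) : Set where
  field
    states-unique   : Unique states
    elements-unique : Unique elements
    toggled⇒active  : ∀ {S e} → S ∈ states → toggled S e ≡ true → active S e ≡ true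
    flip-∈          : ∀ {S e} → S ∈ states → active S e ≡ true → flip e S ∈ states
    flip-involutive : ∀ {S e} → S ∈ states → active S e ≡ true → flip e (flip e S) ≡ S
    flip-active     : ∀ {S e} → S ∈ states → active S e ≡ true → ∀ f → active (flip e S) f ≡ active S f
    flip-toggled    : ∀ {S e} → S ∈ states → active S e ≡ true → toggled (flip e S) e ≡ not (toggled S e)
    flip-toggled-≢  : ∀ {S e f} → S ∈ states → e ∈ elements → f ∈ elements → f ≢ e → active S e ≡ true →
                      toggled (flip e S) f ≡ toggled S f

-- With w S u m = (z - 1)^u z^m both sides of sumOver-untoggled compute Σ z^(number of active elements)
-- over the classes of states that differ by flips: the left one expands z = (z - 1) + 1 at every
-- active element, the right one does not.
module UntoggledSum {A E : Set} {states : List A} {elements : List E}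
  {toggled active : A → E → Bool} {flip : E → A → A}
  (system : ToggleSystem states elements toggled active flip) (w : A → ℕ → ℕ → ℤ)
  (w-split : ∀ S u m → w S (suc u) m +ℤ w S u m ≡ w S u (suc m))
  (w-flip : ∀ {S e} → S ∈ states → active S e ≡ true → ∀ u m → w (flip e S) u m ≡ w S u m) where

  open ToggleSystem system

  -- Elements of done must be untoggled and contribute z if active; those in todo are still expanded.
  partialWeight : List E → List E → A → ℤ
  partialWeight done todo S =
    if count (toggled S) done ≡ᵇ 0 then w S (count (toggled S) todo) (count (active S) done) else + 0

  private
    partialWeight≡ : ∀ S done todo {d u m} → count (toggled S) done ≡ d → count (toggled S) todo ≡ u →
      count (active S) done ≡ m → partialWeight done todo S ≡ (if d ≡ᵇ 0 then w S u m else + 0)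
    partialWeight≡ S done todo refl refl refl = refl

    split-cases : ∀ S t d u m →
      (if d ≡ᵇ 0 then w S (𝟙 t + u) m else + 0) +ℤ (if d ≡ᵇ 0 then w S (𝟙 (not t) + u) m else + 0) ≡
      (if (𝟙 t + d) ≡ᵇ 0 then w S u (suc m) else + 0) +ℤ (if (𝟙 (not t) + d) ≡ᵇ 0 then w S u (suc m) else + 0)
    split-cases S true zero u m = trans (w-split S u m) (sym (ℤₚ.+-identityˡ _))
    split-cases S false zero u m = trans (ℤₚ.+-comm (w S u m) _) (trans (w-split S u m) (sym (ℤₚ.+-identityʳ _)))
    split-cases S true (suc d) u m = refl
    split-cases S false (suc d) u m = refl

  module _ {e : E} {done todo : List E} (e∈ : e ∈ elements)
    (done-≢ : ∀ {f} → f ∈ done → f ∈ elements × f ≢ e) (todo-≢ : ∀ {f} → f ∈ todo → f ∈ elements × f ≢ e) where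

    inactive-step : ∀ {S} → S ∈ states → active S e ≡ false →
      partialWeight done (e ∷ todo) S ≡ partialWeight (e ∷ done) todo S
    inactive-step {S} S∈ inactive = trans
      (partialWeight≡ S done (e ∷ todo) refl (untoggled todo) refl)
      (sym (partialWeight≡ S (e ∷ done) todo (untoggled done) refl
        (trans (count-∷ (active S) e done) (cong (λ b → 𝟙 b + count (active S) done) inactive))))
      where
      untoggled : ∀ fs → count (toggled S) (e ∷ fs) ≡ count (toggled S) fs
      untoggled fs = trans (count-∷ (toggled S) e fs) (cong (λ b → 𝟙 b + count (toggled S) fs)
        (≢true⇒false (λ t → 𝔹ₚ.not-¬ (toggled⇒active S∈ t) inactive)))

    active-step : ∀ {S} → S ∈ states → active S e ≡ true →
      partialWeight done (e ∷ todo) S +ℤ partialWeight done (e ∷ todo) (flip e S) ≡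
      partialWeight (e ∷ done) todo S +ℤ partialWeight (e ∷ done) todo (flip e S)
    active-step {S} S∈ act = begin
      partialWeight done (e ∷ todo) S +ℤ partialWeight done (e ∷ todo) S′
        ≡⟨ cong₂ _+ℤ_ (partialWeight≡ S done (e ∷ todo) refl (count-∷ (toggled S) e todo) refl)
             (trans (partialWeight≡ S′ done (e ∷ todo) (toggled-≢ done-≢)
                (trans (count-∷ (toggled S′) e todo)
                  (cong₂ (λ b k → 𝟙 b + k) (flip-toggled S∈ act) (toggled-≢ todo-≢)))
                (count-cong done (λ _ → flip-active S∈ act _)))
              (cong (λ z → if d ≡ᵇ 0 then z else + 0) (w-flip S∈ act _ _))) ⟩
      (if d ≡ᵇ 0 then w S (𝟙 t + u) m else + 0) +ℤ (if d ≡ᵇ 0 then w S (𝟙 (not t) + u) m else + 0)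
        ≡⟨ split-cases S t d u m ⟩
      (if (𝟙 t + d) ≡ᵇ 0 then w S u (suc m) else + 0) +ℤ (if (𝟙 (not t) + d) ≡ᵇ 0 then w S u (suc m) else + 0)
        ≡⟨ cong₂ _+ℤ_ (partialWeight≡ S (e ∷ done) todo (count-∷ (toggled S) e done) refl active-suc)
             (trans (partialWeight≡ S′ (e ∷ done) todo
                (trans (count-∷ (toggled S′) e done)
                  (cong₂ (λ b k → 𝟙 b + k) (flip-toggled S∈ act) (toggled-≢ done-≢)))
                (toggled-≢ todo-≢) (trans (count-cong (e ∷ done) (λ _ → flip-active S∈ act _)) active-suc))
              (cong (λ z → if (𝟙 (not t) + d) ≡ᵇ 0 then z else + 0) (w-flip S∈ act _ _))) ⟨
      partialWeight (e ∷ done) todo S +ℤ partialWeight (e ∷ done) todo S′ ∎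
      where
      open ≡-Reasoning
      S′ : A
      S′ = flip e S
      t : Bool
      t = toggled S e
      d u m : ℕ
      d = count (toggled S) done
      u = count (toggled S) todo
      m = count (active S) done
      toggled-≢ : ∀ {fs} → (∀ {f} → f ∈ fs → f ∈ elements × f ≢ e) → count (toggled S′) fs ≡ count (toggled S) fs
      toggled-≢ {fs} fs-≢ = count-cong fs (λ i → let f∈ , f≢e = fs-≢ i in flip-toggled-≢ S∈ e∈ f∈ f≢e act)
      active-suc : count (active S) (e ∷ done) ≡ suc m
      active-suc = trans (count-∷ (active S) e done) (cong (λ b → 𝟙 b + m) act)

    sumOver-step : sumOver (partialWeight done (e ∷ todo)) states ≡ sumOver (partialWeight (e ∷ done) todo) states
    sumOver-step = sumOver-involution states-unique τ-∈ τ-involutive paired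
      where
      τ : A → A
      τ S = if active S e then flip e S else S
      τ-active : ∀ {S} → active S e ≡ true → τ S ≡ flip e S
      τ-active {S} act = cong (if_then flip e S else S) act
      τ-inactive : ∀ {S} → active S e ≡ false → τ S ≡ S
      τ-inactive {S} inactive = cong (if_then flip e S else S) inactive
      τ-∈ : ∀ {S} → S ∈ states → τ S ∈ states
      τ-∈ {S} S∈ with true⊎false (active S e)
      ... | inj₁ act = subst (_∈ states) (sym (τ-active act)) (flip-∈ S∈ act)
      ... | inj₂ inactive = subst (_∈ states) (sym (τ-inactive inactive)) S∈
      τ-involutive : ∀ {S} → S ∈ states → τ (τ S) ≡ S
      τ-involutive {S} S∈ with true⊎false (active S e)
      ... | inj₂ inactive = trans (cong τ (τ-inactive inactive)) (τ-inactive inactive)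
      ... | inj₁ act = trans (cong τ (τ-active act))
              (trans (τ-active (trans (flip-active S∈ act e) act)) (flip-involutive S∈ act))
      paired : ∀ {S} → S ∈ states → partialWeight done (e ∷ todo) S +ℤ partialWeight done (e ∷ todo) (τ S) ≡
                                    partialWeight (e ∷ done) todo S +ℤ partialWeight (e ∷ done) todo (τ S)
      paired {S} S∈ with true⊎false (active S e)
      ... | inj₁ act rewrite τ-active act = active-step S∈ act
      ... | inj₂ inactive rewrite τ-inactive inactive = cong₂ _+ℤ_ (inactive-step S∈ inactive)
            (inactive-step S∈ inactive)

  private
    sumOver-steps : ∀ todo done → Unique todo → (∀ {e} → e ∈ todo → e ∈ elements) →
      (∀ {e f} → e ∈ todo → f ∈ done → f ∈ elements × f ≢ e) →
      sumOver (partialWeight done todo) states ≡ sumOver (partialWeight (todo ʳ++ done) []) states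
    sumOver-steps [] done _ _ _ = refl
    sumOver-steps (e ∷ todo) done (e∉ ∷ u) todo∈ disjoint = trans
      (sumOver-step (todo∈ (here refl)) (disjoint (here refl)) (λ i → todo∈ (there i) , All.lookup e∉ i ∘ sym))
      (sumOver-steps todo (e ∷ done) u (todo∈ ∘ there) λ where
        i (here refl) → todo∈ (here refl) , All.lookup e∉ i
        i (there j) → disjoint (there i) j)

  sumOver-untoggled : sumOver (λ S → w S (count (toggled S) elements) 0) states ≡
    sumOver (λ S → if count (toggled S) elements ≡ᵇ 0 then w S 0 (count (active S) elements) else + 0) states
  sumOver-untoggled = trans (sumOver-steps elements [] elements-unique id (λ _ ()))
    (sumOver-cong states (λ {S} _ → cong₂ (λ d m → if d ≡ᵇ 0 then w S 0 m else + 0)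
      (count-reversed (toggled S)) (count-reversed (active S))))
    where
    count-reversed : ∀ p → count p (elements ʳ++ []) ≡ count p elements
    count-reversed p = trans (count-ʳ++ p elements []) (ℕₚ.+-identityʳ _)

coeff-+P : ∀ p q i → coeff (p +P q) i ≡ coeff p i +ℤ coeff q i
coeff-+P [] q i = sym (ℤₚ.+-identityˡ _)
coeff-+P (a ∷ p) [] i = sym (ℤₚ.+-identityʳ _)
coeff-+P (a ∷ p) (b ∷ q) zero = refl
coeff-+P (a ∷ p) (b ∷ q) (suc i) = coeff-+P p q i

coeff-scaleP : ∀ c p i → coeff (scaleP c p) i ≡ c *ℤ coeff p i
coeff-scaleP c [] i = sym (ℤₚ.*-zeroʳ c)
coeff-scaleP c (a ∷ p) zero = refl
coeff-scaleP c (a ∷ p) (suc i) = coeff-scaleP c p i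

coeff-*constP : ∀ p c i → coeff (p *P constP c) i ≡ coeff p i *ℤ c
coeff-*constP [] c i = refl
coeff-*constP (a ∷ p) c zero = ℤₚ.+-identityʳ _
coeff-*constP (a ∷ p) c (suc i) = coeff-*constP p c i

coeff-sumP : ∀ {A : Set} (f : A → Poly) xs i → coeff (sumP (map f xs)) i ≡ sumOver (λ x → coeff (f x) i) xs
coeff-sumP f [] i = refl
coeff-sumP f (x ∷ xs) i = trans (coeff-+P (f x) _ i) (cong (coeff (f x) i +ℤ_) (coeff-sumP f xs i))

coeff-x+a*-0 : ∀ a p → coeff ((a ∷ + 1 ∷ []) *P p) 0 ≡ a *ℤ coeff p 0
coeff-x+a*-0 a p = trans (coeff-+P (scaleP a p) _ 0) (trans (ℤₚ.+-identityʳ _) (coeff-scaleP a p 0))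

coeff-x+a*-suc : ∀ a p i → coeff ((a ∷ + 1 ∷ []) *P p) (suc i) ≡ a *ℤ coeff p (suc i) +ℤ coeff p i
coeff-x+a*-suc a p i = trans (coeff-+P (scaleP a p) _ (suc i)) (cong₂ _+ℤ_ (coeff-scaleP a p (suc i)) (coeff-1*P i))
  where
  coeff-0∷ : ∀ i → coeff (+ 0 ∷ []) i ≡ + 0
  coeff-0∷ zero = refl
  coeff-0∷ (suc i) = refl
  coeff-1*P : ∀ i → coeff ((+ 1 ∷ []) *P p) i ≡ coeff p i
  coeff-1*P i = begin
    coeff (scaleP (+ 1) p +P (+ 0 ∷ [])) i            ≡⟨ coeff-+P (scaleP (+ 1) p) _ i ⟩
    coeff (scaleP (+ 1) p) i +ℤ coeff (+ 0 ∷ []) i    ≡⟨ cong₂ _+ℤ_ (coeff-scaleP (+ 1) p i) (coeff-0∷ i) ⟩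
    + 1 *ℤ coeff p i +ℤ + 0                           ≡⟨ ℤₚ.+-identityʳ _ ⟩
    + 1 *ℤ coeff p i                                  ≡⟨ ℤₚ.*-identityˡ _ ⟩
    coeff p i                                         ∎
    where open ≡-Reasoning

coeff-x^ : ∀ k i → coeff (varX ^P k) i ≡ ⟦ k ≡ᵇ i ⟧
coeff-x^ zero zero = refl
coeff-x^ zero (suc i) = refl
coeff-x^ (suc k) zero = coeff-x+a*-0 (+ 0) (varX ^P k)
coeff-x^ (suc k) (suc i) = trans (coeff-x+a*-suc (+ 0) (varX ^P k) i) (trans (ℤₚ.+-identityˡ _) (coeff-x^ k i))

x-1 : Poly
x-1 = varX +P constP (- + 1)

-- The coefficient of x^i in (x - 1)^u x^m
expansionCoeff : ℕ → ℕ → ℕ → ℤ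
expansionCoeff zero m i = ⟦ m ≡ᵇ i ⟧
expansionCoeff (suc u) m i = expansionCoeff u (suc m) i -ℤ expansionCoeff u m i

expansionCoeff-suc-0 : ∀ u m → expansionCoeff u (suc m) 0 ≡ + 0
expansionCoeff-suc-0 zero m = refl
expansionCoeff-suc-0 (suc u) m = cong₂ _-ℤ_ (expansionCoeff-suc-0 u (suc m)) (expansionCoeff-suc-0 u m)

expansionCoeff-suc-suc : ∀ u m i → expansionCoeff u (suc m) (suc i) ≡ expansionCoeff u m i
expansionCoeff-suc-suc zero m i = refl
expansionCoeff-suc-suc (suc u) m i = cong₂ _-ℤ_ (expansionCoeff-suc-suc u (suc m) i) (expansionCoeff-suc-suc u m i)

coeff-[x-1]^ : ∀ u i → coeff (x-1 ^P u) i ≡ expansionCoeff u 0 i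
coeff-[x-1]^ zero zero = refl
coeff-[x-1]^ zero (suc i) = refl
coeff-[x-1]^ (suc u) zero = begin
  coeff (x-1 *P (x-1 ^P u)) 0                         ≡⟨ coeff-x+a*-0 (- + 1) (x-1 ^P u) ⟩
  - + 1 *ℤ coeff (x-1 ^P u) 0                         ≡⟨ cong (- + 1 *ℤ_) (coeff-[x-1]^ u 0) ⟩
  - + 1 *ℤ expansionCoeff u 0 0                       ≡⟨ ℤₚ.-1*i≡-i _ ⟩
  - expansionCoeff u 0 0                              ≡⟨ ℤₚ.+-identityˡ _ ⟨
  + 0 -ℤ expansionCoeff u 0 0                         ≡⟨ cong (_-ℤ expansionCoeff u 0 0) (expansionCoeff-suc-0 u 0) ⟨
  expansionCoeff u 1 0 -ℤ expansionCoeff u 0 0        ∎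
  where open ≡-Reasoning
coeff-[x-1]^ (suc u) (suc i) = begin
  coeff (x-1 *P (x-1 ^P u)) (suc i)                   ≡⟨ coeff-x+a*-suc (- + 1) (x-1 ^P u) i ⟩
  - + 1 *ℤ coeff (x-1 ^P u) (suc i) +ℤ coeff (x-1 ^P u) i
    ≡⟨ cong₂ (λ a b → - + 1 *ℤ a +ℤ b) (coeff-[x-1]^ u (suc i)) (coeff-[x-1]^ u i) ⟩
  - + 1 *ℤ expansionCoeff u 0 (suc i) +ℤ expansionCoeff u 0 i
    ≡⟨ solve 2 (λ a b → con (- + 1) :* a :+ b := b :- a) refl (expansionCoeff u 0 (suc i)) (expansionCoeff u 0 i) ⟩
  expansionCoeff u 0 i -ℤ expansionCoeff u 0 (suc i)
    ≡⟨ cong (_-ℤ expansionCoeff u 0 (suc i)) (expansionCoeff-suc-suc u 0 i) ⟨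
  expansionCoeff u 1 (suc i) -ℤ expansionCoeff u 0 (suc i) ∎
  where
  open ≡-Reasoning
  open +-*-Solver

module Map {n : ℕ} (M : RootedMap n) where
  open RootedMap M
  open MapDefs M

  ==-reflects : ∀ x y → Reflects (x ≡ y) (x == y)
  ==-reflects x y with x Finₚ.≟ y
  ... | yes x≡y = ofʸ x≡y
  ... | no x≢y = ofⁿ x≢y

  ==-refl : ∀ x → (x == x) ≡ true
  ==-refl x = reflects-true⁺ (==-reflects x x) refl

  ==⇒≡ : ∀ {x y} → (x == y) ≡ true → x ≡ y
  ==⇒≡ = reflects-true⁻ (==-reflects _ _)

  α-injective : ∀ {x y} → α x ≡ α y → x ≡ y
  α-injective {x} {y} e = trans (sym (α-invol x)) (trans (cong α e) (α-invol y))

  SameEdge : Fin n → Fin n → Set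
  SameEdge x e = x ≡ e ⊎ x ≡ α e

  sameEdge-resp : ∀ {A : Set} {f : Fin n → A} → (∀ h → f h ≡ f (α h)) → ∀ {x e} → SameEdge x e → f x ≡ f e
  sameEdge-resp fα (inj₁ refl) = refl
  sameEdge-resp fα (inj₂ refl) = sym (fα _)

  sameEdge⁻ : ∀ x e → sameEdge x e ≡ true → SameEdge x e
  sameEdge⁻ x e p with ∨⁻ (x == e) p
  ... | inj₁ q = inj₁ (==⇒≡ q)
  ... | inj₂ q = inj₂ (==⇒≡ q)

  sameEdge-refl : ∀ e → sameEdge e e ≡ true
  sameEdge-refl e = ∨⁺ˡ (==-refl e)

  α-sameEdge : ∀ e → sameEdge (α e) e ≡ true
  α-sameEdge e = ∨⁺ʳ (α e == e) (==-refl (α e))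

  ≢⇒¬sameEdge : ∀ {x e} → x ≢ e → x ≢ α e → sameEdge x e ≡ false
  ≢⇒¬sameEdge p q = ≢true⇒false ([ p , q ]′ ∘ sameEdge⁻ _ _)

  sameEdge-αʳ : ∀ x e → sameEdge x (α e) ≡ sameEdge x e
  sameEdge-αʳ x e rewrite α-invol e = 𝔹ₚ.∨-comm (x == α e) (x == e)

  sameEdge-αˡ : ∀ x e → sameEdge (α x) e ≡ sameEdge x e
  sameEdge-αˡ x e = true-ext (subst (λ y → sameEdge y e ≡ true) (α-invol x) ∘ flip (α x)) (flip x)
    where
    flip : ∀ y → sameEdge y e ≡ true → sameEdge (α y) e ≡ true
    flip y p with sameEdge⁻ y e p
    ... | inj₁ refl = α-sameEdge e
    ... | inj₂ refl = subst (λ y → sameEdge y e ≡ true) (sym (α-invol e)) (sameEdge-refl e)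

  sameEdge-congʳ : ∀ e f → sameEdge e f ≡ true → ∀ x → sameEdge x e ≡ sameEdge x f
  sameEdge-congʳ e f p x with sameEdge⁻ e f p
  ... | inj₁ refl = refl
  ... | inj₂ refl = sameEdge-αʳ x f

  sameEdge-sym : ∀ e f → sameEdge e f ≡ true → sameEdge f e ≡ true
  sameEdge-sym e f p = trans (sameEdge-congʳ e f p f) (sameEdge-refl f)

  σf-injective : Injective _≡_ _≡_ σf
  σf-injective e = trans (sym (inverseˡ σ)) (trans (cong (σ ⟨$⟩ˡ_) e) (inverseˡ σ))

  module σ-Orbit = Orbit σf σf-injective

  record _≈_ (x y : Fin n) : Set where
    constructor sameV⇒≈
    field ≈⇒sameV : sameV x y ≡ true
  open _≈_ public

  ≈⇒orbit : ∀ {x y} → x ≈ y → x σ-Orbit.∼ y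
  ≈⇒orbit {x} {y} (sameV⇒≈ e) = let k , _ , q = any⁻ (λ k → iter σf k x == y) (upTo n) e in k , ==⇒≡ q

  orbit⇒≈ : ∀ {x y} → x σ-Orbit.∼ y → x ≈ y
  orbit⇒≈ {x} o with σ-Orbit.∼-bounded o
  ... | k , k<n , refl = sameV⇒≈ (any⁺ (λ j → iter σf j x == iter σf k x) (∈-upTo⁺ k<n) (==-refl _))

  ≈-refl : ∀ {x} → x ≈ x
  ≈-refl = orbit⇒≈ σ-Orbit.∼-refl

  ≈-sym : ∀ {x y} → x ≈ y → y ≈ x
  ≈-sym = orbit⇒≈ ∘ σ-Orbit.∼-sym ∘ ≈⇒orbit

  ≈-trans : ∀ {x y z} → x ≈ y → y ≈ z → x ≈ z
  ≈-trans p q = orbit⇒≈ (σ-Orbit.∼-trans (≈⇒orbit p) (≈⇒orbit q))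

  ≈-σ : ∀ x → x ≈ σf x
  ≈-σ x = orbit⇒≈ σ-Orbit.∼-step

  ≈-σ⁻¹ : ∀ x → x ≈ (σ ⟨$⟩ˡ x)
  ≈-σ⁻¹ x = ≈-sym (subst ((σ ⟨$⟩ˡ x) ≈_) (inverseʳ σ) (≈-σ (σ ⟨$⟩ˡ x)))

  module _ (step : Fin n → Fin n → Bool) where

    closure-weaken : ∀ {x y} d k → closure step k x y ≡ true → closure step (d + k) x y ≡ true
    closure-weaken zero k p = p
    closure-weaken (suc d) k p = ∨⁺ˡ (closure-weaken d k p)

    closure-refl : ∀ x k → closure step k x x ≡ true
    closure-refl x k = subst (λ j → closure step j x x ≡ true) (ℕₚ.+-identityʳ k) (closure-weaken k 0 (==-refl x))

    closure-ind : ∀ {x} (Q : Fin n → Set) → Q x → (∀ {y z} → Q y → step y z ≡ true → Q z) →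
                  ∀ k {y} → closure step k x y ≡ true → Q y
    closure-ind Q base ind zero p = subst Q (==⇒≡ p) base
    closure-ind {x} Q base ind (suc k) {y} p with ∨⁻ (closure step k x y) p
    ... | inj₁ q = closure-ind Q base ind k q
    ... | inj₂ q = let z , r = anyFin⁻ (λ z → closure step k x z ∧ step z y) q in
                   ind (closure-ind Q base ind k (∧⁻ˡ r)) (∧⁻ʳ (closure step k x z) r)

    Stable : Fin n → ℕ → Set
    Stable x k = ∀ {y z} → closure step k x y ≡ true → step y z ≡ true → closure step k x z ≡ true

    stable-or-large : ∀ x k → (∃ λ j → j ≤ k × Stable x j) ⊎ k < count (closure step k x) H
    stable-or-large x zero = inj₂ (ℕₚ.≤-reflexive (sym
      (count-unique allFin-unique (∈-allFin x) (==-refl x) (sym ∘ ==⇒≡))))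
    stable-or-large x (suc k) with stable-or-large x k
    ... | inj₁ (j , j≤k , stable) = inj₁ (j , ℕₚ.m≤n⇒m≤1+n j≤k , stable)
    ... | inj₂ large with all (λ y → not (closure step (suc k) x y) ∨ closure step k x y) H in eq
    ... | true = inj₁ (k , ℕₚ.n≤1+n k , λ {y} {z} p q →
            implies⁻ (allFin⁻ _ eq z) (∨⁺ʳ (closure step k x z) (anyFin⁺ _ y (∧⁺ p q))))
    ... | false with ¬allFin⁻ _ eq
    ... | y , e = let new , old = ¬implies⁻ {closure step (suc k) x y} e in
            inj₂ (ℕₚ.≤-<-trans large (count-strict (λ {z} → ∨⁺ˡ) (∈-allFin y) old new))

    reach-refl : ∀ x → reach step x x ≡ true
    reach-refl x = closure-refl x n

    reach-ind : ∀ {x} (Q : Fin n → Set) → Q x → (∀ {y z} → Q y → step y z ≡ true → Q z) →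
                ∀ {y} → reach step x y ≡ true → Q y
    reach-ind Q base ind = closure-ind Q base ind n

    reach-snoc : ∀ {x y z} → reach step x y ≡ true → step y z ≡ true → reach step x z ≡ true
    reach-snoc {x} {y} {z} p q with stable-or-large x n
    ... | inj₂ large = ⊥-elim (ℕₚ.<-irrefl refl (ℕₚ.<-≤-trans large (count-allFin-≤ (closure step n x))))
    ... | inj₁ (j , j≤n , stable) = subst (λ k → closure step k x z ≡ true) (ℕₚ.m∸n+n≡m j≤n)
            (closure-weaken (n ∸ j) j (stable (reach-ind _ (closure-refl x j) stable p) q))

    reach-trans : ∀ {x y z} → reach step x y ≡ true → reach step y z ≡ true → reach step x z ≡ true
    reach-trans {x} p = reach-ind (λ w → reach step x w ≡ true) p reach-snoc

  -- Edge sets and orientations are both sets of half-edges, and numComp and reachD follow the same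
  -- steps: within a vertex, or from a half-edge of the set to its opposite.
  opaque
    reaches : Vec Bool n → Fin n → Fin n → Bool
    reaches = reachD

    reaches≡reachD : ∀ {S x y} → reaches S x y ≡ reachD S x y
    reaches≡reachD = refl

    numComp≡numClasses : ∀ S → numComp S ≡ numClasses (reaches S)
    numComp≡numClasses S = refl

  _⇝[_]_ : Fin n → Vec Bool n → Fin n → Set
  x ⇝[ S ] y = reaches S x y ≡ true

  VertexSet : (Fin n → Bool) → Set
  VertexSet X = ∀ {x y} → x ≈ y → X x ≡ X y

  NoExit NoEntry Uncut : Vec Bool n → (Fin n → Bool) → Set
  NoExit S X = ∀ {h} → lookup S h ≡ true → X h ≡ true → X (α h) ≡ true
  NoEntry S X = ∀ {h} → lookup S h ≡ true → X (α h) ≡ true → X h ≡ true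
  Uncut S X = ∀ {h} → lookup S h ≡ true → X h ≡ X (α h)

  module _ {S : Vec Bool n} where

    opaque
      unfolding reaches

      ⇝-refl : ∀ {x} → x ⇝[ S ] x
      ⇝-refl {x} = reach-refl (dstep S) x

      ⇝-trans : ∀ {x y z} → x ⇝[ S ] y → y ⇝[ S ] z → x ⇝[ S ] z
      ⇝-trans = reach-trans (dstep S)

      ≈⇒⇝ : ∀ {x y} → x ≈ y → x ⇝[ S ] y
      ≈⇒⇝ p = reach-snoc (dstep S) (reach-refl (dstep S) _) (∨⁺ˡ (≈⇒sameV p))

      ∈⇒⇝ : ∀ {x} → lookup S x ≡ true → x ⇝[ S ] α x
      ∈⇒⇝ {x} p = reach-snoc (dstep S) (reach-refl (dstep S) x) (∨⁺ʳ (sameV x (α x)) (∧⁺ p (==-refl (α x))))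

      ⇝-ind : ∀ {x} (Q : Fin n → Set) → Q x → (∀ {y z} → Q y → y ≈ z → Q z) →
              (∀ {y} → Q y → lookup S y ≡ true → Q (α y)) → ∀ {y} → x ⇝[ S ] y → Q y
      ⇝-ind Q base vertex edge = reach-ind (dstep S) Q base step
        where
        step : ∀ {y z} → Q y → dstep S y z ≡ true → Q z
        step {y} {z} qy e with ∨⁻ (sameV y z) e
        ... | inj₁ same = vertex qy (sameV⇒≈ same)
        ... | inj₂ tail = subst Q (==⇒≡ (∧⁻ʳ (lookup S y) tail)) (edge qy (∧⁻ˡ tail))

    α∈⇒⇝ : ∀ {x} → lookup S (α x) ≡ true → α x ⇝[ S ] x
    α∈⇒⇝ {x} p = subst (α x ⇝[ S ]_) (α-invol x) (∈⇒⇝ p)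

    reaches-vertexSet : ∀ z → VertexSet (reaches S z)
    reaches-vertexSet z p = true-ext (λ r → ⇝-trans r (≈⇒⇝ p)) (λ r → ⇝-trans r (≈⇒⇝ (≈-sym p)))

    ⇝-noExit : ∀ {X} → VertexSet X → NoExit S X → ∀ {x y} → x ⇝[ S ] y → X x ≡ true → X y ≡ true
    ⇝-noExit {X} vs noExit r px = ⇝-ind (λ y → X y ≡ true) px (λ p v → trans (sym (vs v)) p) (λ p o → noExit o p) r

    ⇝-noEntry : ∀ {X} → VertexSet X → NoEntry S X → ∀ {x y} → x ⇝[ S ] y → X y ≡ true → X x ≡ true
    ⇝-noEntry {X} vs noEntry r py = ≢false⇒true λ px →
      𝔹ₚ.not-¬ py (not⁻ (⇝-noExit {X = not ∘ X} (cong not ∘ vs)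
        (λ o q → not⁺ (≢true⇒false (λ q′ → 𝔹ₚ.not-¬ (noEntry o q′) (not⁻ q)))) r (not⁺ px)))

    ⇝-uncut : ∀ {X} → VertexSet X → Uncut S X → ∀ {x y} → x ⇝[ S ] y → X x ≡ X y
    ⇝-uncut {X} vs uncut {x} = ⇝-ind (λ y → X x ≡ X y) refl (λ p v → trans p (vs v)) (λ p o → trans p (uncut o))

  ⇝-mono : ∀ {S S′} → (∀ {z} → lookup S z ≡ true → lookup S′ z ≡ true) → ∀ {x y} → x ⇝[ S ] y → x ⇝[ S′ ] y
  ⇝-mono {S′ = S′} S⊆S′ {x} = ⇝-ind (x ⇝[ S′ ]_) ⇝-refl (λ r v → ⇝-trans r (≈⇒⇝ v)) (λ r o → ⇝-trans r (∈⇒⇝ (S⊆S′ o)))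

  uncut-or-exit : ∀ S X → NoExit S X ⊎ (∃ λ g → lookup S g ≡ true × X g ≡ true × X (α g) ≡ false)
  uncut-or-exit S X with any (λ g → lookup S g ∧ (X g ∧ not (X (α g)))) H in eq
  ... | true = let g , p = anyFin⁻ _ eq ; q = ∧⁻ʳ (lookup S g) p in inj₂ (g , ∧⁻ˡ p , ∧⁻ˡ q , not⁻ (∧⁻ʳ (X g) q))
  ... | false = inj₁ λ {h} h∈ p → ≢false⇒true λ q →
                  𝔹ₚ.not-¬ (anyFin⁺ (λ g → lookup S g ∧ (X g ∧ not (X (α g)))) h (∧⁺ h∈ (∧⁺ p (not⁺ q)))) eq

  ⇝-exit : ∀ {S X} → VertexSet X → ∀ {x y} → x ⇝[ S ] y → X x ≡ true → X y ≡ false →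
           ∃ λ g → lookup S g ≡ true × X g ≡ true × X (α g) ≡ false
  ⇝-exit {S} {X} vs r px py with uncut-or-exit S X
  ... | inj₁ noExit = ⊥-elim (𝔹ₚ.not-¬ (⇝-noExit vs noExit r px) py)
  ... | inj₂ exit = exit

  all-half-edges : Vec Bool n
  all-half-edges = tabulate (λ _ → true)

  map-connected : ∀ x y → x ⇝[ all-half-edges ] y
  map-connected x y = follow (transitive x y)
    where
    follow : ∀ {x y} → Star (MapStep σ α) x y → x ⇝[ all-half-edges ] y
    follow ε = ⇝-refl
    follow (byσ ◅ r) = ⇝-trans (≈⇒⇝ (≈-σ _)) (follow r)
    follow (byσ⁻ ◅ r) = ⇝-trans (≈⇒⇝ (≈-σ⁻¹ _)) (follow r)
    follow {x} (byα ◅ r) = ⇝-trans (∈⇒⇝ (lookup∘tabulate (λ _ → true) x)) (follow r)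

  record IsEquivalenceᵇ (r : Fin n → Fin n → Bool) : Set where
    field
      reflᵇ  : ∀ {x} → r x x ≡ true
      symᵇ   : ∀ {x y} → r x y ≡ true → r y x ≡ true
      transᵇ : ∀ {x y z} → r x y ≡ true → r y z ≡ true → r x z ≡ true

  module Classes {r : Fin n → Fin n → Bool} (equivalence : IsEquivalenceᵇ r) where
    open IsEquivalenceᵇ equivalence public

    isRep : Fin n → Bool
    isRep h = all (λ h′ → not (r h h′) ∨ (toℕ h ≤ᵇ toℕ h′)) H

    reps : List (Fin n)
    reps = filterᵇ isRep H

    isRep⁺ : ∀ {x} → (∀ {y} → r x y ≡ true → toℕ x ≤ toℕ y) → isRep x ≡ true
    isRep⁺ {x} least = allFin⁺ _ (λ y → implies⁺ {r x y} (≤ᵇ⁺ ∘ least))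

    isRep⁻ : ∀ {x y} → isRep x ≡ true → r x y ≡ true → toℕ x ≤ toℕ y
    isRep⁻ {x} {y} p e = ≤ᵇ⁻ (implies⁻ (allFin⁻ _ p y) e)

    rep-of : ∀ x → ∃ λ m → isRep m ≡ true × r m x ≡ true
    rep-of x with least-satisfying toℕ (λ y → r y x) H
    ... | inj₁ none = ⊥-elim (𝔹ₚ.not-¬ reflᵇ (none (∈-allFin x)))
    ... | inj₂ (m , rmx , least) = m , isRep⁺ (λ rmy → least (∈-allFin _) (transᵇ (symᵇ rmy) rmx)) , rmx

    Covers Independent : List (Fin n) → Set
    Covers L = ∀ x → ∃ λ m → m ∈ L × r m x ≡ true
    Independent = AllPairs (λ x y → r x y ≢ true)

    reps-cover : Covers reps
    reps-cover x = let m , p , e = rep-of x in m , ∈-filterᵇ⁺ isRep (∈-allFin m) p , e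

    reps-independent : Independent reps
    reps-independent = unique⇒AllPairs (filterᵇ-unique isRep allFin-unique) λ i j x≢y e →
      x≢y (Finₚ.toℕ-injective (ℕₚ.≤-antisym (isRep⁻ (∈reps⇒ i) e) (isRep⁻ (∈reps⇒ j) (symᵇ e))))
      where
      ∈reps⇒ : ∀ {x} → x ∈ reps → isRep x ≡ true
      ∈reps⇒ = proj₂ ∘ ∈-filterᵇ⁻ isRep H

    private
      independent-≤-cover : ∀ {L L′} → Independent L → Covers L′ → length L ≤ length L′
      independent-≤-cover independent cover = pigeonhole-≤ (λ x y → r y x ≡ true) (λ {x} _ → cover x)
        (AllPairs.map (λ x≁x′ {_} e e′ → x≁x′ (transᵇ (symᵇ e) e′)) independent)

    numClasses-≤ : ∀ {L} → Covers L → numClasses r ≤ length L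
    numClasses-≤ = independent-≤-cover reps-independent

    numClasses-≥ : ∀ {L} → Independent L → length L ≤ numClasses r
    numClasses-≥ independent = independent-≤-cover independent reps-cover

  module _ {r r′ : Fin n → Fin n → Bool} (eq : IsEquivalenceᵇ r) (eq′ : IsEquivalenceᵇ r′)
           (r⊆r′ : ∀ {x y} → r x y ≡ true → r′ x y ≡ true) where
    private
      module R = Classes eq
      module R′ = Classes eq′

      isRep-antitone : ∀ {x} → R′.isRep x ≡ true → R.isRep x ≡ true
      isRep-antitone p = R.isRep⁺ (λ e → R′.isRep⁻ p (r⊆r′ e))

    numClasses-antitone : numClasses r′ ≤ numClasses r
    numClasses-antitone = count-mono H isRep-antitone

    numClasses-strict : ∀ {x y} → r′ x y ≡ true → r x y ≡ false → numClasses r′ < numClasses r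
    numClasses-strict {x} {y} x∼y x≁y with R.rep-of x | R.rep-of y
    ... | a , rep-a , rax | b , rep-b , rby = count-strict isRep-antitone (∈-allFin (proj₁ lost))
          (proj₂ (proj₂ lost)) (proj₁ (proj₂ lost))
      where
      a∼b : r′ a b ≡ true
      a∼b = R′.transᵇ (r⊆r′ rax) (R′.transᵇ x∼y (R′.symᵇ (r⊆r′ rby)))
      lost : ∃ λ c → R.isRep c ≡ true × R′.isRep c ≡ false
      lost with R′.isRep a in rep′-a | R′.isRep b in rep′-b
      ... | false | _ = a , rep-a , rep′-a
      ... | true | false = b , rep-b , rep′-b
      ... | true | true with Finₚ.toℕ-injective (ℕₚ.≤-antisym (R′.isRep⁻ rep′-a a∼b) (R′.isRep⁻ rep′-b (R′.symᵇ a∼b)))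
      ... | refl = ⊥-elim (𝔹ₚ.not-¬ (R.transᵇ (R.symᵇ rax) rby) x≁y)

    -- Here a and b are the ends of an edge whose addition to r yields r′.
    module _ {a b : Fin n}
      (merged : ∀ {x y} → r′ x y ≡ true → r x y ≡ true ⊎
        ((r a x ≡ true ⊎ r b x ≡ true) × (r a y ≡ true ⊎ r b y ≡ true))) where

      numClasses-merge : numClasses r ≤ suc (numClasses r′)
      numClasses-merge with R′.reps-cover a
      ... | m , m∈ , m∼′a = [ extra-end b id , extra-end a swap ]′ m-end
        where
        m-end : r a m ≡ true ⊎ r b m ≡ true
        m-end with merged m∼′a
        ... | inj₁ m∼a = inj₁ (R.symᵇ m∼a)
        ... | inj₂ (end , _) = end
        extra-end : ∀ far {near} → (∀ {y} → r a y ≡ true ⊎ r b y ≡ true → r near y ≡ true ⊎ r far y ≡ true) →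
                    r near m ≡ true → numClasses r ≤ suc (numClasses r′)
        extra-end far {near} sort near∼m = R.numClasses-≤ {far ∷ R′.reps} cover
          where
          cover : R.Covers (far ∷ R′.reps)
          cover x with R′.reps-cover x
          ... | k , k∈ , k∼′x with merged k∼′x
          ... | inj₁ k∼x = k , there k∈ , k∼x
          ... | inj₂ (_ , end) with sort end
          ... | inj₁ near∼x = m , there m∈ , R.transᵇ (R.symᵇ near∼m) near∼x
          ... | inj₂ far∼x = far , here refl , far∼x

  record Subgraph (S : Vec Bool n) : Set where
    constructor mkSubgraph
    field α-closed : ∀ h → lookup S h ≡ lookup S (α h)
  open Subgraph public

  isSubgraph⁻ : ∀ S → isSubgraph S ≡ true → Subgraph S
  isSubgraph⁻ S p = mkSubgraph (λ h → xnor⁻ (allFin⁻ _ p h))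

  isSubgraph⁺ : ∀ {S} → Subgraph S → isSubgraph S ≡ true
  isSubgraph⁺ sub = allFin⁺ _ (λ h → xnor⁺ (α-closed sub h))

  ⇝-sym : ∀ {S} → Subgraph S → ∀ {x y} → x ⇝[ S ] y → y ⇝[ S ] x
  ⇝-sym {S} sub {x} = ⇝-ind (_⇝[ S ] x) ⇝-refl (λ r v → ⇝-trans (≈⇒⇝ (≈-sym v)) r)
    (λ {y} r y∈ → ⇝-trans (α∈⇒⇝ (trans (sym (α-closed sub y)) y∈)) r)

  ⇝-equivalence : ∀ {S} → Subgraph S → IsEquivalenceᵇ (reaches S)
  ⇝-equivalence sub = record { reflᵇ = ⇝-refl ; symᵇ = ⇝-sym sub ; transᵇ = ⇝-trans }

  sameV-equivalence : IsEquivalenceᵇ sameV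
  sameV-equivalence = record
    { reflᵇ  = ≈⇒sameV ≈-refl
    ; symᵇ   = λ p → ≈⇒sameV (≈-sym (sameV⇒≈ p))
    ; transᵇ = λ p q → ≈⇒sameV (≈-trans (sameV⇒≈ p) (sameV⇒≈ q))
    }

  module Vertices = Classes sameV-equivalence
  module Components {S : Vec Bool n} (sub : Subgraph S) = Classes (⇝-equivalence sub)

  module _ {S : Vec Bool n} (sub : Subgraph S) where
    open Components sub using (Covers; Independent)

    numComp-≤ : ∀ {L} → Covers L → numComp S ≤ length L
    numComp-≤ {L} cover = subst (_≤ length L) (sym (numComp≡numClasses S)) (Components.numClasses-≤ sub cover)

    numComp-≥ : ∀ {L} → Independent L → length L ≤ numComp S
    numComp-≥ {L} independent = subst (length L ≤_) (sym (numComp≡numClasses S))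
      (Components.numClasses-≥ sub independent)

    connected⇒numComp≤1 : (∀ x → h₀ ⇝[ S ] x) → numComp S ≤ 1
    connected⇒numComp≤1 reached = numComp-≤ {h₀ ∷ []} (λ x → h₀ , here refl , reached x)

    numComp≤1⇒connected : numComp S ≤ 1 → ∀ x y → x ⇝[ S ] y
    numComp≤1⇒connected ≤1 x y = ≢false⇒true λ e →
      ℕₚ.<⇒≱ (numComp-≥ {x ∷ y ∷ []} (((λ p → 𝔹ₚ.not-¬ p e) ∷ []) ∷ [] ∷ [])) ≤1

    numComp≥1 : 1 ≤ numComp S
    numComp≥1 = numComp-≥ {h₀ ∷ []} ([] ∷ [])

  canonical : Fin n → Bool
  canonical h = toℕ h <ᵇ toℕ (α h)

  α-comparable : ∀ {f : Fin n → ℕ} → Injective _≡_ _≡_ f → ∀ h → f h < f (α h) ⊎ f (α h) < f h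
  α-comparable {f} f-injective h with ℕₚ.<-cmp (f h) (f (α h))
  ... | tri< h< _ _ = inj₁ h<
  ... | tri≈ _ e _ = ⊥-elim (α-fpf h (sym (f-injective e)))
  ... | tri> _ _ >h = inj₂ >h

  α-reverses : ∀ {f : Fin n → ℕ} → Injective _≡_ _≡_ f → ∀ h → (f (α h) <ᵇ f (α (α h))) ≡ not (f h <ᵇ f (α h))
  α-reverses f-injective h rewrite α-invol h with α-comparable f-injective h
  ... | inj₁ h< = trans (≮ᵇ⁺ (ℕₚ.<⇒≤ h<)) (cong not (sym (<ᵇ⁺ h<)))
  ... | inj₂ >h = trans (<ᵇ⁺ >h) (cong not (sym (≮ᵇ⁺ (ℕₚ.<⇒≤ >h))))

  canonical-α : ∀ h → canonical (α h) ≡ not (canonical h)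
  canonical-α = α-reverses Finₚ.toℕ-injective

  EdgePredicate : (Fin n → Bool) → Set
  EdgePredicate p = ∀ h → p h ≡ p (α h)

  edgeCount : (Fin n → Bool) → ℕ
  edgeCount p = count (λ h → p h ∧ canonical h) H

  edgeCount-0⁺ : ∀ {p} → (∀ h → p h ≡ false) → edgeCount p ≡ 0
  edgeCount-0⁺ none = count-none⁺ {xs = H} (λ {h} _ → cong (_∧ canonical h) (none h))

  edgeCount-0⁻ : ∀ {p} → EdgePredicate p → edgeCount p ≡ 0 → ∀ h → p h ≡ false
  edgeCount-0⁻ {p} pα e h =
    [ absent , (λ c → trans (pα h) (absent (trans (canonical-α h) (cong not c)))) ]′ (true⊎false (canonical h))
    where
    absent : ∀ {h} → canonical h ≡ true → p h ≡ false
    absent {h} c = trans (sym (trans (cong (p h ∧_) c) (𝔹ₚ.∧-identityʳ (p h))))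
      (count-none⁻ (λ h → p h ∧ canonical h) {H} e (∈-allFin h))

  edgeCount-split : ∀ (r p q : Fin n → Bool) → (∀ h → 𝟙 (r h) ≡ 𝟙 (p h) + 𝟙 (q h)) →
    edgeCount r ≡ edgeCount p + edgeCount q
  edgeCount-split r p q split = count-split _ _ _ H (λ h → restrict (r h) (p h) (q h) (canonical h) (split h))
    where
    restrict : ∀ r p q c → 𝟙 r ≡ 𝟙 p + 𝟙 q → 𝟙 (r ∧ c) ≡ 𝟙 (p ∧ c) + 𝟙 (q ∧ c)
    restrict r p q true e rewrite 𝔹ₚ.∧-identityʳ r | 𝔹ₚ.∧-identityʳ p | 𝔹ₚ.∧-identityʳ q = e
    restrict r p q false e rewrite 𝔹ₚ.∧-zeroʳ r | 𝔹ₚ.∧-zeroʳ p | 𝔹ₚ.∧-zeroʳ q = refl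

  edgeCount-sameEdge : ∀ e → edgeCount (λ h → sameEdge h e) ≡ 1
  edgeCount-sameEdge e with canonical e in c
  ... | true = count-unique allFin-unique (∈-allFin e) (∧⁺ (sameEdge-refl e) c) only
    where
    only : ∀ {h} → sameEdge h e ∧ canonical h ≡ true → h ≡ e
    only {h} p with sameEdge⁻ h e (∧⁻ˡ p)
    ... | inj₁ h≡e = h≡e
    ... | inj₂ refl = ⊥-elim (𝔹ₚ.not-¬ (∧⁻ʳ (sameEdge (α e) e) p) (trans (canonical-α e) (cong not c)))
  ... | false = count-unique allFin-unique (∈-allFin (α e))
                  (∧⁺ (α-sameEdge e) (trans (canonical-α e) (cong not c))) only
    where
    only : ∀ {h} → sameEdge h e ∧ canonical h ≡ true → h ≡ α e
    only {h} p with sameEdge⁻ h e (∧⁻ˡ p)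
    ... | inj₂ h≡αe = h≡αe
    ... | inj₁ refl = ⊥-elim (𝔹ₚ.not-¬ (∧⁻ʳ (sameEdge e e) p) c)

  opaque
    add del : Vec Bool n → Fin n → Vec Bool n
    add S e = tabulate λ h → lookup S h ∨ sameEdge h e
    del S e = tabulate λ h → lookup S h ∧ not (sameEdge h e)

    lookup-add : ∀ S e h → lookup (add S e) h ≡ lookup S h ∨ sameEdge h e
    lookup-add S e h = lookup∘tabulate _ h

    lookup-del : ∀ S e h → lookup (del S e) h ≡ lookup S h ∧ not (sameEdge h e)
    lookup-del S e h = lookup∘tabulate _ h

  module _ {S : Vec Bool n} {e : Fin n} where

    add-subgraph : Subgraph S → Subgraph (add S e)
    add-subgraph sub .α-closed h = begin
      lookup (add S e) h                        ≡⟨ lookup-add S e h ⟩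
      lookup S h ∨ sameEdge h e                 ≡⟨ cong₂ _∨_ (α-closed sub h) (sym (sameEdge-αˡ h e)) ⟩
      lookup S (α h) ∨ sameEdge (α h) e         ≡⟨ lookup-add S e (α h) ⟨
      lookup (add S e) (α h)                    ∎
      where open ≡-Reasoning

    del-subgraph : Subgraph S → Subgraph (del S e)
    del-subgraph sub .α-closed h = begin
      lookup (del S e) h                        ≡⟨ lookup-del S e h ⟩
      lookup S h ∧ not (sameEdge h e)
        ≡⟨ cong₂ (λ a b → a ∧ not b) (α-closed sub h) (sym (sameEdge-αˡ h e)) ⟩
      lookup S (α h) ∧ not (sameEdge (α h) e)   ≡⟨ lookup-del S e (α h) ⟨
      lookup (del S e) (α h)                    ∎
      where open ≡-Reasoning

    ∈-add⁺ : ∀ {h} → lookup S h ≡ true → lookup (add S e) h ≡ true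
    ∈-add⁺ {h} p = trans (lookup-add S e h) (∨⁺ˡ p)

    ∈-add⁻ : ∀ {h} → lookup (add S e) h ≡ true → lookup S h ≡ true ⊎ SameEdge h e
    ∈-add⁻ {h} p with ∨⁻ (lookup S h) (trans (sym (lookup-add S e h)) p)
    ... | inj₁ q = inj₁ q
    ... | inj₂ q = inj₂ (sameEdge⁻ h e q)

    add-≢ : ∀ {h} → h ≢ e → h ≢ α e → lookup (add S e) h ≡ lookup S h
    add-≢ {h} p q = trans (lookup-add S e h) (trans (cong (lookup S h ∨_) (≢⇒¬sameEdge p q)) (𝔹ₚ.∨-identityʳ _))

    del-≢ : ∀ {h} → h ≢ e → h ≢ α e → lookup (del S e) h ≡ lookup S h
    del-≢ {h} p q = trans (lookup-del S e h)
      (trans (cong (λ b → lookup S h ∧ not b) (≢⇒¬sameEdge p q)) (𝔹ₚ.∧-identityʳ _))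

    ∈-del⁻ : ∀ {h} → lookup (del S e) h ≡ true → lookup S h ≡ true × h ≢ e × h ≢ α e
    ∈-del⁻ {h} p = ∧⁻ˡ q , (λ { refl → 𝔹ₚ.not-¬ (sameEdge-refl h) ¬same }) ,
      (λ { refl → 𝔹ₚ.not-¬ (α-sameEdge e) ¬same })
      where
      q : lookup S h ∧ not (sameEdge h e) ≡ true
      q = trans (sym (lookup-del S e h)) p
      ¬same : sameEdge h e ≡ false
      ¬same = not⁻ (∧⁻ʳ (lookup S h) q)

  ∈-add-self : ∀ S e → lookup (add S e) e ≡ true
  ∈-add-self S e = trans (lookup-add S e e) (∨⁺ʳ (lookup S e) (sameEdge-refl e))

  ∉-del-self : ∀ S e → lookup (del S e) e ≡ false
  ∉-del-self S e = ≢true⇒false (λ p → proj₁ (proj₂ (∈-del⁻ {S} p)) refl)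

  edge-∈ : ∀ {S} → Subgraph S → ∀ h e → sameEdge h e ≡ true → lookup S h ≡ lookup S e
  edge-∈ sub h e p = sameEdge-resp (α-closed sub) (sameEdge⁻ h e p)

  add-del : ∀ {S e} → Subgraph S → lookup S e ≡ true → add (del S e) e ≡ S
  add-del {S} {e} sub e∈ = lookup-ext λ h → trans (lookup-add (del S e) e h)
    (trans (cong (_∨ sameEdge h e) (lookup-del S e h)) (restore h))
    where
    restore : ∀ h → (lookup S h ∧ not (sameEdge h e)) ∨ sameEdge h e ≡ lookup S h
    restore h with sameEdge h e in p
    ... | true = trans (𝔹ₚ.∨-zeroʳ _) (sym (trans (edge-∈ sub h e p) e∈))
    ... | false = trans (𝔹ₚ.∨-identityʳ _) (𝔹ₚ.∧-identityʳ _)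

  numE-add : ∀ {S e} → Subgraph S → lookup S e ≡ false → numE (add S e) ≡ suc (numE S)
  numE-add {S} {e} sub e∉ = begin
    numE (add S e)
      ≡⟨ edgeCount-split (lookup (add S e)) (lookup S) (λ h → sameEdge h e) disjoint ⟩
    numE S + edgeCount (λ h → sameEdge h e)         ≡⟨ cong (λ k → numE S + k) (edgeCount-sameEdge e) ⟩
    numE S + 1                                      ≡⟨ ℕₚ.+-comm (numE S) 1 ⟩
    suc (numE S)                                    ∎
    where
    open ≡-Reasoning
    disjoint : ∀ h → 𝟙 (lookup (add S e) h) ≡ 𝟙 (lookup S h) + 𝟙 (sameEdge h e)
    disjoint h rewrite lookup-add S e h with sameEdge h e in p
    ... | true rewrite trans (edge-∈ sub h e p) e∉ = refl
    ... | false rewrite 𝔹ₚ.∨-identityʳ (lookup S h) = sym (ℕₚ.+-identityʳ _)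

  numE-del : ∀ {S e} → Subgraph S → lookup S e ≡ true → numE S ≡ suc (numE (del S e))
  numE-del {S} {e} sub e∈ = trans (cong numE (sym (add-del sub e∈))) (numE-add (del-subgraph sub) (∉-del-self S e))

  module _ {S : Vec Bool n} (sub : Subgraph S) (e : Fin n) where

    ReachedFromEnd : Fin n → Set
    ReachedFromEnd x = e ⇝[ S ] x ⊎ α e ⇝[ S ] x

    ⇝-add⁻ : ∀ {x y} → x ⇝[ add S e ] y → x ⇝[ S ] y ⊎ (ReachedFromEnd x × ReachedFromEnd y)
    ⇝-add⁻ {x} = ⇝-ind Q (inj₁ ⇝-refl) vertex edge
      where
      Q : Fin n → Set
      Q y = x ⇝[ S ] y ⊎ (ReachedFromEnd x × ReachedFromEnd y)
      extend-end : ∀ {y z} → ReachedFromEnd y → y ⇝[ S ] z → ReachedFromEnd z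
      extend-end (inj₁ p) q = inj₁ (⇝-trans p q)
      extend-end (inj₂ p) q = inj₂ (⇝-trans p q)
      follow : ∀ {y z} → Q y → y ⇝[ S ] z → Q z
      follow (inj₁ p) q = inj₁ (⇝-trans p q)
      follow (inj₂ (p , r)) q = inj₂ (p , extend-end r q)
      source-end : ∀ {y} → Q y → ReachedFromEnd y → ReachedFromEnd x
      source-end (inj₁ p) r = extend-end r (⇝-sym sub p)
      source-end (inj₂ (p , _)) _ = p
      vertex : ∀ {y z} → Q y → y ≈ z → Q z
      vertex q v = follow q (≈⇒⇝ v)
      edge : ∀ {y} → Q y → lookup (add S e) y ≡ true → Q (α y)
      edge q y∈ with ∈-add⁻ {S} y∈
      ... | inj₁ y∈S = follow q (∈⇒⇝ y∈S)
      ... | inj₂ (inj₁ refl) = inj₂ (source-end q (inj₁ ⇝-refl) , inj₂ ⇝-refl)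
      ... | inj₂ (inj₂ refl) = inj₂ (source-end q (inj₂ ⇝-refl) , inj₁ (≈⇒⇝ (subst (e ≈_) (sym (α-invol e)) ≈-refl)))

    numComp-add-≥ : numComp S ≤ suc (numComp (add S e))
    numComp-add-≥ = subst₂ (λ a b → a ≤ suc b) (sym (numComp≡numClasses S)) (sym (numComp≡numClasses (add S e)))
      (numClasses-merge (⇝-equivalence sub) (⇝-equivalence (add-subgraph sub)) (⇝-mono ∈-add⁺) ⇝-add⁻)

    numComp-add-bridge : reaches S e (α e) ≡ false → numComp (add S e) < numComp S
    numComp-add-bridge apart = subst₂ _<_ (sym (numComp≡numClasses (add S e))) (sym (numComp≡numClasses S))
      (numClasses-strict (⇝-equivalence sub) (⇝-equivalence (add-subgraph sub)) (⇝-mono ∈-add⁺)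
        (∈⇒⇝ (∈-add-self S e)) apart)

    numComp-add-joined : e ⇝[ S ] α e → numComp S ≤ numComp (add S e)
    numComp-add-joined joined = subst₂ _≤_ (sym (numComp≡numClasses S)) (sym (numComp≡numClasses (add S e)))
      (numClasses-antitone (⇝-equivalence (add-subgraph sub)) (⇝-equivalence sub) contract)
      where
      from-e : ∀ {x} → ReachedFromEnd x → e ⇝[ S ] x
      from-e (inj₁ p) = p
      from-e (inj₂ p) = ⇝-trans joined p
      contract : ∀ {x y} → x ⇝[ add S e ] y → x ⇝[ S ] y
      contract r with ⇝-add⁻ r
      ... | inj₁ p = p
      ... | inj₂ (p , q) = ⇝-trans (⇝-sym sub (from-e p)) (from-e q)

  numE≡0⇒∉ : ∀ {S} → Subgraph S → numE S ≡ 0 → ∀ h → lookup S h ≡ false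
  numE≡0⇒∉ sub = edgeCount-0⁻ (α-closed sub)

  numE≡suc⇒∈ : ∀ {S k} → numE S ≡ suc k → ∃ λ h → lookup S h ≡ true
  numE≡suc⇒∈ {S} e with any (lookup S) H in eq
  ... | true = anyFin⁻ (lookup S) eq
  ... | false = ⊥-elim (ℕₚ.0≢1+n
        (trans (sym (edgeCount-0⁺ λ h → ≢true⇒false (λ p → 𝔹ₚ.not-¬ (anyFin⁺ (lookup S) h p) eq))) e))

  numV≤numE+numComp : ∀ {S} → Subgraph S → numV ≤ numE S + numComp S
  numV≤numE+numComp {S} sub = by-edges (numE S) sub refl
    where
    by-edges : ∀ k {S} → Subgraph S → numE S ≡ k → numV ≤ k + numComp S
    by-edges zero {S} sub e = numComp-≥ sub (AllPairs.map (λ x≉y r → x≉y (≈⇒sameV (⇝⇒≈ r))) Vertices.reps-independent)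
      where
      ⇝⇒≈ : ∀ {x y} → x ⇝[ S ] y → x ≈ y
      ⇝⇒≈ {x} = ⇝-ind (x ≈_) ≈-refl ≈-trans (λ {y} _ y∈ → ⊥-elim (𝔹ₚ.not-¬ y∈ (numE≡0⇒∉ sub e y)))
    by-edges (suc k) {S} sub e with numE≡suc⇒∈ {S} e
    ... | h , h∈ = begin
      numV                              ≤⟨ by-edges k (del-subgraph sub)
        (ℕₚ.suc-injective (trans (sym (numE-del sub h∈)) e)) ⟩
      k + numComp (del S h)             ≤⟨ ℕₚ.+-monoʳ-≤ k (numComp-add-≥ (del-subgraph sub) h) ⟩
      k + suc (numComp (add (del S h) h))   ≡⟨ cong (λ S → k + suc (numComp S)) (add-del sub h∈) ⟩
      k + suc (numComp S)               ≡⟨ ℕₚ.+-suc k (numComp S) ⟩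
      suc k + numComp S                 ∎
      where open ℕₚ.≤-Reasoning

  record Forest (F : Vec Bool n) : Set where
    constructor mkForest
    field
      forest-subgraph : Subgraph F
      forest-size : numE F + numComp F ≡ numV
  open Forest public

  forest-add : ∀ {F e} → Forest F → reaches F e (α e) ≡ false → Forest (add F e) × numComp F ≡ suc (numComp (add F e))
  forest-add {F} {e} forest apart = mkForest sub⁺ (trans numE⁺ (trans (sym comp) size)) ,
    ℕₚ.+-cancelˡ-≡ (numE F) _ _ comp
    where
    sub : Subgraph F
    sub = forest-subgraph forest
    sub⁺ : Subgraph (add F e)
    sub⁺ = add-subgraph sub
    size : numE F + numComp F ≡ numV
    size = forest-size forest
    numE⁺ : numE (add F e) + numComp (add F e) ≡ numE F + suc (numComp (add F e))
    numE⁺ = trans (cong (_+ numComp (add F e)) (numE-add sub (≢true⇒false λ e∈ → 𝔹ₚ.not-¬ (∈⇒⇝ e∈) apart)))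
                  (sym (ℕₚ.+-suc (numE F) _))
    comp : numE F + numComp F ≡ numE F + suc (numComp (add F e))
    comp = ℕₚ.≤-antisym
      (subst₂ _≤_ (sym size) numE⁺ (numV≤numE+numComp sub⁺))
      (ℕₚ.+-monoʳ-≤ (numE F) (numComp-add-bridge sub e apart))

  module _ {F : Vec Bool n} {e : Fin n} (forest : Forest F) (e∈ : lookup F e ≡ true) where
    private
      sub : Subgraph F
      sub = forest-subgraph forest
      sub⁻ : Subgraph (del F e)
      sub⁻ = del-subgraph sub
      restored : ∀ {A : Set} (f : Vec Bool n → A) → f (add (del F e) e) ≡ f F
      restored f = cong f (add-del sub e∈)
      size⁻ : numE (del F e) + suc (numComp F) ≡ numV
      size⁻ = trans (ℕₚ.+-suc _ _) (trans (cong (_+ numComp F) (sym (numE-del sub e∈))) (forest-size forest))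

    forest-bridge : reaches (del F e) e (α e) ≡ false
    forest-bridge = ≢true⇒false λ joined → ℕₚ.<⇒≱ (begin-strict
      numE (del F e) + numComp (del F e)
        ≤⟨ ℕₚ.+-monoʳ-≤ (numE (del F e)) (subst (numComp (del F e) ≤_) (restored numComp)
          (numComp-add-joined sub⁻ e joined)) ⟩
      numE (del F e) + numComp F          <⟨ ℕₚ.+-monoʳ-< (numE (del F e)) (ℕₚ.n<1+n (numComp F)) ⟩
      numE (del F e) + suc (numComp F)    ≡⟨ size⁻ ⟩
      numV                                ∎) (numV≤numE+numComp sub⁻)
      where open ℕₚ.≤-Reasoning

    forest-del : Forest (del F e)
    forest-del = mkForest sub⁻ (ℕₚ.≤-antisym
      (subst (numE (del F e) + numComp (del F e) ≤_) size⁻ (ℕₚ.+-monoʳ-≤ (numE (del F e))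
        (subst (λ c → numComp (del F e) ≤ suc c) (restored numComp) (numComp-add-≥ sub⁻ e))))
      (numV≤numE+numComp sub⁻))

  record Tree (T : Vec Bool n) : Set where
    constructor mkTree
    field
      tree-forest : Forest T
      tree-numComp : numComp T ≡ 1

    tree-subgraph : Subgraph T
    tree-subgraph = forest-subgraph tree-forest

    tree-size : numE T + 1 ≡ numV
    tree-size = trans (cong (λ k → numE T + k) (sym tree-numComp)) (forest-size tree-forest)

    tree-connected : ∀ x y → x ⇝[ T ] y
    tree-connected = numComp≤1⇒connected tree-subgraph (ℕₚ.≤-reflexive tree-numComp)
  open Tree public

  isSpanningTree⁻ : ∀ {T} → isSpanningTree T ≡ true → Tree T
  isSpanningTree⁻ {T} p = mkTree
    (mkForest (isSubgraph⁻ T (∧⁻ˡ p))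
      (trans (cong (λ k → numE T + k) one) (≡ᵇ⁻ (∧⁻ʳ (numComp T ≡ᵇ 1) (∧⁻ʳ (isSubgraph T) p))))) one
    where
    one : numComp T ≡ 1
    one = ≡ᵇ⁻ (∧⁻ˡ (∧⁻ʳ (isSubgraph T) p))

  isSpanningTree⁺ : ∀ {T} → Tree T → isSpanningTree T ≡ true
  isSpanningTree⁺ tree = ∧⁺ (isSubgraph⁺ (tree-subgraph tree)) (∧⁺ (≡ᵇ⁺ (tree-numComp tree)) (≡ᵇ⁺ (tree-size tree)))

  empty : Vec Bool n
  empty = tabulate (λ _ → false)

  ∉-empty : ∀ h → lookup empty h ≡ false
  ∉-empty h = lookup∘tabulate (λ _ → false) h

  empty-forest : Forest empty
  empty-forest = mkForest sub (trans (cong (_+ numComp empty) no-edges) (ℕₚ.≤-antisym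
    (numComp-≤ sub (λ x → let m , m∈ , m≈x = Vertices.reps-cover x in m , m∈ , ≈⇒⇝ (sameV⇒≈ m≈x)))
    (subst (λ k → numV ≤ k + numComp empty) no-edges (numV≤numE+numComp sub))))
    where
    sub : Subgraph empty
    sub .α-closed h = trans (∉-empty h) (sym (∉-empty (α h)))
    no-edges : numE empty ≡ 0
    no-edges = edgeCount-0⁺ ∉-empty

  spanning-tree : ∃ Tree
  spanning-tree = connect (numComp empty ∸ 1) empty-forest
    (sym (ℕₚ.m+[n∸m]≡n (numComp≥1 (forest-subgraph empty-forest))))
    where
    connect : ∀ k {F} → Forest F → numComp F ≡ suc k → ∃ Tree
    connect zero {F} forest comp = F , mkTree forest comp
    connect (suc k) {F} forest comp with all (reaches F h₀) H in reached
    ... | true = ⊥-elim (ℕₚ.<⇒≱ (s≤s (s≤s z≤n)) (subst (_≤ 1) comp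
                   (connected⇒numComp≤1 (forest-subgraph forest) (allFin⁻ (reaches F h₀) reached))))
    ... | false with ¬allFin⁻ (reaches F h₀) reached
    ... | x , x-unreached with ⇝-exit {X = reaches F h₀} (reaches-vertexSet h₀)
          (map-connected h₀ x) ⇝-refl x-unreached
    ... | g , _ , g-reached , αg-unreached
      with forest-add {e = g} forest (≢true⇒false λ r → 𝔹ₚ.not-¬ (⇝-trans g-reached r) αg-unreached)
    ... | forest⁺ , comp⁺ = connect k forest⁺ (ℕₚ.suc-injective (trans (sym comp⁺) comp))

  motion-∈ : ∀ {S h} → lookup S h ≡ true → motion S h ≡ σf (α h)
  motion-∈ {h = h} h∈ = cong (if_then σf (α h) else σf h) h∈

  motion-∉ : ∀ {S h} → lookup S h ≡ false → motion S h ≡ σf h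
  motion-∉ {h = h} h∉ = cong (if_then σf (α h) else σf h) h∉

  motion-cong : ∀ {S S′ h} → lookup S h ≡ lookup S′ h → motion S h ≡ motion S′ h
  motion-cong {h = h} e = cong (if_then σf (α h) else σf h) e

  motion-injective : ∀ {S} → Subgraph S → Injective _≡_ _≡_ (motion S)
  motion-injective {S} sub {x} {y} e with lookup S x in x? | lookup S y in y?
  ... | true | true = α-injective (σf-injective e)
  ... | false | false = σf-injective e
  ... | true | false = ⊥-elim
        (𝔹ₚ.not-¬ (trans (cong (lookup S) (sym (σf-injective e))) (trans (sym (α-closed sub x)) x?)) y?)
  ... | false | true = ⊥-elim
        (𝔹ₚ.not-¬ (trans (cong (lookup S) (σf-injective e)) (trans (sym (α-closed sub y)) y?)) x?)

  module MotionOrbit {S : Vec Bool n} (sub : Subgraph S) = Orbit (motion S) (motion-injective sub)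

  ⇝-motion : ∀ {S} h → h ⇝[ S ] motion S h
  ⇝-motion {S} h with lookup S h in h?
  ... | true = ⇝-trans (∈⇒⇝ h?) (≈⇒⇝ (≈-σ (α h)))
  ... | false = ≈⇒⇝ (≈-σ h)

  orbit⇒⇝ : ∀ {S} (sub : Subgraph S) {x y} → MotionOrbit._∼_ sub x y → x ⇝[ S ] y
  orbit⇒⇝ {S} sub {x} (k , refl) = iterate k
    where
    iterate : ∀ k → x ⇝[ S ] iter (motion S) k x
    iterate zero = ⇝-refl
    iterate (suc k) = ⇝-trans (iterate k) (⇝-motion _)

  -- The motion of S is that of del S b composed with the transposition of b and α b, so adding an
  -- edge between two components merges their orbits.
  module MergeOrbits {S : Vec Bool n} (sub : Subgraph S) {b : Fin n} (b∈ : lookup S b ≡ true)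
    (apart : reaches (del S b) b (α b) ≡ false)
    (⇝⇒orbit′ : ∀ {x y} → x ⇝[ del S b ] y → MotionOrbit._∼_ (del-subgraph {e = b} sub) x y) where

    private
      S′ : Vec Bool n
      S′ = del S b
      sub′ : Subgraph S′
      sub′ = del-subgraph sub
      open module O = MotionOrbit sub using (_∼_; ∼-refl; ∼-sym; ∼-trans)
      open module O′ = MotionOrbit sub′ using () renaming (_∼_ to _∼′_)

      b∉ : lookup S′ b ≡ false
      b∉ = ∉-del-self S b

      motion′ : ∀ {h} → h ≢ b → h ≢ α b → motion S′ h ≡ motion S h
      motion′ h≢b h≢αb = motion-cong {S′} {S} (del-≢ h≢b h≢αb)

      module _ {c : Fin n} (αc∈ : lookup S (α c) ≡ true) (c∉ : lookup S′ c ≡ false)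
        (agree : ∀ {h} → h ≢ c → h ≢ α c → motion S′ h ≡ motion S h) (c-apart : reaches S′ c (α c) ≡ false) where

        absorb-suc : ∀ k → α c ∼ iter (motion S′) (suc k) c
        absorb-suc zero = 1 , (begin
          motion S (α c)     ≡⟨ motion-∈ {S} αc∈ ⟩
          σf (α (α c))       ≡⟨ cong σf (α-invol c) ⟩
          σf c               ≡⟨ motion-∉ {S′} c∉ ⟨
          motion S′ c        ∎)
          where open ≡-Reasoning
        absorb-suc (suc k) with iter (motion S′) (suc k) c Finₚ.≟ c | iter (motion S′) (suc k) c Finₚ.≟ α c
        ... | yes returned | _ = subst (α c ∼_) (cong (motion S′) (sym returned)) (absorb-suc zero)
        ... | no _ | yes hits = ⊥-elim (𝔹ₚ.not-¬ (orbit⇒⇝ sub′ (suc k , hits)) c-apart)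
        ... | no ≢c | no ≢αc = ∼-trans (absorb-suc k) (1 , sym (agree ≢c ≢αc))

        absorb : ∀ {y} → c ⇝[ S′ ] y → α c ∼ y
        absorb r with ⇝⇒orbit′ r
        ... | suc k , refl = absorb-suc k
        ... | zero , refl = let m , _ , loop = O′.period c in subst (α c ∼_) loop (absorb-suc m)

      absorb-b : ∀ {y} → b ⇝[ S′ ] y → α b ∼ y
      absorb-b = absorb (trans (sym (α-closed sub b)) b∈) b∉ motion′ apart

      absorb-αb : ∀ {y} → α b ⇝[ S′ ] y → b ∼ y
      absorb-αb {y} r = subst (_∼ y) (α-invol b) (absorb
        (trans (cong (lookup S) (α-invol b)) b∈) (trans (sym (α-closed sub′ b)) b∉)
        (λ h≢αb h≢b → motion′ (λ e → h≢b (trans e (sym (α-invol b)))) h≢αb)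
        (≢true⇒false λ joined → 𝔹ₚ.not-¬ (⇝-sym sub′ (subst (α b ⇝[ S′ ]_) (α-invol b) joined)) apart) r)

      unaffected : ∀ {x y} → reaches S′ b x ≡ false → reaches S′ (α b) x ≡ false → x ∼′ y → x ∼ y
      unaffected {x} x∉b x∉αb (k , e) = k , trans (same k) e
        where
        same : ∀ k → iter (motion S) k x ≡ iter (motion S′) k x
        same zero = refl
        same (suc k) = trans (cong (motion S) (same k)) (sym (motion′ (avoids x∉b) (avoids x∉αb)))
          where
          avoids : ∀ {c} → reaches S′ c x ≡ false → iter (motion S′) k x ≢ c
          avoids c-apart hits = 𝔹ₚ.not-¬ (⇝-sym sub′ (orbit⇒⇝ sub′ (k , hits))) c-apart

      ⇝′⇒∼ : ∀ {x y} → x ⇝[ S′ ] y → x ∼ y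
      ⇝′⇒∼ {x} r with reaches S′ b x in from-b | reaches S′ (α b) x in from-αb
      ... | true | _ = ∼-trans (∼-sym (absorb-b from-b)) (absorb-b (⇝-trans from-b r))
      ... | false | true = ∼-trans (∼-sym (absorb-αb from-αb)) (absorb-αb (⇝-trans from-αb r))
      ... | false | false = unaffected from-b from-αb (⇝⇒orbit′ r)

      b∼αb : b ∼ α b
      b∼αb = ∼-sym (absorb-b ⇝-refl)

    ⇝⇒merged-orbit : ∀ {x y} → x ⇝[ S ] y → x ∼ y
    ⇝⇒merged-orbit {x} = ⇝-ind (x ∼_) ∼-refl (λ o v → ∼-trans o (⇝′⇒∼ (≈⇒⇝ v))) edge
      where
      edge : ∀ {y} → x ∼ y → lookup S y ≡ true → x ∼ α y
      edge {y} o y∈ with y Finₚ.≟ b | y Finₚ.≟ α b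
      ... | yes refl | _ = ∼-trans o b∼αb
      ... | no _ | yes refl = ∼-trans o (subst (α b ∼_) (sym (α-invol b)) (∼-sym b∼αb))
      ... | no ≢b | no ≢αb = ∼-trans o (⇝′⇒∼ (∈⇒⇝ (trans (del-≢ ≢b ≢αb) y∈)))

  forest-⇝⇒orbit : ∀ {F} (forest : Forest F) {x y} → x ⇝[ F ] y → MotionOrbit._∼_ (forest-subgraph forest) x y
  forest-⇝⇒orbit {F} forest = by-edges (numE F) forest refl
    where
    by-edges : ∀ k {F} (forest : Forest F) → numE F ≡ k → ∀ {x y} → x ⇝[ F ] y →
      MotionOrbit._∼_ (forest-subgraph forest) x y
    by-edges zero {F} forest e {x} = ⇝-ind (x ∼_) ∼-refl vertex
      (λ {y} _ y∈ → ⊥-elim (𝔹ₚ.not-¬ y∈ (no-edges y)))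
      where
      open MotionOrbit (forest-subgraph forest)
      no-edges : ∀ h → lookup F h ≡ false
      no-edges = numE≡0⇒∉ (forest-subgraph forest) e
      vertex : ∀ {y z} → x ∼ y → y ≈ z → x ∼ z
      vertex o v = let k , q = ≈⇒orbit v in ∼-trans o (k , trans (iter-cong (λ h → motion-∉ {F} (no-edges h)) k _) q)
    by-edges (suc k) {F} forest e with numE≡suc⇒∈ {F} e
    ... | b , b∈ = MergeOrbits.⇝⇒merged-orbit (forest-subgraph forest) b∈ (forest-bridge forest b∈)
          (by-edges k (forest-del forest b∈)
            (ℕₚ.suc-injective (trans (sym (numE-del (forest-subgraph forest) b∈)) e)))

  module Tour {T : Vec Bool n} (tree : Tree T) where

    subgraph : Subgraph T
    subgraph = tree-subgraph tree

    visit : ℕ → Fin n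
    visit k = iter (motion T) k h₀

    opaque
      time : Fin n → ℕ
      time = pos T

      time≡pos : ∀ x → time x ≡ pos T x
      time≡pos x = refl

      time-least : ∀ {x k} → k < n → visit k ≡ x → time x ≤ k × visit (time x) ≡ x
      time-least {k = k} k<n refl with takeWhileᵇ-applyUpTo (λ j → not (visit j == visit k)) id k<n
        (cong not (==-refl (visit k)))
      ... | least , found = least , ==⇒≡ (𝔹ₚ.not-injective found)

    visited : ∀ x → ∃ λ k → k < n × visit k ≡ x
    visited x = MotionOrbit.∼-bounded subgraph (forest-⇝⇒orbit (tree-forest tree) (tree-connected tree h₀ x))

    visit-time : ∀ x → visit (time x) ≡ x
    visit-time x = let k , k<n , e = visited x in proj₂ (time-least k<n e)

    time<n : ∀ x → time x < n
    time<n x = let k , k<n , e = visited x in ℕₚ.≤-<-trans (proj₁ (time-least k<n e)) k<n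

    time-injective : ∀ {x y} → time x ≡ time y → x ≡ y
    time-injective {x} {y} e = trans (sym (visit-time x)) (trans (cong visit e) (visit-time y))

    time-visit : ∀ {k} → k < n → time (visit k) ≡ k
    time-visit {k} k<n = trans (cong time (trans (cong visit (sym time-x)) (visit-time x))) time-x
      where
      timeᶠ : Fin n → Fin n
      timeᶠ x = fromℕ< (time<n x)
      surjective : ∃ λ x → timeᶠ x ≡ fromℕ< k<n
      surjective = injective⇒surjective (λ e → time-injective (Finₚ.fromℕ<-injective _ _ (time<n _) (time<n _) e))
        (fromℕ< k<n)
      x : Fin n
      x = proj₁ surjective
      time-x : time x ≡ k
      time-x = Finₚ.fromℕ<-injective _ _ (time<n x) k<n (proj₂ surjective)

    time-root : time h₀ ≡ 0
    time-root = time-visit (ℕₚ.≤-<-trans z≤n (time<n h₀))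

    time-motion : ∀ {x} → suc (time x) < n → time (motion T x) ≡ suc (time x)
    time-motion {x} lt = trans (cong (time ∘ motion T) (sym (visit-time x))) (time-visit lt)

    predecessor : ∀ {x k} → time x ≡ suc k → ∃ λ w → time w ≡ k × motion T w ≡ x
    predecessor {x} {k} e = visit k , time-visit (ℕₚ.<-trans (ℕₚ.n<1+n k) (subst (_< n) e (time<n x))) ,
      trans (cong visit (sym e)) (visit-time x)

    visit-n : visit n ≡ h₀
    visit-n with time (visit n) in e
    ... | zero = trans (sym (visit-time (visit n))) (cong visit e)
    ... | suc j = ⊥-elim (ℕₚ.<-irrefl (trans (sym (time-visit (ℕₚ.<-trans (ℕₚ.n<1+n j) 1+j<n)))
                    (trans (cong time (sym same)) (time-visit (ℕₚ.≤-reflexive 1+pred)))) j<pred)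
      where
      1+j<n : suc j < n
      1+j<n = subst (_< n) e (time<n (visit n))
      1+pred : suc (ℕ.pred n) ≡ n
      1+pred = ℕₚ.suc-pred n ⦃ ℕ.>-nonZero (ℕₚ.≤-<-trans z≤n 1+j<n) ⦄
      j<pred : j < ℕ.pred n
      j<pred = ℕₚ.≤-pred (subst (suc j <_) (sym 1+pred) 1+j<n)
      same : visit (ℕ.pred n) ≡ visit j
      same = motion-injective subgraph (begin
        visit (suc (ℕ.pred n))     ≡⟨ cong visit 1+pred ⟩
        visit n                    ≡⟨ visit-time (visit n) ⟨
        visit (time (visit n))     ≡⟨ cong visit e ⟩
        visit (suc j)              ∎)
        where open ≡-Reasoning

    time-comparable : ∀ x → time x < time (α x) ⊎ time (α x) < time x
    time-comparable = α-comparable time-injective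

    -- The first half-edge of an internal (κ = true) or external (κ = false) edge.
    record Half (κ : Bool) (b : Fin n) : Set where
      constructor half
      field
        kind  : lookup T b ≡ κ
        first : time b < time (α b)
    open Half public

    Internal External : Fin n → Set
    Internal = Half true
    External = Half false

    α-first : ∀ {x} → time (α x) < time x → time (α x) < time (α (α x))
    α-first {x} = subst (λ y → time (α x) < time y) (sym (α-invol x))

    first-half : ∀ x → ∃ λ h → SameEdge h x × Half (lookup T x) h
    first-half x with time-comparable x
    ... | inj₁ x<αx = x , inj₁ refl , half refl x<αx
    ... | inj₂ αx<x = α x , inj₂ refl , half (sym (α-closed subgraph x)) (α-first αx<x)

    half-elim : (Q : Fin n → Set) → (∀ {x} → Q (α x) → Q x) →
                (∀ {b} → Internal b → Q b) → (∀ {e} → External e → Q e) → ∀ x → Q x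
    half-elim Q Qα Q-internal Q-external x = let _ , h∼x , first-h = first-half x in from-half h∼x (by-kind first-h)
      where
      by-kind : ∀ {κ h} → Half κ h → Q h
      by-kind {true} = Q-internal
      by-kind {false} = Q-external
      from-half : ∀ {h} → SameEdge h x → Q h → Q x
      from-half (inj₁ refl) q = q
      from-half (inj₂ refl) q = Qα q

    half-unique : ∀ {κ κ′ x} → Half κ x → Half κ′ (α x) → ⊥
    half-unique {x = x} p q = ℕₚ.<-asym (first p) (subst (λ y → time (α x) < time y) (α-invol x) (first q))

    data Arrival (x : Fin n) : Set where
      at-root : time x ≡ 0 → Arrival x
      revisit : ∀ {y} → y ≈ x → time y < time x → Arrival x
      descend : ∀ {b} → Internal b → α b ≈ x → time x ≡ suc (time b) → Arrival x

    arrival-motion : ∀ w → time (motion T w) ≡ suc (time w) → Arrival (motion T w)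
    arrival-motion w next = cases (true⊎false (lookup T w)) (time-comparable w)
      where
      w<next : time w < time (motion T w)
      w<next = ℕₚ.≤-reflexive (sym next)
      cases : lookup T w ≡ true ⊎ lookup T w ≡ false → time w < time (α w) ⊎ time (α w) < time w →
        Arrival (motion T w)
      cases (inj₂ w∉) _ = revisit (subst (w ≈_) (sym (motion-∉ {T} w∉)) (≈-σ w)) w<next
      cases (inj₁ w∈) (inj₁ w<αw) = descend (half w∈ w<αw) (subst (α w ≈_) (sym (motion-∈ {T} w∈)) (≈-σ (α w))) next
      cases (inj₁ w∈) (inj₂ αw<w) = revisit (subst (α w ≈_) (sym (motion-∈ {T} w∈)) (≈-σ (α w)))
        (ℕₚ.<-trans αw<w w<next)

    arrival : ∀ x → Arrival x
    arrival x = by-time (time x) refl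
      where
      by-time : ∀ k → time x ≡ k → Arrival x
      by-time zero e = at-root e
      by-time (suc k) e = let w , time-w , next = predecessor e in
        subst Arrival next (arrival-motion w (trans (cong time next) (trans e (cong suc (sym time-w)))))

    time-rec : (Q : Fin n → Set) → (∀ x → (∀ {y} → time y < time x → Q y) → Q x) → ∀ x → Q x
    time-rec Q step x = by-acc x (<-wellFounded (time x))
      where
      by-acc : ∀ x → Acc _<_ (time x) → Q x
      by-acc x (acc rec) = step x (λ y<x → by-acc _ (rec y<x))

    at-root⇒≡ : ∀ {x} → time x ≡ 0 → h₀ ≡ x
    at-root⇒≡ e = time-injective (trans time-root (sym e))

    opaque
      -- For internal b, the component of T - {b, αb} that does not contain the root.
      subtree : Fin n → Fin n → Bool
      subtree b x = (time b <ᵇ time x) ∧ (time x ≤ᵇ time (α b))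

      subtree⁺ : ∀ {b x} → time b < time x → time x ≤ time (α b) → subtree b x ≡ true
      subtree⁺ b<x x≤αb = ∧⁺ (<ᵇ⁺ b<x) (≤ᵇ⁺ x≤αb)

      subtree-lower : ∀ {b x} → subtree b x ≡ true → time b < time x
      subtree-lower p = <ᵇ⁻ (∧⁻ˡ p)

      subtree-upper : ∀ {b x} → subtree b x ≡ true → time x ≤ time (α b)
      subtree-upper {b} {x} p = ≤ᵇ⁻ (∧⁻ʳ (time b <ᵇ time x) p)

    subtree-before : ∀ {b x} → time x ≤ time b → subtree b x ≡ false
    subtree-before x≤b = ≢true⇒false (λ p → ℕₚ.<⇒≱ (subtree-lower p) x≤b)

    ∉subtree-self : ∀ b → subtree b b ≡ false
    ∉subtree-self b = subtree-before ℕₚ.≤-refl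

    ∉subtree-root : ∀ b → subtree b h₀ ≡ false
    ∉subtree-root b = subtree-before (subst (_≤ time b) (sym time-root) z≤n)

    module _ {b : Fin n} (ib : Internal b) where

      α∈subtree : subtree b (α b) ≡ true
      α∈subtree = subtree⁺ (first ib) ℕₚ.≤-refl

      private
        T′ : Vec Bool n
        T′ = del T b

        subtree-motion : ∀ x → subtree b x ≡ true → subtree b (motion T′ x) ≡ true
        subtree-motion x x∈ with x Finₚ.≟ b | x Finₚ.≟ α b
        ... | yes refl | _ = ⊥-elim (𝔹ₚ.not-¬ x∈ (∉subtree-self b))
        ... | no _ | yes refl = subst (λ y → subtree b y ≡ true) (sym motion-αb)
                (subtree⁺ (ℕₚ.≤-reflexive (sym time-next)) (subst (_≤ time (α b)) (sym time-next) (first ib)))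
          where
          motion-αb : motion T′ (α b) ≡ motion T b
          motion-αb = trans (motion-∉ {T′} (trans (sym (α-closed (del-subgraph subgraph) b)) (∉-del-self T b)))
            (sym (motion-∈ {T} (kind ib)))
          time-next : time (motion T b) ≡ suc (time b)
          time-next = time-motion (ℕₚ.≤-<-trans (first ib) (time<n (α b)))
        ... | no x≢b | no x≢αb = subst (λ y → subtree b y ≡ true) (sym (motion-cong {T′} {T} (del-≢ x≢b x≢αb)))
                (subtree⁺ (subst (time b <_) (sym time-next) (ℕₚ.m<n⇒m<1+n (subtree-lower x∈)))
                          (subst (_≤ time (α b)) (sym time-next) x<αb))
          where
          x<αb : time x < time (α b)
          x<αb = ℕₚ.≤∧≢⇒< (subtree-upper x∈) (x≢αb ∘ time-injective)
          time-next : time (motion T x) ≡ suc (time x)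
          time-next = time-motion (ℕₚ.≤-<-trans x<αb (time<n (α b)))

        subtree-iter : ∀ k {x} → subtree b x ≡ true → subtree b (iter (motion T′) k x) ≡ true
        subtree-iter zero x∈ = x∈
        subtree-iter (suc k) x∈ = subtree-motion _ (subtree-iter k x∈)

        subtree-closed : ∀ {x y} → x ⇝[ T′ ] y → subtree b x ≡ true → subtree b y ≡ true
        subtree-closed r x∈ with forest-⇝⇒orbit (forest-del (tree-forest tree) (kind ib)) r
        ... | k , refl = subtree-iter k x∈

      subtree-⇝ : ∀ {x y} → x ⇝[ del T b ] y → subtree b x ≡ subtree b y
      subtree-⇝ r = true-ext (subtree-closed r) (subtree-closed (⇝-sym (del-subgraph subgraph) r))

      subtree-vertexSet : VertexSet (subtree b)
      subtree-vertexSet v = subtree-⇝ (≈⇒⇝ v)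

      subtree-edge : ∀ {f} → lookup T f ≡ true → f ≢ b → f ≢ α b → subtree b f ≡ subtree b (α f)
      subtree-edge f∈ f≢b f≢αb = subtree-⇝ (∈⇒⇝ (trans (del-≢ f≢b f≢αb) f∈))

      crossing-internal : ∀ {f} → Internal f → subtree b f ≢ subtree b (α f) → f ≡ b
      crossing-internal {f} if crosses with f Finₚ.≟ b | f Finₚ.≟ α b
      ... | yes f≡b | _ = f≡b
      ... | no _ | yes refl = ⊥-elim (half-unique ib if)
      ... | no f≢b | no f≢αb = ⊥-elim (crosses (subtree-edge (kind if) f≢b f≢αb))

    subtree-α-earlier : ∀ {b c} → Internal b → Internal c → time b < time c → subtree c (α b) ≡ false
    subtree-α-earlier ib ic b<c = trans (sym (subtree-edge ic (kind ib) (λ { refl → ℕₚ.<-irrefl refl b<c })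
      (λ { refl → half-unique ic ib }))) (subtree-before (ℕₚ.<⇒≤ b<c))

    SplitsOff : (Fin n → Bool) → Fin n → Fin n → Fin n → Set
    SplitsOff X f p q = subtree f p ≡ true × subtree f q ≡ false × X (α f) ≡ X p × X f ≡ X q

    -- An edge of the tree path from p to q whose ends lie on the same sides of X as p and q.
    Separating : (Fin n → Bool) → Fin n → Fin n → Fin n → Set
    Separating X p q f = Internal f × (SplitsOff X f p q ⊎ SplitsOff X f q p)

    private
      module _ {X : Fin n → Bool} where

        separating-sym : ∀ {p q f} → Separating X p q f → Separating X q p f
        separating-sym (if , splits) = if , swap splits

        separating-move : ∀ {p p′ q f} → X p ≡ X p′ → subtree f p ≡ subtree f p′ → Separating X p q f →
          Separating X p′ q f
        separating-move e e′ (if , inj₁ (a , b , c , d)) = if , inj₁ (trans (sym e′) a , b , trans c e , d)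
        separating-move e e′ (if , inj₂ (a , b , c , d)) = if , inj₂ (a , trans (sym e′) b , c , trans d e)

        separating-later : VertexSet X → ∀ {p q} → time q < time p →
          (∀ {p′} → time p′ < time p → X p′ ≡ not (X q) → ∃ (Separating X p′ q)) → X p ≡ not (X q) →
            ∃ (Separating X p q)
        separating-later vs {p} {q} q<p recurse X≠ with arrival p
        ... | at-root p≡0 = ⊥-elim (ℕₚ.n≮0 (subst (time q <_) p≡0 q<p))
        ... | revisit y≈p y<p = let f , s = recurse y<p (trans (vs y≈p) X≠) in
                f , separating-move (vs y≈p) (subtree-vertexSet (proj₁ s) y≈p) s
        ... | descend {b} ib αb≈p p≡1+b with X b 𝔹ₚ.≟ X p
        ... | no Xb≢Xp = b , ib , inj₁
                ( trans (sym (subtree-vertexSet ib αb≈p)) (α∈subtree ib)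
                , subtree-before (ℕₚ.≤-pred (subst (time q <_) p≡1+b q<p)) , vs αb≈p
                , 𝔹ₚ.not-injective (trans (sym (𝔹ₚ.¬-not (Xb≢Xp ∘ sym))) X≠) )
        ... | yes Xb≡Xp with recurse (ℕₚ.≤-reflexive (sym p≡1+b)) (trans Xb≡Xp X≠)
        ... | f , s = f , separating-move Xb≡Xp (trans (subtree-edge (proj₁ s) (kind ib) b≢f b≢αf)
                            (subtree-vertexSet (proj₁ s) αb≈p)) s
          where
          q≤b : time q ≤ time b
          q≤b = ℕₚ.≤-pred (subst (time q <_) p≡1+b q<p)
          b≢f : b ≢ f
          b≢f refl with proj₂ s
          ... | inj₁ (b∈ , _) = 𝔹ₚ.not-¬ b∈ (∉subtree-self b)
          ... | inj₂ (q∈ , _) = 𝔹ₚ.not-¬ q∈ (subtree-before q≤b)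
          b≢αf : b ≢ α f
          b≢αf refl = half-unique (proj₁ s) ib

    separating-edge : ∀ X → VertexSet X → ∀ p q → X p ≡ not (X q) → ∃ (Separating X p q)
    separating-edge X vs p q = by-time p q (<-wellFounded (time p + time q))
      where
      by-time : ∀ p q → Acc _<_ (time p + time q) → X p ≡ not (X q) → ∃ (Separating X p q)
      by-time p q (acc rec) X≠ with ℕₚ.<-cmp (time p) (time q)
      ... | tri≈ _ e _ = ⊥-elim (𝔹ₚ.not-¬ refl (subst (λ z → X z ≡ not (X q)) (time-injective e) X≠))
      ... | tri> _ _ q<p = separating-later vs q<p (λ p′<p → by-time _ q (rec (ℕₚ.+-monoˡ-< (time q) p′<p))) X≠
      ... | tri< p<q _ _ = let f , s = separating-later vs p<q recurse (not-sym X≠) in f , separating-sym s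
        where
        recurse : ∀ {q′} → time q′ < time q → X q′ ≡ not (X p) → ∃ (Separating X q′ p)
        recurse q′<q X≠′ =
          let f , s = by-time p _ (rec (ℕₚ.+-monoʳ-< (time p) q′<q)) (not-sym X≠′) in f , separating-sym s

  opaque
    unfolding add

    removeAdd≡ : ∀ T e e′ → removeAdd T e e′ ≡ add (del T e) e′
    removeAdd≡ T e e′ = tabulate-cong (λ h → cong (_∨ sameEdge h e′) (sym (lookup∘tabulate _ h)))

    addRemove≡ : ∀ T e e′ → addRemove T e e′ ≡ del (add T e) e′
    addRemove≡ T e e′ = tabulate-cong (λ h → cong (_∧ not (sameEdge h e′)) (sym (lookup∘tabulate _ h)))

  module Fundamental {T : Vec Bool n} (tree : Tree T) where
    open Tour tree public

    opaque
      unfolding time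

      inFund : Fin n → Fin n → Bool
      inFund = fund T

      rank : Fin n → ℕ
      rank = edgeRank T

      isActive : Fin n → Bool
      isActive = active T

      rank≡edgeRank : ∀ e → rank e ≡ edgeRank T e
      rank≡edgeRank e = refl

      isActive≡active : ∀ e → isActive e ≡ active T e
      isActive≡active e = refl

      meets : Vec Bool n → Fin n → Bool
      meets S h = any (λ h′ → inFund h h′ ∧ (lookup S h′ xor lookup T h′)) H

      meets⁺ : ∀ {S h h′} → inFund h h′ ≡ true → lookup S h′ xor lookup T h′ ≡ true → meets S h ≡ true
      meets⁺ {h′ = h′} p q = anyFin⁺ _ h′ (∧⁺ p q)

      meets⁻ : ∀ {S h} → meets S h ≡ true → ∃ λ h′ → inFund h h′ ≡ true × lookup S h′ xor lookup T h′ ≡ true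
      meets⁻ {S} {h} m =
        let h′ , q = anyFin⁻ (λ h′ → inFund h h′ ∧ (lookup S h′ xor lookup T h′)) m in h′ , ∧⁻ˡ q , ∧⁻ʳ (inFund h h′) q

      Φ-lookup : ∀ S h → lookup (Φ T S) h ≡
        not ((time h <ᵇ time (α h)) xor (if lookup T h then not (meets S h) else meets S h))
      Φ-lookup S h = lookup∘tabulate _ h

      inFund-internal : ∀ {b} g → lookup T b ≡ true → inFund b g ≡ isSpanningTree (add (del T b) g)
      inFund-internal {b} g b∈ = trans (cong (if_then inFundCocycle T b g else inFundCycle T b g) b∈)
        (cong isSpanningTree (removeAdd≡ T b g))

      inFund-external : ∀ {e} f → lookup T e ≡ false → inFund e f ≡ isSpanningTree (del (add T e) f)
      inFund-external {e} f e∉ = trans (cong (if_then inFundCocycle T e f else inFundCycle T e f) e∉)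
        (cong isSpanningTree (addRemove≡ T e f))

      inFund-αˡ : ∀ e f → inFund e f ≡ inFund (α e) f
      inFund-αˡ e f rewrite α-closed subgraph e with lookup T (α e)
      ... | true = cong isSpanningTree (tabulate-cong λ h → cong (λ b → (lookup T h ∧ not b) ∨ sameEdge h f)
            (sym (sameEdge-αʳ h e)))
      ... | false = cong isSpanningTree (tabulate-cong λ h → cong (λ b → (lookup T h ∨ b) ∧ not (sameEdge h f))
            (sym (sameEdge-αʳ h e)))

      meets-α : ∀ S → EdgePredicate (meets S)
      meets-α S h = cong or (Listₚ.map-cong (λ h′ → cong (_∧ (lookup S h′ xor lookup T h′)) (inFund-αˡ h h′)) H)

      inFund-αʳ : ∀ e f → inFund e f ≡ inFund e (α f)
      inFund-αʳ e f with lookup T e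
      ... | true = cong isSpanningTree (tabulate-cong λ h → cong ((lookup T h ∧ not (sameEdge h e)) ∨_)
            (sym (sameEdge-αʳ h f)))
      ... | false = cong isSpanningTree (tabulate-cong λ h → cong (λ b → (lookup T h ∨ sameEdge h e) ∧ not b)
            (sym (sameEdge-αʳ h f)))

      rank-α : ∀ e → rank e ≡ rank (α e)
      rank-α e rewrite α-invol e = ℕₚ.⊓-comm (time e) (time (α e))

      rank-first : ∀ {κ b} → Half κ b → rank b ≡ time b
      rank-first fb = ℕₚ.m≤n⇒m⊓n≡m (ℕₚ.<⇒≤ (first fb))

      isActive-α : ∀ e → isActive e ≡ isActive (α e)
      isActive-α e = cong and
        (Listₚ.map-cong (λ f → cong₂ (λ a b → not a ∨ (b ≤ᵇ rank f)) (inFund-αˡ e f) (rank-α e)) H)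

      active⇒rank≤ : ∀ {e f} → isActive e ≡ true → inFund e f ≡ true → rank e ≤ rank f
      active⇒rank≤ {e} {f} act f∈ = ≤ᵇ⁻ (implies⁻ (allFin⁻ (λ f → not (inFund e f) ∨ (rank e ≤ᵇ rank f)) act f) f∈)

      inactive⇒rank> : ∀ {e} → isActive e ≡ false → ∃ λ f → inFund e f ≡ true × rank f < rank e
      inactive⇒rank> {e} inactive =
        let f , p = ¬allFin⁻ (λ f → not (inFund e f) ∨ (rank e ≤ᵇ rank f)) inactive
            f∈ , rank> = ¬implies⁻ {inFund e f} p in f , f∈ , ≰ᵇ⁻ rank>

    Crosses : Fin n → Fin n → Set
    Crosses b g = subtree b g ≡ not (subtree b (α g))

    crosses-α : ∀ {b g} → Crosses b g → Crosses b (α g)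
    crosses-α {b} {g} c = trans (not-sym c) (cong (not ∘ subtree b) (sym (α-invol g)))

    sameEdge-crosses : ∀ {b g h} → SameEdge h g → Crosses b g → Crosses b h
    sameEdge-crosses (inj₁ refl) c = c
    sameEdge-crosses {g = g} (inj₂ refl) c = crosses-α {g = g} c

    self-crosses : ∀ {b} → Internal b → Crosses b b
    self-crosses {b} ib = trans (∉subtree-self b) (cong not (sym (α∈subtree ib)))

    internal-crosses⇒≡ : ∀ {b f} → Internal b → Internal f → Crosses b f → f ≡ b
    internal-crosses⇒≡ ib if c = crossing-internal ib if (𝔹ₚ.not-¬ refl ∘ λ same → trans (sym same) c)

    module _ {b : Fin n} (ib : Internal b) where

      exchange-tree : ∀ {g} → Crosses b g → Tree (add (del T b) g)
      exchange-tree {g} c = let forest⁺ , comp = forest-add forest⁻ apart in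
        mkTree forest⁺ (ℕₚ.suc-injective (trans (sym comp) numComp⁻))
        where
        forest⁻ : Forest (del T b)
        forest⁻ = forest-del (tree-forest tree) (kind ib)
        numComp⁻ : numComp (del T b) ≡ 2
        numComp⁻ = ℕₚ.+-cancelˡ-≡ (numE (del T b)) _ _ (begin
          numE (del T b) + numComp (del T b)   ≡⟨ forest-size forest⁻ ⟩
          numV                                 ≡⟨ tree-size tree ⟨
          numE T + 1                           ≡⟨ cong (_+ 1) (numE-del subgraph (kind ib)) ⟩
          suc (numE (del T b)) + 1             ≡⟨ ℕₚ.+-suc _ 1 ⟨
          numE (del T b) + 2                   ∎)
          where open ≡-Reasoning
        apart : reaches (del T b) g (α g) ≡ false
        apart = ≢true⇒false (λ r → 𝔹ₚ.not-¬ (subtree-⇝ ib r) c)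

      exchange-crosses : ∀ {g} → Tree (add (del T b) g) → Crosses b g
      exchange-crosses {g} tree′ = 𝔹ₚ.¬-not λ same →
        𝔹ₚ.not-¬ (α∈subtree ib)
          (trans (sym (⇝-uncut {X = subtree b} (subtree-vertexSet ib) (uncut same) (tree-connected tree′ b (α b))))
            (∉subtree-self b))
        where
        uncut : subtree b g ≡ subtree b (α g) → Uncut (add (del T b) g) (subtree b)
        uncut same {h} h∈ with ∈-add⁻ h∈
        ... | inj₁ h∈⁻ = subtree-⇝ ib (∈⇒⇝ h∈⁻)
        ... | inj₂ (inj₁ refl) = same
        ... | inj₂ (inj₂ refl) = trans (sym same) (cong (subtree b) (sym (α-invol g)))

      fundCocycle⁺ : ∀ {g} → Crosses b g → inFund b g ≡ true
      fundCocycle⁺ {g} c = trans (inFund-internal g (kind ib)) (isSpanningTree⁺ (exchange-tree c))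

      fundCocycle⁻ : ∀ {g} → inFund b g ≡ true → Crosses b g
      fundCocycle⁻ {g} p = exchange-crosses (isSpanningTree⁻ (trans (sym (inFund-internal g (kind ib))) p))

    private
      ∉-sameEdge : ∀ {e} → External e → ∀ {h} → SameEdge h e → lookup T h ≡ false
      ∉-sameEdge ee same = trans (sameEdge-resp (α-closed subgraph) same) (kind ee)

      lookup-del-add : ∀ e f h → lookup (del (add T e) f) h ≡ (lookup T h ∨ sameEdge h e) ∧ not (sameEdge h f)
      lookup-del-add e f h = trans (lookup-del (add T e) f h) (cong (_∧ not (sameEdge h f)) (lookup-add T e h))

      del-add-self : ∀ {e f} → External e → sameEdge f e ≡ true → del (add T e) f ≡ T
      del-add-self {e} {f} ee f∼e = lookup-ext λ h → trans (lookup-del-add e f h) (restore h)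
        where
        restore : ∀ h → (lookup T h ∨ sameEdge h e) ∧ not (sameEdge h f) ≡ lookup T h
        restore h rewrite sameEdge-congʳ f e f∼e h with sameEdge h e in h∼e
        ... | true = trans (𝔹ₚ.∧-zeroʳ _) (sym (∉-sameEdge ee (sameEdge⁻ h e h∼e)))
        ... | false = trans (𝔹ₚ.∧-identityʳ _) (𝔹ₚ.∨-identityʳ _)

      del-add-comm : ∀ {e f} → sameEdge f e ≡ false → del (add T e) f ≡ add (del T f) e
      del-add-comm {e} {f} f≁e = lookup-ext λ h → trans (lookup-del-add e f h)
        (trans (commute h) (sym (trans (lookup-add (del T f) e h) (cong (_∨ sameEdge h e) (lookup-del T f h)))))
        where
        commute : ∀ h → (lookup T h ∨ sameEdge h e) ∧ not (sameEdge h f) ≡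
          (lookup T h ∧ not (sameEdge h f)) ∨ sameEdge h e
        commute h with sameEdge h e in h∼e | sameEdge h f in h∼f
        ... | false | _ = trans (cong (_∧ _) (𝔹ₚ.∨-identityʳ (lookup T h))) (sym (𝔹ₚ.∨-identityʳ _))
        ... | true | false = trans (𝔹ₚ.∧-identityʳ _) (trans (𝔹ₚ.∨-zeroʳ (lookup T h)) (sym (𝔹ₚ.∨-zeroʳ _)))
        ... | true | true = ⊥-elim (𝔹ₚ.not-¬ (trans (sym (sameEdge-congʳ h e h∼e f)) (sameEdge-sym h f h∼f)) f≁e)

      -- Removing an edge outside the tree leaves T + e, which has too many edges.
      external-not-exchangeable : ∀ {e f} → External e → lookup T f ≡ false → sameEdge f e ≡ false →
        Tree (del (add T e) f) → ⊥
      external-not-exchangeable {e} {f} ee f∉ f≁e tree′ = ℕₚ.1+n≢n (begin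
        suc (numE T)              ≡⟨ numE-add subgraph (kind ee) ⟨
        numE (add T e)            ≡⟨ cong numE (lookup-ext {v = del (add T e) f} {add T e} same) ⟨
        numE (del (add T e) f)    ≡⟨ ℕₚ.+-cancelʳ-≡ 1 _ _ (trans (tree-size tree′) (sym (tree-size tree))) ⟩
        numE T                    ∎)
        where
        open ≡-Reasoning
        f∉⁺ : lookup (add T e) f ≡ false
        f∉⁺ = trans (lookup-add T e f) (trans (cong (_∨ sameEdge f e) f∉) f≁e)
        same : ∀ h → lookup (del (add T e) f) h ≡ lookup (add T e) h
        same h rewrite lookup-del (add T e) f h with sameEdge h f in h∼f
        ... | true = trans (𝔹ₚ.∧-zeroʳ _) (sym (trans (edge-∈ (add-subgraph subgraph) h f h∼f) f∉⁺))
        ... | false = 𝔹ₚ.∧-identityʳ _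

    module _ {e : Fin n} (ee : External e) where

      external≢internal : ∀ {f} → lookup T f ≡ true → sameEdge f e ≡ false
      external≢internal {f} f∈ = ≢true⇒false (λ f∼e → 𝔹ₚ.not-¬ f∈ (∉-sameEdge ee (sameEdge⁻ f e f∼e)))

      exchange-tree-external : ∀ {f} → Internal f → Crosses f e → Tree (del (add T e) f)
      exchange-tree-external if c = subst Tree (sym (del-add-comm (external≢internal (kind if)))) (exchange-tree if c)

      fundCycle⁺ : ∀ {f} → Internal f → Crosses f e → inFund e f ≡ true
      fundCycle⁺ {f} if c = trans (inFund-external f (kind ee)) (isSpanningTree⁺ (exchange-tree-external if c))

      fundCycle⁻ : ∀ {f} → inFund e f ≡ true → SameEdge f e ⊎ (∃ λ b → SameEdge b f × Internal b × Crosses b e)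
      fundCycle⁻ {f} p = cases (sameEdge f e) refl (first-half f) (lookup T f) refl
        where
        tree-at : ∀ {b} → SameEdge b f → Tree (del (add T e) b)
        tree-at {b} b∼f = isSpanningTree⁻
          (trans (sym (inFund-external b (kind ee))) (trans (sameEdge-resp (inFund-αʳ e) b∼f) p))
        cases : ∀ s → sameEdge f e ≡ s → (∃ λ b → SameEdge b f × Half (lookup T f) b) → ∀ t → lookup T f ≡ t →
                SameEdge f e ⊎ (∃ λ b → SameEdge b f × Internal b × Crosses b e)
        cases true f∼e _ _ _ = inj₁ (sameEdge⁻ f e f∼e)
        cases false f≁e _ false f∉ = ⊥-elim (external-not-exchangeable ee f∉ f≁e (tree-at (inj₁ refl)))
        cases false _ (b , b∼f , fb) true f∈ = inj₂ (b , b∼f , ib ,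
          exchange-crosses ib (subst Tree (del-add-comm (external≢internal (kind ib))) (tree-at b∼f)))
          where
          ib : Internal b
          ib = subst (λ κ → Half κ b) f∈ fb

      fundCycle-self : inFund e e ≡ true
      fundCycle-self = trans (inFund-external e (kind ee))
        (isSpanningTree⁺ (subst Tree (sym (del-add-self ee (sameEdge-refl e))) tree))

    inFund-self : ∀ e → inFund e e ≡ true
    inFund-self = half-elim (λ e → inFund e e ≡ true) (λ {e} p → trans (trans (inFund-αˡ e e) (inFund-αʳ (α e) e)) p)
      (λ ib → fundCocycle⁺ ib (self-crosses ib)) fundCycle-self

    -- A tree edge f and an external edge g in each other's fundamental cocycle and cycle, by which
    -- of the two the tour meets first.
    _≺×_ _≻×_ : Fin n → Fin n → Set
    f ≺× g = subtree f g ≡ true × subtree f (α g) ≡ false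
    f ≻× g = subtree f g ≡ false × subtree f (α g) ≡ true

    ≺×⇒crosses : ∀ {f g} → f ≺× g → Crosses f g
    ≺×⇒crosses (p , q) = trans p (cong not (sym q))

    ≻×⇒crosses : ∀ {f g} → f ≻× g → Crosses f g
    ≻×⇒crosses (p , q) = trans p (cong not (sym q))

    ≺×⇒< : ∀ {f g} → f ≺× g → time f < time g
    ≺×⇒< (p , _) = subtree-lower p

    ≻×⇒< : ∀ {f g} → Internal f → External g → f ≻× g → time g < time f
    ≻×⇒< {f} {g} if eg (p , q) = ℕₚ.≤∧≢⇒<
      (ℕₚ.≮⇒≥ (λ f<g → 𝔹ₚ.not-¬ (subtree⁺ f<g (ℕₚ.≤-trans (ℕₚ.<⇒≤ (first eg)) (subtree-upper q))) p))
      (λ e → 𝔹ₚ.not-¬ (kind if) (trans (cong (lookup T) (sym (time-injective e))) (kind eg)))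

    internal-active : ∀ {f g} → Internal f → External g → isActive f ≡ true → f ≻× g → ⊥
    internal-active if eg act c = ℕₚ.<⇒≱ (≻×⇒< if eg c)
      (subst₂ _≤_ (rank-first if) (rank-first eg) (active⇒rank≤ act (fundCocycle⁺ if (≻×⇒crosses c))))

    external-active : ∀ {f g} → Internal f → External g → isActive g ≡ true → f ≺× g → ⊥
    external-active if eg act c = ℕₚ.<⇒≱ (≺×⇒< c)
      (subst₂ _≤_ (rank-first eg) (rank-first if) (active⇒rank≤ act (fundCycle⁺ eg if (≺×⇒crosses c))))

    internal-inactive : ∀ {f} → Internal f → isActive f ≡ false → ∃ λ g → External g × f ≻× g
    internal-inactive {f} if inactive with inactive⇒rank> inactive
    ... | h , h∈ , h<f with first-half h
    ... | g , g∼h , fg = by-kind fg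
      where
      crosses : Crosses f g
      crosses = sameEdge-crosses g∼h (fundCocycle⁻ if h∈)
      g<f : rank g < rank f
      g<f = subst (_< rank f) (sym (sameEdge-resp rank-α g∼h)) h<f
      by-kind : ∀ {κ} → Half κ g → ∃ λ g → External g × f ≻× g
      by-kind {true} ig = ⊥-elim (ℕₚ.<-irrefl (cong rank (internal-crosses⇒≡ if ig crosses)) g<f)
      by-kind {false} eg with ≡not-cases crosses
      ... | inj₁ f≺g = ⊥-elim (ℕₚ.<-asym (≺×⇒< f≺g) (subst₂ _<_ (rank-first eg) (rank-first if) g<f))
      ... | inj₂ f≻g = g , eg , f≻g

    external-inactive : ∀ {g} → External g → isActive g ≡ false → ∃ λ f → Internal f × f ≺× g
    external-inactive {g} eg inactive with inactive⇒rank> inactive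
    ... | h , h∈ , h<g with fundCycle⁻ eg h∈
    ... | inj₁ h∼g = ⊥-elim (ℕₚ.<-irrefl (sameEdge-resp rank-α h∼g) h<g)
    ... | inj₂ (f , f∼h , if , crosses) with ≡not-cases crosses
    ... | inj₁ f≺g = f , if , f≺g
    ... | inj₂ f≻g = ⊥-elim (ℕₚ.<-asym (≻×⇒< if eg f≻g)
            (subst₂ _<_ (trans (sym (sameEdge-resp rank-α f∼h)) (rank-first if)) (rank-first eg) h<g))

    time-≢ : ∀ {x y k} → time y ≤ k → k < time x → x ≢ y
    time-≢ y≤k k<x refl = ℕₚ.<⇒≱ k<x y≤k

    exchange-inactive : ∀ {κ h} → Half κ h → isActive h ≡ false →
      ∃ λ T′ → Tree T′ × lookup T′ h ≡ not κ × (∀ {x} → time (α h) < time x → lookup T x ≡ lookup T′ x)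
    exchange-inactive {true} {h} ih inactive with internal-inactive ih inactive
    ... | g , eg , h≻g = add (del T h) g , exchange-tree ih (≻×⇒crosses h≻g) , trans (add-≢ h≢g h≢αg)
          (∉-del-self T h) ,
        λ after → sym (trans (add-≢ (time-≢ g<αh after) (time-≢ αg≤αh after))
          (del-≢ (time-≢ (ℕₚ.<⇒≤ (first ih)) after) (time-≢ ℕₚ.≤-refl after)))
      where
      h≢g : h ≢ g
      h≢g refl = 𝔹ₚ.not-¬ (kind ih) (kind eg)
      h≢αg : h ≢ α g
      h≢αg refl = 𝔹ₚ.not-¬ (trans (α-closed subgraph g) (kind ih)) (kind eg)
      αg≤αh : time (α g) ≤ time (α h)
      αg≤αh = subtree-upper (proj₂ h≻g)
      g<αh : time g ≤ time (α h)
      g<αh = ℕₚ.≤-trans (ℕₚ.<⇒≤ (first eg)) αg≤αh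
    exchange-inactive {false} {h} eh inactive with external-inactive eh inactive
    ... | f , if , f≺h = del (add T h) f , exchange-tree-external eh if (≺×⇒crosses f≺h) , trans (del-≢ h≢f h≢αf)
          (∈-add-self T h) ,
        λ after → sym (trans (del-≢ (time-≢ f≤αh after) (time-≢ αf≤αh after))
          (add-≢ (time-≢ (ℕₚ.<⇒≤ (first eh)) after) (time-≢ ℕₚ.≤-refl after)))
      where
      h≢f : h ≢ f
      h≢f refl = 𝔹ₚ.not-¬ (kind if) (kind eh)
      h≢αf : h ≢ α f
      h≢αf refl = 𝔹ₚ.not-¬ (kind if) (trans (α-closed subgraph f) (kind eh))
      αf≤αh : time (α f) ≤ time (α h)
      αf≤αh = ℕₚ.≮⇒≥ λ αh<αf →
        𝔹ₚ.not-¬ (subtree⁺ (ℕₚ.<-trans (≺×⇒< f≺h) (first eh)) (ℕₚ.<⇒≤ αh<αf)) (proj₂ f≺h)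
      f≤αh : time f ≤ time (α h)
      f≤αh = ℕₚ.≤-trans (ℕₚ.<⇒≤ (first if)) αf≤αh

  record Interval (T S : Vec Bool n) : Set where
    constructor mkInterval
    field
      interval-tree : Tree T
      interval-subgraph : Subgraph S
      toggled-active : ∀ {h} → lookup S h xor lookup T h ≡ true → active T h ≡ true
  open Interval public

  inInterval⁻ : ∀ {T S} → inInterval T S ≡ true → Interval T S
  inInterval⁻ {T} {S} p = mkInterval (isSpanningTree⁻ {T} (∧⁻ˡ p)) (isSubgraph⁻ S (∧⁻ˡ q))
    (λ {h} → implies⁻ (allFin⁻ (λ h → not (lookup S h xor lookup T h) ∨ active T h) (∧⁻ʳ (isSubgraph S) q) h))
    where
    q : isSubgraph S ∧ all (λ h → not (lookup S h xor lookup T h) ∨ active T h) H ≡ true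
    q = ∧⁻ʳ (isSpanningTree T) p

  inInterval⁺ : ∀ {T S} → Interval T S → inInterval T S ≡ true
  inInterval⁺ {T} {S} iv = ∧⁺ (isSpanningTree⁺ (interval-tree iv)) (∧⁺ (isSubgraph⁺ (interval-subgraph iv))
    (allFin⁺ _ (λ h → implies⁺ {lookup S h xor lookup T h} (toggled-active iv))))

  record Preimage (T S O : Vec Bool n) : Set where
    constructor mkPreimage
    field
      interval : Interval T S
      Φ-image : Φ T S ≡ O
  open Preimage public

  module Orientation {T S O : Vec Bool n} (π : Preimage T S O) where
    open Fundamental (interval-tree (interval π)) public

    subgraph-S : Subgraph S
    subgraph-S = interval-subgraph (interval π)

    toggled : Fin n → Bool
    toggled h = lookup S h xor lookup T h

    toggled-α : EdgePredicate toggled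
    toggled-α h = cong₂ _xor_ (α-closed subgraph-S h) (α-closed subgraph h)

    toggled⇒active : ∀ {h} → toggled h ≡ true → isActive h ≡ true
    toggled⇒active {h} t = trans (isActive≡active h) (toggled-active (interval π) t)

    meetsToggled : Fin n → Bool
    meetsToggled = meets S

    O-lookup : ∀ h → lookup O h ≡
      not ((time h <ᵇ time (α h)) xor (if lookup T h then not (meetsToggled h) else meetsToggled h))
    O-lookup h = trans (cong (λ O → lookup O h) (sym (Φ-image π))) (Φ-lookup S h)

    O-α : ∀ h → lookup O h ≡ not (lookup O (α h))
    O-α h = begin
      lookup O h                      ≡⟨ O-lookup h ⟩
      not (earlier h xor reversed h)              ≡⟨ 𝔹ₚ.not-distribˡ-xor (earlier h) (reversed h) ⟩
      not (earlier h) xor reversed h              ≡⟨ cong₂ _xor_ (sym (α-reverses time-injective h)) reversed-α ⟩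
      earlier (α h) xor reversed (α h)            ≡⟨ 𝔹ₚ.not-involutive _ ⟨
      not (not (earlier (α h) xor reversed (α h)))  ≡⟨ cong not (O-lookup (α h)) ⟨
      not (lookup O (α h))            ∎
      where
      open ≡-Reasoning
      earlier reversed : Fin n → Bool
      earlier h = time h <ᵇ time (α h)
      reversed h = if lookup T h then not (meetsToggled h) else meetsToggled h
      reversed-α : reversed h ≡ reversed (α h)
      reversed-α = cong₂ (λ t m → if t then not m else m) (α-closed subgraph h) (meets-α S h)

    O-antisym : ∀ {h} → lookup O h ≡ true → lookup O (α h) ≡ true → ⊥
    O-antisym {h} p q = 𝔹ₚ.not-¬ p (trans (O-α h) (cong not q))

    O-first : ∀ {κ b} → Half κ b → lookup O b ≡ (if κ then not (meetsToggled b) else meetsToggled b)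
    O-first {b = b} fb rewrite O-lookup b | kind fb | <ᵇ⁺ (first fb) = 𝔹ₚ.not-involutive _

    O-internal-α : ∀ {b} → Internal b → lookup O (α b) ≡ meetsToggled b
    O-internal-α ib = sym (𝔹ₚ.not-injective (trans (sym (O-first ib)) (O-α _)))

    O-external-α : ∀ {e} → External e → lookup O (α e) ≡ not (meetsToggled e)
    O-external-α ee = trans (not-sym (O-α _)) (cong not (O-first ee))

    meetsToggled-self : ∀ {h} → toggled h ≡ true → meetsToggled h ≡ true
    meetsToggled-self {h} = meets⁺ (inFund-self h)

    cocycle-meetsToggled⁻ : ∀ {b} → Internal b → meetsToggled b ≡ true →
                            toggled b ≡ true ⊎ (∃ λ a → External a × toggled a ≡ true × b ≻× a)
    cocycle-meetsToggled⁻ {b} ib m with meets⁻ m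
    ... | h , h∈ , h-toggled with first-half h
    ... | a , a∼h , fa = by-kind fa
      where
      crosses : Crosses b a
      crosses = sameEdge-crosses a∼h (fundCocycle⁻ ib h∈)
      a-toggled : toggled a ≡ true
      a-toggled = trans (sameEdge-resp toggled-α a∼h) h-toggled
      by-kind : ∀ {κ} → Half κ a → toggled b ≡ true ⊎ (∃ λ a → External a × toggled a ≡ true × b ≻× a)
      by-kind {true} ia = inj₁ (subst (λ h → toggled h ≡ true) (internal-crosses⇒≡ ib ia crosses) a-toggled)
      by-kind {false} ea with ≡not-cases crosses
      ... | inj₁ b≺a = ⊥-elim (external-active ib ea (toggled⇒active a-toggled) b≺a)
      ... | inj₂ b≻a = inj₂ (a , ea , a-toggled , b≻a)

    cycle-meetsToggled⁻ : ∀ {e} → External e → meetsToggled e ≡ true →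
                          toggled e ≡ true ⊎ (∃ λ b → Internal b × toggled b ≡ true × b ≺× e)
    cycle-meetsToggled⁻ {e} ee m with meets⁻ m
    ... | h , h∈ , h-toggled with fundCycle⁻ ee h∈
    ... | inj₁ h∼e = inj₁ (trans (sym (sameEdge-resp toggled-α h∼e)) h-toggled)
    ... | inj₂ (b , b∼h , ib , crosses) with ≡not-cases crosses
    ... | inj₁ b≺e = inj₂ (b , ib , trans (sameEdge-resp toggled-α b∼h) h-toggled , b≺e)
    ... | inj₂ b≻e = ⊥-elim
          (internal-active ib ee (toggled⇒active (trans (sameEdge-resp toggled-α b∼h) h-toggled)) b≻e)

    data InternalCase (b : Fin n) : Set where
      toggled-cut : toggled b ≡ true → lookup O (α b) ≡ true → InternalCase b
      downward    : toggled b ≡ false → lookup O b ≡ true → InternalCase b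
      on-cycle    : ∀ {a} → toggled b ≡ false → lookup O (α b) ≡ true → External a → toggled a ≡ true → b ≻× a →
        InternalCase b

    internal-case : ∀ {b} → Internal b → InternalCase b
    internal-case {b} ib with true⊎false (meetsToggled b) | true⊎false (toggled b)
    ... | inj₁ m | inj₁ t = toggled-cut t (trans (O-internal-α ib) m)
    ... | inj₂ ¬m | inj₁ t = ⊥-elim (𝔹ₚ.not-¬ (meetsToggled-self t) ¬m)
    ... | inj₂ ¬m | inj₂ ¬t = downward ¬t (trans (O-first ib) (cong not ¬m))
    ... | inj₁ m | inj₂ ¬t with cocycle-meetsToggled⁻ ib m
    ... | inj₁ t = ⊥-elim (𝔹ₚ.not-¬ t ¬t)
    ... | inj₂ (a , ea , a-toggled , b≻a) = on-cycle ¬t (trans (O-internal-α ib) m) ea a-toggled b≻a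

    data ExternalCase (e : Fin n) : Set where
      toggled-cycle : toggled e ≡ true → lookup O e ≡ true → ExternalCase e
      backward      : toggled e ≡ false → lookup O (α e) ≡ true → meetsToggled e ≡ false → ExternalCase e
      on-cocycle    : ∀ {b} → toggled e ≡ false → lookup O e ≡ true → Internal b → toggled b ≡ true → b ≺× e →
        ExternalCase e

    external-case : ∀ {e} → External e → ExternalCase e
    external-case {e} ee with true⊎false (meetsToggled e) | true⊎false (toggled e)
    ... | inj₁ m | inj₁ t = toggled-cycle t (trans (O-first ee) m)
    ... | inj₂ ¬m | inj₁ t = ⊥-elim (𝔹ₚ.not-¬ (meetsToggled-self t) ¬m)
    ... | inj₂ ¬m | inj₂ ¬t = backward ¬t (trans (O-external-α ee) (cong not ¬m)) ¬m
    ... | inj₁ m | inj₂ ¬t with cycle-meetsToggled⁻ ee m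
    ... | inj₁ t = ⊥-elim (𝔹ₚ.not-¬ t ¬t)
    ... | inj₂ (b , ib , b-toggled , b≺e) = on-cocycle ¬t (trans (O-first ee) m) ib b-toggled b≺e

    module _ {b : Fin n} (ib : Internal b) (b-toggled : toggled b ≡ true) where

      cut-outward : ∀ h → Crosses b h → lookup O h ≡ subtree b h
      cut-outward = half-elim (λ h → Crosses b h → lookup O h ≡ subtree b h)
        (λ {h} outward c → trans (O-α h) (trans (cong not (outward (crosses-α {g = h} c))) (sym c)))
        (λ ih c → by-equality (internal-crosses⇒≡ ib ih c))
        (λ eh c → by-order eh c (≡not-cases c))
        where
        by-equality : ∀ {h} → h ≡ b → lookup O h ≡ subtree b h
        by-equality refl = trans (O-first ib) (trans (cong not (meetsToggled-self b-toggled)) (sym (∉subtree-self b)))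
        by-order : ∀ {h} → External h → Crosses b h → b ≺× h ⊎ b ≻× h → lookup O h ≡ subtree b h
        by-order eh c (inj₁ b≺h) = trans (O-first eh) (trans (meets⁺ (fundCycle⁺ eh ib c) b-toggled)
          (sym (proj₁ b≺h)))
        by-order eh c (inj₂ b≻h) = ⊥-elim (internal-active ib eh (toggled⇒active b-toggled) b≻h)

      subtree-noEntry : NoEntry O (subtree b)
      subtree-noEntry {h} tail αh∈ = ≢false⇒true λ h∉ →
        𝔹ₚ.not-¬ tail (trans (cut-outward h (trans h∉ (cong not (sym αh∈)))) h∉)

      subtree-unreachable : ∀ {x y} → x ⇝[ O ] y → subtree b x ≡ false → subtree b y ≡ true → ⊥
      subtree-unreachable r x∉ y∈ = 𝔹ₚ.not-¬ (⇝-noEntry (subtree-vertexSet ib) subtree-noEntry r y∈) x∉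

    module _ {a : Fin n} (ea : External a) (a-toggled : toggled a ≡ true) where

      toggled-tail : lookup O a ≡ true
      toggled-tail = trans (O-first ea) (meetsToggled-self a-toggled)

      cycle-backward : ∀ {f} → Internal f → f ≻× a → lookup O (α f) ≡ true
      cycle-backward if f≻a = trans (O-internal-α if) (meets⁺ (fundCocycle⁺ if (≻×⇒crosses f≻a)) a-toggled)

      cycle-exit : ∀ X → VertexSet X → X (α a) ≡ true → X a ≡ false →
                   ∃ λ f → Internal f × f ≻× a × X (α f) ≡ true × X f ≡ false × lookup O (α f) ≡ true
      cycle-exit X vs αa∈ a∉ with separating-edge X vs (α a) a (trans αa∈ (cong not (sym a∉)))
      ... | f , if , inj₁ (αa-below , a-above , Xαf , Xf) =
              f , if , (a-above , αa-below) , trans Xαf αa∈ , trans Xf a∉ , cycle-backward if (a-above , αa-below)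
      ... | f , if , inj₂ (a-below , αa-above , _) =
              ⊥-elim (external-active if ea (toggled⇒active a-toggled) (a-below , αa-above))

      toggled-return : α a ⇝[ O ] a
      toggled-return = ≢false⇒true λ a-unreached →
        let f , _ , _ , αf-reached , f-unreached , tail =
              cycle-exit (reaches O (α a)) (reaches-vertexSet (α a)) ⇝-refl a-unreached
        in 𝔹ₚ.not-¬ (⇝-trans αf-reached (α∈⇒⇝ tail)) f-unreached

      module _ {g : Fin n} (ig : Internal g) (g≻a : g ≻× a) where

        private
          exit-is-g : ∀ {f} → Internal f → subtree g f ≡ false → subtree g (α f) ≡ true → f ≡ g
          exit-is-g if f∉ αf∈ = internal-crosses⇒≡ ig if (trans f∉ (cong not (sym αf∈)))

          reaches-a : g ⇝[ O ] a
          reaches-a = ≢false⇒true absurd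
            where
            X : Fin n → Bool
            X x = reaches O g x ∨ subtree g x
            absurd : reaches O g a ≡ false → ⊥
            absurd a-unreached with cycle-exit X (λ v → cong₂ _∨_ (reaches-vertexSet g v) (subtree-vertexSet ig v))
                (∨⁺ʳ (reaches O g (α a)) (proj₂ g≻a)) (cong₂ _∨_ a-unreached (proj₁ g≻a))
            ... | f , if , _ , αf∈ , f∉ , tail with ∨⁻ (reaches O g (α f)) αf∈
            ... | inj₁ αf-reached = 𝔹ₚ.not-¬ (⇝-trans αf-reached (α∈⇒⇝ tail)) (𝔹ₚ.∨-conicalˡ _ _ f∉)
            ... | inj₂ αf-below with exit-is-g if (𝔹ₚ.∨-conicalʳ (reaches O g f) _ f∉) αf-below
            ... | refl = 𝔹ₚ.not-¬ ⇝-refl (𝔹ₚ.∨-conicalˡ (reaches O f f) _ f∉)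

          reached-from-αa : α a ⇝[ O ] α g
          reached-from-αa with cycle-exit (λ x → reaches O (α a) x ∧ subtree g x)
              (λ v → cong₂ _∧_ (reaches-vertexSet (α a) v) (subtree-vertexSet ig v))
              (∧⁺ ⇝-refl (proj₂ g≻a)) (trans (cong (reaches O (α a) a ∧_) (proj₁ g≻a)) (𝔹ₚ.∧-zeroʳ _))
          ... | f , if , _ , αf∈ , f∉ , tail with exit-is-g if
              (≢true⇒false λ f-below → 𝔹ₚ.not-¬ (∧⁺ (⇝-trans (∧⁻ˡ αf∈) (α∈⇒⇝ tail)) f-below) f∉)
              (∧⁻ʳ (reaches O (α a) (α f)) αf∈)
          ... | refl = ∧⁻ˡ αf∈

        cycle-forth : g ⇝[ O ] α g
        cycle-forth = ⇝-trans reaches-a (⇝-trans (∈⇒⇝ toggled-tail) reached-from-αa)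

    untoggled-forth : ∀ {b} → Internal b → toggled b ≡ false → b ⇝[ O ] α b
    untoggled-forth ib ¬t with internal-case ib
    ... | toggled-cut t _ = ⊥-elim (𝔹ₚ.not-¬ t ¬t)
    ... | downward _ tail = ∈⇒⇝ tail
    ... | on-cycle _ _ ea a-toggled b≻a = cycle-forth ea a-toggled ib b≻a

    toggled-entry : ∀ {X y} → VertexSet X → NoEntry O X → X y ≡ true → X h₀ ≡ false →
                    ∃ λ f → Internal f × toggled f ≡ true × subtree f y ≡ true × X f ≡ false × X (α f) ≡ true
    toggled-entry {X} {y} vs noEntry y∈ root∉ with separating-edge X vs y h₀ (trans y∈ (cong not (sym root∉)))
    ... | f , _ , inj₂ (root-below , _) = ⊥-elim (𝔹ₚ.not-¬ root-below (∉subtree-root f))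
    ... | f , if , inj₁ (y-below , _ , Xαf , Xf) with true⊎false (toggled f)
    ... | inj₁ t = f , if , t , y-below , trans Xf root∉ , trans Xαf y∈
    ... | inj₂ ¬t = ⊥-elim (𝔹ₚ.not-¬ (⇝-noEntry vs noEntry (untoggled-forth if ¬t) (trans Xαf y∈)) (trans Xf root∉))

  record SameTourUntil {T T′ : Vec Bool n} (tree : Tree T) (tree′ : Tree T′) (b : Fin n) : Set where
    private
      module τ = Tour tree
      module τ′ = Tour tree′
    field
      time-here : τ.time b ≡ τ′.time b
      time-before : ∀ {x} → τ.time x < τ.time b → τ′.time x ≡ τ.time x
      time-before′ : ∀ {x} → τ′.time x < τ′.time b → τ.time x ≡ τ′.time x
      edges-before : ∀ {x} → τ.time x < τ.time b → lookup T x ≡ lookup T′ x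

    edges-before′ : ∀ {x} → τ′.time x < τ′.time b → lookup T x ≡ lookup T′ x
    edges-before′ x<b = edges-before (subst₂ _<_ (sym (time-before′ x<b)) (sym time-here) x<b)

    after : ∀ {x} → τ.time b < τ.time x → τ′.time b < τ′.time x
    after {x} b<x with ℕₚ.<-cmp (τ′.time b) (τ′.time x)
    ... | tri< b<′x _ _ = b<′x
    ... | tri≈ _ e _ = ⊥-elim (ℕₚ.<-irrefl (cong τ.time (τ′.time-injective e)) b<x)
    ... | tri> _ _ x<′b = ⊥-elim (ℕₚ.<-asym b<x (subst₂ _<_ (sym (time-before′ x<′b)) (sym time-here) x<′b))

    differ-after : ∀ {x} → lookup T x ≢ lookup T′ x → x ≢ b → τ.time b < τ.time x
    differ-after {x} differ x≢b with ℕₚ.<-cmp (τ.time b) (τ.time x)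
    ... | tri< b<x _ _ = b<x
    ... | tri≈ _ e _ = ⊥-elim (x≢b (sym (τ.time-injective e)))
    ... | tri> _ _ x<b = ⊥-elim (differ (edges-before x<b))

  SameTourUntil-sym : ∀ {T T′} {tree : Tree T} {tree′ : Tree T′} {b} → SameTourUntil tree tree′ b →
    SameTourUntil tree′ tree b
  SameTourUntil-sym same = record
    { time-here = sym time-here ; time-before = time-before′ ; time-before′ = time-before
    ; edges-before = sym ∘ edges-before′ }
    where open SameTourUntil same

  sameTourUntil : ∀ {T T′} (tree : Tree T) (tree′ : Tree T′) b → let open Tour tree in
    (∀ {x} → time x < time b → lookup T x ≡ lookup T′ x) → SameTourUntil tree tree′ b
  sameTourUntil {T} {T′} tree tree′ b edges-before = record
    { time-here = sym (time-upto ℕₚ.≤-refl)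
    ; time-before = time-upto ∘ ℕₚ.<⇒≤
    ; time-before′ = λ {x} x<b → time-upto′ (subst (τ′.time x <_) (time-upto ℕₚ.≤-refl) x<b)
    ; edges-before = edges-before }
    where
    module τ = Tour tree
    module τ′ = Tour tree′
    same-visit : ∀ j → j ≤ τ.time b → τ.visit j ≡ τ′.visit j
    same-visit zero _ = refl
    same-visit (suc j) j<b = trans
      (motion-cong {T} {T′}
        (edges-before (subst (_< τ.time b) (sym (τ.time-visit (ℕₚ.<-trans j<b (τ.time<n b)))) j<b)))
      (cong (motion T′) (same-visit j (ℕₚ.<⇒≤ j<b)))
    time-upto : ∀ {x} → τ.time x ≤ τ.time b → τ′.time x ≡ τ.time x
    time-upto {x} x≤b = trans (cong τ′.time (trans (sym (τ.visit-time x)) (same-visit (τ.time x) x≤b)))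
      (τ′.time-visit (τ.time<n x))
    time-upto′ : ∀ {x} → τ′.time x < τ.time b → τ.time x ≡ τ′.time x
    time-upto′ {x} x<b = trans
      (cong τ.time (trans (sym (τ′.visit-time x)) (sym (same-visit (τ′.time x) (ℕₚ.<⇒≤ x<b)))))
      (τ.time-visit (τ′.time<n x))

  module Compare {T S T′ S′ O : Vec Bool n} (π : Preimage T S O) (π′ : Preimage T′ S′ O) where
    module π = Orientation π
    module π′ = Orientation π′

    toggled-internal : ∀ {e} → π.Internal e → π′.Internal e → π.toggled e ≡ true → π′.toggled e ≡ true
    toggled-internal {e} ie ie′ t with π′.internal-case ie′
    ... | π′.toggled-cut t′ _ = t′
    ... | π′.downward _ tail = ⊥-elim (𝔹ₚ.not-¬ tail (trans (π.O-first ie) (cong not (π.meetsToggled-self t))))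
    ... | π′.on-cycle _ _ ea a-toggled e≻a = ⊥-elim
            (π.subtree-unreachable ie t (π′.cycle-forth ea a-toggled ie′ e≻a) (π.∉subtree-self e) (π.α∈subtree ie))

    toggled-external : ∀ {e} → π.External e → π′.External e → π.toggled e ≡ true → π′.toggled e ≡ true
    toggled-external {e} ee ee′ t with π′.external-case ee′
    ... | π′.toggled-cycle t′ _ = t′
    ... | π′.backward _ head _ = ⊥-elim (π.O-antisym (π.toggled-tail ee t) head)
    ... | π′.on-cocycle _ _ ib b-toggled (e-below , αe-above) = ⊥-elim
            (π′.subtree-unreachable ib b-toggled (π.toggled-return ee t) αe-above e-below)

  -- At the first disagreement b, internal for T and external for T′, a directed cut of one preimage
  -- meets a directed cycle of the other, or O takes both directions on an edge.
  module FirstDisagreement {T S T′ S′ O : Vec Bool n} (π : Preimage T S O) (π′ : Preimage T′ S′ O) {b : Fin n}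
    (b∈ : lookup T b ≡ true) (b∉ : lookup T′ b ≡ false)
    (same : SameTourUntil (interval-tree (interval π)) (interval-tree (interval π′)) b) where
    open Compare π π′
    private
      module π′π = Compare π′ π
      module S≤ = SameTourUntil same
      module S≥ = SameTourUntil (SameTourUntil-sym same)

      αb∈ : lookup T (α b) ≡ true
      αb∈ = trans (sym (α-closed π.subgraph b)) b∈

      αb∉ : lookup T′ (α b) ≡ false
      αb∉ = trans (sym (α-closed π′.subgraph b)) b∉

      ib : π.Internal b
      ib = π.half b∈ (S≤.differ-after (λ e → 𝔹ₚ.not-¬ αb∈ (trans e αb∉)) (α-fpf b))

      eb : π′.External b
      eb = π′.half b∉ (S≤.after (π.first ib))

      ≢b : ∀ {f} → lookup T′ f ≡ true → f ≢ b
      ≢b f∈ refl = 𝔹ₚ.not-¬ f∈ b∉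

      ≢αb : ∀ {f} → lookup T′ f ≡ true → f ≢ α b
      ≢αb f∈ refl = 𝔹ₚ.not-¬ f∈ αb∉

      crossing-∉ : ∀ {f} → lookup T′ f ≡ true → π.subtree b f ≡ false → π.subtree b (α f) ≡ true → lookup T f ≡ false
      crossing-∉ f∈′ f∉ αf∈ = ≢true⇒false λ f∈ →
        𝔹ₚ.not-¬ αf∈ (trans (sym (π.subtree-edge ib f∈ (≢b f∈′) (≢αb f∈′))) f∉)

      no-return-into-subtree : ∀ {f} → lookup T f ≡ false → π.time b < π.time f → π.subtree b f ≡ false →
        π.subtree b (α f) ≡ true → lookup O (α f) ≡ true → f ⇝[ O ] α f → ⊥
      no-return-into-subtree {f} f∉T b<f f∉ αf∈ tail r with π.time-comparable f
      ... | inj₁ f<αf = 𝔹ₚ.not-¬ (π.subtree⁺ b<f (ℕₚ.≤-trans (ℕₚ.<⇒≤ f<αf) (π.subtree-upper αf∈))) f∉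
      ... | inj₂ αf<f = by-case (π.external-case eαf)
        where
        eαf : π.External (α f)
        eαf = π.half (trans (sym (α-closed π.subgraph f)) f∉T) (π.α-first αf<f)
        by-case : π.ExternalCase (α f) → ⊥
        by-case (π.toggled-cycle t _) = π.external-active ib eαf (π.toggled⇒active t)
          (αf∈ , subst (λ x → π.subtree b x ≡ false) (sym (α-invol f)) f∉)
        by-case (π.backward _ head _) = π.O-antisym tail head
        by-case (π.on-cocycle {c} _ _ ic c-toggled (αf-below , ααf-above)) = π.subtree-unreachable ic c-toggled r
          (subst (λ x → π.subtree c x ≡ false) (α-invol f) ααf-above) αf-below

      Entry : Fin n → Set
      Entry c = ∃ λ f → π′.Internal f × π′.toggled f ≡ true × π′.subtree f (α b) ≡ true ×
                        π.subtree c f ≡ false × π.subtree c (α f) ≡ true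

      cut-vs-backward : π.toggled b ≡ true → π′.meetsToggled b ≡ false → ⊥
      cut-vs-backward b-toggled ¬m =
        absurd (π′.toggled-entry (π.subtree-vertexSet ib) (π.subtree-noEntry ib b-toggled)
                                              (π.α∈subtree ib) (π.∉subtree-root b))
        where
        absurd : Entry b → ⊥
        absurd (f , if , f-toggled , αb-below , f∉ , αf∈) =
          𝔹ₚ.not-¬ (trans (S≤.edges-before′ (π′.subtree-lower b-below)) (π′.kind if)) (crossing-∉ (π′.kind if) f∉ αf∈)
          where
          b-below : π′.subtree f b ≡ true
          b-below = ≢false⇒true λ b-above →
            𝔹ₚ.not-¬ (π′.meets⁺ (π′.fundCycle⁺ eb if (π′.≻×⇒crosses (b-above , αb-below))) f-toggled) ¬m

      Exit : Fin n → Set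
      Exit a = ∃ λ f → π′.Internal f × f π′.≻× a ×
                       π.subtree b (α f) ≡ true × π.subtree b f ≡ false × lookup O (α f) ≡ true

      on-cycle-impossible : ∀ {a} → π.External a → π.toggled a ≡ true → b π.≻× a → ⊥
      on-cycle-impossible {a} ea a-toggled b≻a =
        absurd (π′.cycle-exit ea′ a-toggled′ (π.subtree b) (π.subtree-vertexSet ib) (proj₂ b≻a) (proj₁ b≻a))
        where
        a<b : π.time a < π.time b
        a<b = π.≻×⇒< ib ea b≻a
        ea′ : π′.External a
        ea′ = π′.half (trans (sym (S≤.edges-before a<b)) (π.kind ea))
          (ℕₚ.<-trans (subst₂ _<_ (sym (S≤.time-before a<b)) S≤.time-here a<b)
            (S≤.after (π.subtree-lower (proj₂ b≻a))))
        a-toggled′ : π′.toggled a ≡ true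
        a-toggled′ = toggled-external ea ea′ a-toggled
        absurd : Exit a → ⊥
        absurd (f , if , f≻a , αf∈ , f∉ , tail) = no-return-into-subtree f∉T
          (S≤.differ-after (λ e → 𝔹ₚ.not-¬ (trans e (π′.kind if)) f∉T) (≢b (π′.kind if))) f∉ αf∈ tail
          (π′.cycle-forth ea′ a-toggled′ if f≻a)
          where
          f∉T : lookup T f ≡ false
          f∉T = crossing-∉ (π′.kind if) f∉ αf∈

      toggled-cycle-impossible : π′.toggled b ≡ true → ⊥
      toggled-cycle-impossible b-toggled =
        absurd (π′.cycle-exit eb b-toggled (π.subtree b) (π.subtree-vertexSet ib) (π.α∈subtree ib)
          (π.∉subtree-self b))
        where
        absurd : Exit b → ⊥
        absurd (f , if , f≻b , αf∈ , f∉ , tail) = no-return-into-subtree (crossing-∉ (π′.kind if) f∉ αf∈)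
          (S≥.after (π′.≻×⇒< if eb f≻b)) f∉ αf∈ tail (π′.cycle-forth eb b-toggled if f≻b)

      on-cocycle-impossible : ∀ {c} → lookup O b ≡ true → π′.Internal c → π′.toggled c ≡ true → c π′.≺× b → ⊥
      on-cocycle-impossible {c} tail ic′ c-toggled′ (b-below , αb-above) = absurd
        (π′.toggled-entry (π.subtree-vertexSet ic)
          (π.subtree-noEntry ic (π′π.toggled-internal ic′ ic c-toggled′)) αb∈c (π.∉subtree-root c))
        where
        αc≢b : α c ≢ b
        αc≢b refl = 𝔹ₚ.not-¬ (trans (sym (α-closed π′.subgraph c)) (π′.kind ic′)) b∉
        b<αc : π.time b < π.time (α c)
        b<αc = S≥.after (ℕₚ.≤∧≢⇒< (π′.subtree-upper b-below) (λ e → αc≢b (sym (π′.time-injective e))))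
        c<b : π.time c < π.time b
        c<b = subst₂ _<_ (sym (S≤.time-before′ (π′.subtree-lower b-below))) (sym S≤.time-here)
          (π′.subtree-lower b-below)
        ic : π.Internal c
        ic = π.half (trans (S≤.edges-before c<b) (π′.kind ic′)) (ℕₚ.<-trans c<b b<αc)
        αb∈c : π.subtree c (α b) ≡ true
        αb∈c = trans (sym (π.subtree-edge ic b∈ (≢b (π′.kind ic′) ∘ sym) (αc≢b ∘ sym))) (π.subtree⁺ c<b (ℕₚ.<⇒≤ b<αc))
        absurd : Entry c → ⊥
        absurd (f , if , f-toggled , αb-below , f∉ , αf∈) =
          𝔹ₚ.not-¬ αf∈ (trans (sym (π.subtree-edge ic f∈ f≢c f≢αc)) f∉)
          where
          f∈ : lookup T f ≡ true
          f∈ = trans (S≤.edges-before′ (π′.subtree-lower (π′.subtree-noEntry if f-toggled tail αb-below)))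
            (π′.kind if)
          f≢c : f ≢ c
          f≢c refl = 𝔹ₚ.not-¬ αb-below αb-above
          f≢αc : f ≢ α c
          f≢αc refl = π′.half-unique ic′ if

    impossible : ⊥
    impossible with π.internal-case ib | π′.external-case eb
    ... | π.toggled-cut t _         | π′.backward _ _ ¬m            = cut-vs-backward t ¬m
    ... | π.downward _ _            | π′.toggled-cycle t _          = toggled-cycle-impossible t
    ... | π.downward _ _            | π′.on-cocycle _ tail ic t c≺b = on-cocycle-impossible tail ic t c≺b
    ... | π.on-cycle _ _ ea t b≻a   | π′.backward _ _ _             = on-cycle-impossible ea t b≻a
    ... | π.downward _ tail         | π′.backward _ head _          = π.O-antisym tail head
    ... | π.toggled-cut _ head      | π′.toggled-cycle _ tail       = π.O-antisym tail head
    ... | π.toggled-cut _ head      | π′.on-cocycle _ tail _ _ _    = π.O-antisym tail head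
    ... | π.on-cycle _ head _ _ _   | π′.toggled-cycle _ tail       = π.O-antisym tail head
    ... | π.on-cycle _ head _ _ _   | π′.on-cocycle _ tail _ _ _    = π.O-antisym tail head

  preimage-tree-unique : ∀ {T S T′ S′ O} → Preimage T S O → Preimage T′ S′ O → T ≡ T′
  preimage-tree-unique {T} {T′ = T′} π π′ with least-satisfying time (λ x → lookup T x xor lookup T′ x) H
    where open Tour (interval-tree (interval π))
  ... | inj₁ agree = lookup-ext (λ x → xnor⁻ (not⁺ (agree (∈-allFin x))))
  ... | inj₂ (b , differ , least) = ⊥-elim (absurd (lookup T b) refl (xor⁻ {lookup T b} differ))
    where
    tree : Tree T
    tree = interval-tree (interval π)
    same : SameTourUntil tree (interval-tree (interval π′)) b
    same = sameTourUntil tree _ b λ {x} x<b →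
      xnor⁻ (not⁺ (≢true⇒false λ differ-x → ℕₚ.<⇒≱ x<b (least (∈-allFin x) differ-x)))
    absurd : ∀ t → lookup T b ≡ t → lookup T b ≡ not (lookup T′ b) → ⊥
    absurd true b∈ e = FirstDisagreement.impossible π π′ b∈ (sym (𝔹ₚ.not-injective (trans (sym b∈) e))) same
    absurd false b∉ e = FirstDisagreement.impossible π′ π (trans (not-sym e) (cong not b∉)) b∉
      (SameTourUntil-sym same)

  preimage-unique : ∀ {T S T′ S′ O} → Preimage T S O → Preimage T′ S′ O → T ≡ T′ × S ≡ S′
  preimage-unique {T} {S} {T′} {S′} π π′ with preimage-tree-unique π π′
  ... | refl = refl , lookup-ext (λ h → xor-cancelʳ (lookup T h) (same-toggled h))
    where
    module ππ′ = Compare π π′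
    module π′π = Compare π′ π
    module π = Orientation π
    module π′ = Orientation π′
    transfer : ∀ {κ h} → π.Half κ h → π′.Half κ h
    transfer {h = h} fh = π′.half (π.kind fh) (subst₂ _<_ (same-time h) (same-time (α h)) (π.first fh))
      where
      same-time : ∀ x → π.time x ≡ π′.time x
      same-time x = trans (π.time≡pos x) (sym (π′.time≡pos x))
    same-toggled : ∀ h → π.toggled h ≡ π′.toggled h
    same-toggled = π.half-elim (λ h → π.toggled h ≡ π′.toggled h)
      (λ {h} e → trans (π.toggled-α h) (trans e (sym (π′.toggled-α h))))
      (λ ih → true-ext (ππ′.toggled-internal ih (transfer ih)) (π′π.toggled-internal (transfer ih) ih))
      (λ eh → true-ext (ππ′.toggled-external eh (transfer eh)) (π′π.toggled-external (transfer eh) eh))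

  module AgreeAfter {T T′ : Vec Bool n} (tree : Tree T) (tree′ : Tree T′) (k : ℕ)
    (agree : ∀ {x} → k < Tour.time tree x → lookup T x ≡ lookup T′ x) where
    private
      module τ = Fundamental tree
      module τ′ = Fundamental tree′

    -- Both tours return to h₀ after n steps, so they are compared backwards from there.
    same-visit : ∀ {j} → j ≤ n → k < j → τ.visit j ≡ τ′.visit j
    same-visit {j} j≤n = backwards (n ∸ j) j (ℕₚ.m∸n+n≡m j≤n)
      where
      backwards : ∀ d j → d + j ≡ n → k < j → τ.visit j ≡ τ′.visit j
      backwards zero j refl _ = trans τ.visit-n (sym τ′.visit-n)
      backwards (suc d) j e k<j = motion-injective τ′.subgraph
        (trans (sym (motion-cong {T} {T′} (agree (subst (k <_) (sym (τ.time-visit j<n)) k<j))))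
               (backwards d (suc j) (trans (ℕₚ.+-suc d j) e) (ℕₚ.m<n⇒m<1+n k<j)))
        where
        j<n : j < n
        j<n = subst (j <_) e (s≤s (ℕₚ.m≤n+m j d))

    time-after : ∀ {x} → k < τ.time x → τ′.time x ≡ τ.time x
    time-after {x} k<x = trans (cong τ′.time (trans (sym (τ.visit-time x)) (same-visit (ℕₚ.<⇒≤ (τ.time<n x)) k<x)))
      (τ′.time-visit (τ.time<n x))

    time-after′ : ∀ {x} → k < τ′.time x → τ.time x ≡ τ′.time x
    time-after′ {x} k<x =
      trans (cong τ.time (trans (sym (τ′.visit-time x)) (sym (same-visit (ℕₚ.<⇒≤ (τ′.time<n x)) k<x))))
      (τ.time-visit (τ′.time<n x))

    differ⇒early : ∀ {x} → lookup T x ≢ lookup T′ x → τ.time x ≤ k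
    differ⇒early differ = ℕₚ.≮⇒≥ (differ ∘ agree)

    private
      module _ {x : Fin n} where

        agree-α : k < τ.time (α x) → lookup T x ≡ lookup T′ x
        agree-α k<αx = trans (α-closed τ.subgraph x) (trans (agree k<αx) (sym (α-closed τ′.subgraph x)))

        half′ : ∀ {κ} → τ.Half κ x → k < τ.time (α x) → τ′.Half κ x
        half′ fx k<αx = τ′.half (trans (sym (agree-α k<αx)) (τ.kind fx))
          (subst (τ′.time x <_) (sym (time-after k<αx)) (x<αx (ℕₚ.<-≤-connex k (τ′.time x))))
          where
          x<αx : k < τ′.time x ⊎ τ′.time x ≤ k → τ′.time x < τ.time (α x)
          x<αx (inj₁ k<x) = subst (_< τ.time (α x)) (time-after′ k<x) (τ.first fx)
          x<αx (inj₂ x≤k) = ℕₚ.≤-<-trans x≤k k<αx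

    module _ {s : Fin n} (is : τ.Internal s) (k<αs : k < τ.time (α s)) (s-active : τ.isActive s ≡ true) where
      private
        is′ : τ′.Internal s
        is′ = half′ is k<αs

        subtree-uncut′ : ∀ {f} → lookup T′ f ≡ true → f ≢ s → f ≢ α s → τ.subtree s f ≡ τ.subtree s (α f)
        subtree-uncut′ {f} f∈′ f≢s f≢αs = decidable-stable (_ 𝔹ₚ.≟ _)
          (λ differ → by-membership (𝔹ₚ.¬-not differ) (true⊎false (lookup T f)))
          where
          by-membership : τ.Crosses s f → lookup T f ≡ true ⊎ lookup T f ≡ false → ⊥
          by-membership crosses (inj₁ f∈) = 𝔹ₚ.not-¬ (τ.subtree-edge is f∈ f≢s f≢αs) crosses
          by-membership crosses (inj₂ f∉) with τ.first-half f
          ... | h , h∼f , fh = by-order (≡not-cases (τ.sameEdge-crosses h∼f crosses))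
            where
            eh : τ.External h
            eh = subst (λ κ → τ.Half κ h) f∉ fh
            differ : lookup T (α h) ≢ lookup T′ (α h)
            differ e = 𝔹ₚ.not-¬ (trans (sameEdge-resp (α-closed τ′.subgraph) h∼f) f∈′)
              (trans (α-closed τ′.subgraph h) (trans (sym e) (trans (sym (α-closed τ.subgraph h)) (τ.kind eh))))
            by-order : s τ.≺× h ⊎ s τ.≻× h → ⊥
            by-order (inj₂ s≻h) = τ.internal-active is eh s-active s≻h
            by-order (inj₁ s≺h) = 𝔹ₚ.not-¬ (τ.subtree⁺ (ℕₚ.<-trans (τ.≺×⇒< s≺h) (τ.first eh))
              (ℕₚ.≤-trans (differ⇒early differ) (ℕₚ.<⇒≤ k<αs))) (proj₂ s≺h)

        crossing-internal′ : ∀ {f} → τ′.Internal f → τ.subtree s f ≢ τ.subtree s (α f) → f ≡ s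
        crossing-internal′ {f} if′ crosses with f Finₚ.≟ s | f Finₚ.≟ α s
        ... | yes f≡s | _ = f≡s
        ... | no _ | yes refl = ⊥-elim (τ′.half-unique is′ if′)
        ... | no f≢s | no f≢αs = ⊥-elim (crosses (subtree-uncut′ (τ′.kind if′) f≢s f≢αs))

        separated′ : ∀ {p q} → τ.subtree s p ≡ not (τ.subtree s q) → τ′.subtree s p ≡ not (τ′.subtree s q)
        separated′ {p} {q} X≠ = from-edge (τ′.separating-edge (τ.subtree s) (τ.subtree-vertexSet is) p q X≠)
          where
          splits : ∀ {f p q} → τ.subtree s p ≡ not (τ.subtree s q) → τ′.Internal f →
            τ′.SplitsOff (τ.subtree s) f p q →
                   τ′.subtree s p ≡ true × τ′.subtree s q ≡ false
          splits X≠ if′ (p-below , q-above , Xαf , Xf) with crossing-internal′ if′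
            (λ same → 𝔹ₚ.not-¬ (trans (sym Xαf) (trans (sym same) Xf)) X≠)
          ... | refl = p-below , q-above
          from-edge : ∃ (τ′.Separating (τ.subtree s) p q) → τ′.subtree s p ≡ not (τ′.subtree s q)
          from-edge (f , if′ , inj₁ split) =
            let p-below , q-above = splits X≠ if′ split in trans p-below (cong not (sym q-above))
          from-edge (f , if′ , inj₂ split) =
            let q-below , p-above = splits (not-sym X≠) if′ split in trans p-above (cong not (sym q-below))

        same-subtree : ∀ x → τ′.subtree s x ≡ τ.subtree s x
        same-subtree x with true⊎false (τ.subtree s x)
        ... | inj₁ x∈ = trans (separated′ {x} {s} (trans x∈ (cong not (sym (τ.∉subtree-self s)))))
                          (trans (cong not (τ′.∉subtree-self s)) (sym x∈))
        ... | inj₂ x∉ = trans (separated′ {x} {α s} (trans x∉ (cong not (sym (τ.α∈subtree is)))))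
                          (trans (cong not (τ′.α∈subtree is′)) (sym x∉))

        not-smaller′ : ∀ {g} → τ′.External g → s τ.≻× g → ⊥
        not-smaller′ {g} eg′ (g∉ , αg∈) with τ.first-half g
        ... | h , h∼g , fh = by-side h∼g (subst (λ κ → τ.Half κ h) g∉T fh)
          where
          g∉T : lookup T g ≡ false
          g∉T = ≢true⇒false λ g∈T → 𝔹ₚ.not-¬ αg∈ (trans (sym (τ.subtree-edge is g∈T
            (λ { refl → 𝔹ₚ.not-¬ (τ′.kind is′) (τ′.kind eg′) })
            (λ { refl → 𝔹ₚ.not-¬ (τ′.kind is′) (trans (α-closed τ′.subgraph s) (τ′.kind eg′)) }))) g∉)
          by-side : ∀ {h} → SameEdge h g → τ.External h → ⊥
          by-side (inj₁ refl) eg = τ.internal-active is eg s-active (g∉ , αg∈)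
          by-side (inj₂ refl) eαg = ℕₚ.<-asym αg<g (subst₂ _<_ (time-after k<g) (sym (time-after′ k<′αg))
            (τ′.first eg′))
            where
            αg<g : τ.time (α g) < τ.time g
            αg<g = subst (λ x → τ.time (α g) < τ.time x) (α-invol g) (τ.first eαg)
            k<g : k < τ.time g
            k<g = ℕₚ.<-trans k<αs
              (ℕₚ.≰⇒> λ g≤αs → 𝔹ₚ.not-¬ (τ.subtree⁺ (ℕₚ.<-trans (τ.subtree-lower αg∈) αg<g) g≤αs) g∉)
            k<′αg : k < τ′.time (α g)
            k<′αg = ℕₚ.<-trans (subst (k <_) (sym (time-after k<g)) k<g) (τ′.first eg′)

      internal-stays-active : τ′.isActive s ≡ true
      internal-stays-active = ≢false⇒true λ inactive′ →
        let g , eg′ , g∉ , αg∈ = τ′.internal-inactive is′ inactive′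
        in not-smaller′ eg′ (trans (sym (same-subtree g)) g∉ , trans (sym (same-subtree (α g))) αg∈)

    module _ {s : Fin n} (es : τ.External s) (k<αs : k < τ.time (α s)) (s-active : τ.isActive s ≡ true) where
      private
        es′ : τ′.External s
        es′ = half′ es k<αs

        not-smaller′ : ∀ {f} → τ′.Internal f → f τ′.≺× s → ⊥
        not-smaller′ {f} if′ f≺s = by-edge (τ.separating-edge (τ′.subtree f) (τ′.subtree-vertexSet if′) s (α s)
          (τ′.≺×⇒crosses f≺s))
          where
          by-edge : ∃ (τ.Separating (τ′.subtree f) s (α s)) → ⊥
          by-edge (h , ih , inj₁ (s-below , αs-above , _)) = τ.external-active ih es s-active (s-below , αs-above)
          by-edge (h , ih , inj₂ (αs-below , _ , Xαh , Xh)) = crossing (h Finₚ.≟ f) (h Finₚ.≟ α f)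
            where
            s<αf : τ′.time (α f) < τ′.time (α s)
            s<αf = ℕₚ.≰⇒> λ αs≤αf →
              𝔹ₚ.not-¬ (τ′.subtree⁺ (ℕₚ.<-trans (τ′.≺×⇒< f≺s) (τ′.first es′)) αs≤αf) (proj₂ f≺s)
            k<αh : k < τ.time (α h)
            k<αh = ℕₚ.<-≤-trans k<αs (τ.subtree-upper αs-below)
            αs≤′αh : τ′.time (α s) ≤ τ′.time (α h)
            αs≤′αh = subst₂ _≤_ (sym (time-after k<αs)) (sym (time-after k<αh)) (τ.subtree-upper αs-below)
            crossing : Dec (h ≡ f) → Dec (h ≡ α f) → ⊥
            crossing (yes refl) _ = ℕₚ.<⇒≱ s<αf αs≤′αh
            crossing (no _) (yes refl) = τ′.half-unique if′ (half′ ih k<αh)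
            crossing (no h≢f) (no h≢αf) = 𝔹ₚ.not-¬ (trans Xh (proj₁ f≺s))
              (trans (τ′.subtree-edge if′ (τ′.kind (half′ ih k<αh)) h≢f h≢αf) (trans Xαh (proj₂ f≺s)))

      external-stays-active : τ′.isActive s ≡ true
      external-stays-active = ≢false⇒true λ inactive′ →
        let f , if′ , f≺s = τ′.external-inactive es′ inactive′ in not-smaller′ if′ f≺s

    stays-active : ∀ {x} → k < τ.time x → τ.isActive x ≡ true → τ′.isActive x ≡ true
    stays-active {x} k<x x-active with τ.first-half x
    ... | h , h∼x , fh = trans (sym (sameEdge-resp τ′.isActive-α h∼x))
            (by-kind fh (after h∼x fh) (trans (sameEdge-resp τ.isActive-α h∼x) x-active))
      where
      after : ∀ {h κ} → SameEdge h x → τ.Half κ h → k < τ.time (α h)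
      after (inj₁ refl) fh = ℕₚ.<-trans k<x (τ.first fh)
      after (inj₂ refl) _ = subst (λ y → k < τ.time y) (sym (α-invol x)) k<x
      by-kind : ∀ {κ h} → τ.Half κ h → k < τ.time (α h) → τ.isActive h ≡ true → τ′.isActive h ≡ true
      by-kind {true} = internal-stays-active
      by-kind {false} = external-stays-active

    opposite-visited : ∀ {u} → τ.time u ≡ k → lookup T′ u ≡ not (lookup T u) → τ′.visit k ≡ α u
    opposite-visited {u} time-u flipped = motion-injective τ′.subgraph (begin
      motion T′ (τ′.visit k)    ≡⟨ same-visit (subst (_< n) time-u (τ.time<n u)) (ℕₚ.n<1+n k) ⟨
      motion T (τ.visit k)      ≡⟨ cong (motion T) (trans (cong τ.visit (sym time-u)) (τ.visit-time u)) ⟩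
      motion T u                ≡⟨ crossed (true⊎false (lookup T u)) ⟩
      motion T′ (α u)           ∎)
      where
      open ≡-Reasoning
      flipped-α : lookup T′ (α u) ≡ not (lookup T u)
      flipped-α = trans (sym (α-closed τ′.subgraph u)) flipped
      crossed : lookup T u ≡ true ⊎ lookup T u ≡ false → motion T u ≡ motion T′ (α u)
      crossed (inj₁ u∈) = trans (motion-∈ {T} u∈) (sym (motion-∉ {T′} (trans flipped-α (cong not u∈))))
      crossed (inj₂ u∉) = trans (motion-∉ {T} u∉)
        (sym (trans (motion-∈ {T′} (trans flipped-α (cong not u∉))) (cong σf (α-invol u))))

  module IntervalOf {S : Vec Bool n} (sub : Subgraph S) where

    toggledAt : Vec Bool n → Fin n → Bool
    toggledAt T x = lookup S x xor lookup T x

    ActiveFrom : {T : Vec Bool n} → Tree T → ℕ → Set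
    ActiveFrom {T} tree k = ∀ {x} → toggledAt T x ≡ true → k ≤ time x → isActive x ≡ true
      where open Fundamental tree

    module _ {T : Vec Bool n} {tree : Tree T} {k : ℕ} (k<n : k < n) (activeAfter : ActiveFrom tree (suc k)) where
      open Fundamental tree

      private
        u : Fin n
        u = visit k

        time-u : time u ≡ k
        time-u = time-visit k<n

        activeFrom : (toggledAt T u ≡ true → isActive u ≡ true) → ActiveFrom tree k
        activeFrom u-active {x} t k≤x = [ activeAfter t , at-u ]′ (ℕₚ.m≤n⇒m<n∨m≡n k≤x)
          where
          at-u : k ≡ time x → isActive x ≡ true
          at-u k≡x = subst (λ y → isActive y ≡ true) u≡x (u-active (subst (λ y → toggledAt T y ≡ true) (sym u≡x) t))
            where
            u≡x : u ≡ x
            u≡x = time-injective (trans time-u k≡x)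

      exchange-activeFrom : ∀ {T′} (tree′ : Tree T′) → lookup T′ u ≡ not (lookup T u) → toggledAt T u ≡ true →
        (∀ {x} → k < time x → lookup T x ≡ lookup T′ x) → ActiveFrom tree′ k
      exchange-activeFrom {T′} tree′ flipped u-toggled agree {x} t k≤x = [ later , ⊥-elim ∘ at-k ]′
        (ℕₚ.m≤n⇒m<n∨m≡n k≤x)
        where
        open AgreeAfter tree tree′ k agree
        later : k < Tour.time tree′ x → Fundamental.isActive tree′ x ≡ true
        later k<′x = stays-active k<x (activeAfter (trans (cong (lookup S x xor_) (agree k<x)) t) k<x)
          where
          k<x : k < time x
          k<x = subst (k <_) (sym (time-after′ k<′x)) k<′x
        -- The new tour visits α u at step k, but the exchange has untoggled the edge of u.
        at-k : k ≡ Tour.time tree′ x → ⊥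
        at-k k≡x = 𝔹ₚ.not-¬ t (begin
          toggledAt T′ x                          ≡⟨ cong (toggledAt T′) x≡αu ⟩
          toggledAt T′ (α u)                      ≡⟨ cong₂ _xor_ (α-closed sub u) (α-closed (tree-subgraph tree′) u) ⟨
          lookup S u xor lookup T′ u              ≡⟨ cong (lookup S u xor_) flipped ⟩
          lookup S u xor not (lookup T u)         ≡⟨ 𝔹ₚ.not-distribʳ-xor (lookup S u) (lookup T u) ⟨
          not (toggledAt T u)                     ≡⟨ cong not u-toggled ⟩
          false                                   ∎)
          where
          open ≡-Reasoning
          x≡αu : x ≡ α u
          x≡αu = trans (sym (Tour.visit-time tree′ x))
            (trans (cong (Tour.visit tree′) (sym k≡x)) (opposite-visited time-u flipped))

      improve : ∃ λ T′ → ∃ λ (tree′ : Tree T′) → ActiveFrom tree′ k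
      improve = by-case (true⊎false (toggledAt T u)) (true⊎false (isActive u))
        where
        by-case : toggledAt T u ≡ true ⊎ toggledAt T u ≡ false → isActive u ≡ true ⊎ isActive u ≡ false →
                  ∃ λ T′ → ∃ λ (tree′ : Tree T′) → ActiveFrom tree′ k
        by-case (inj₂ ¬t) _ = T , tree , λ {x} → activeFrom (λ t → ⊥-elim (𝔹ₚ.not-¬ t ¬t)) {x}
        by-case (inj₁ _) (inj₁ act) = T , tree , λ {x} → activeFrom (λ _ → act) {x}
        by-case (inj₁ t) (inj₂ inactive) = by-side (time-comparable u)
          where
          by-side : time u < time (α u) ⊎ time (α u) < time u → ∃ λ T′ → ∃ λ (tree′ : Tree T′) → ActiveFrom tree′ k
          by-side (inj₁ u<αu) = ⊥-elim (𝔹ₚ.not-¬ (trans (isActive-α u)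
            (activeAfter (trans (sym (cong₂ _xor_ (α-closed sub u) (α-closed subgraph u))) t)
              (subst (_< time (α u)) time-u u<αu))) inactive)
          by-side (inj₂ αu<u) =
            let T′ , tree′ , flipped , agree =
                  exchange-inactive (half refl (α-first αu<u)) (trans (sym (isActive-α u)) inactive)
            in T′ , tree′ , (λ {x} → exchange-activeFrom tree′
                 (trans (α-closed (tree-subgraph tree′) u) (trans flipped (cong not (sym (α-closed subgraph u))))) t
                 (λ {x} k<x → agree (subst (_< time x) (trans (sym time-u) (cong time (sym (α-invol u)))) k<x)) {x})

    interval-tree-exists : ∃ λ T → Interval T S
    interval-tree-exists =
      let T , tree , activeFrom = improve-all n 0 (ℕₚ.+-identityʳ n)
      in T , mkInterval tree sub (λ {h} t → trans (sym (Fundamental.isActive≡active tree h)) (activeFrom t z≤n))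
      where
      improve-all : ∀ d k → d + k ≡ n → ∃ λ T → ∃ λ (tree : Tree T) → ActiveFrom tree k
      improve-all zero k refl = let T , tree = spanning-tree in
        T , tree , λ {x} _ n≤x → ⊥-elim (ℕₚ.<⇒≱ (Tour.time<n tree x) n≤x)
      improve-all (suc d) k e =
        let T , tree , activeAfter = improve-all d (suc k) (trans (ℕₚ.+-suc d k) e)
        in improve {tree = tree} (subst (k <_) e (s≤s (ℕₚ.m≤n+m k d))) activeAfter

  module _ {ρ₁ ρ₂ : Fin n → ℕ} (ρ₁-injective : Injective _≡_ _≡_ ρ₁) (ρ₂-injective : Injective _≡_ _≡_ ρ₂)
           {p : Fin n → Bool} (pα : EdgePredicate p) where

    private
      firstBy₂ : Fin n → Fin n
      firstBy₂ h = if ρ₂ h <ᵇ ρ₂ (α h) then h else α h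

      firstBy₂-cases : ∀ h → (firstBy₂ h ≡ h × ρ₂ h < ρ₂ (α h)) ⊎ (firstBy₂ h ≡ α h × ρ₂ (α h) < ρ₂ h)
      firstBy₂-cases h with α-comparable ρ₂-injective h
      ... | inj₁ h<αh = inj₁ (cong (if_then h else α h) (<ᵇ⁺ h<αh) , h<αh)
      ... | inj₂ αh<h = inj₂ (cong (if_then h else α h) (≮ᵇ⁺ (ℕₚ.<⇒≤ αh<h)) , αh<h)

    count-firsts-≤ : count (λ h → p h ∧ (ρ₁ h <ᵇ ρ₁ (α h))) H ≤ count (λ h → p h ∧ (ρ₂ h <ᵇ ρ₂ (α h))) H
    count-firsts-≤ = count-injection firstBy₂ allFin-unique (λ {h} _ q → ∈-allFin (firstBy₂ h) , is-first h q)
      (λ {x} {y} → unique x y)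
      where
      is-first : ∀ h → p h ∧ (ρ₁ h <ᵇ ρ₁ (α h)) ≡ true →
                 p (firstBy₂ h) ∧ (ρ₂ (firstBy₂ h) <ᵇ ρ₂ (α (firstBy₂ h))) ≡ true
      is-first h q with firstBy₂-cases h
      ... | inj₁ (e , h<αh) rewrite e = ∧⁺ (∧⁻ˡ q) (<ᵇ⁺ h<αh)
      ... | inj₂ (e , αh<h) rewrite e | α-invol h = ∧⁺ (trans (sym (pα h)) (∧⁻ˡ q)) (<ᵇ⁺ αh<h)
      both-first : ∀ x y → p x ∧ (ρ₁ x <ᵇ ρ₁ (α x)) ≡ true → p y ∧ (ρ₁ y <ᵇ ρ₁ (α y)) ≡ true → x ≡ α y → ⊥
      both-first x y q r refl = ℕₚ.<-asym (<ᵇ⁻ (∧⁻ʳ (p y) r))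
        (subst (λ z → ρ₁ (α y) < ρ₁ z) (α-invol y) (<ᵇ⁻ (∧⁻ʳ (p (α y)) q)))
      unique : ∀ x y → p x ∧ (ρ₁ x <ᵇ ρ₁ (α x)) ≡ true → p y ∧ (ρ₁ y <ᵇ ρ₁ (α y)) ≡ true → firstBy₂ x ≡ firstBy₂ y →
        x ≡ y
      unique x y q r e with firstBy₂-cases x | firstBy₂-cases y
      ... | inj₁ (a , _) | inj₁ (b , _) = trans (sym a) (trans e b)
      ... | inj₁ (a , _) | inj₂ (b , _) = ⊥-elim (both-first x y q r (trans (sym a) (trans e b)))
      ... | inj₂ (a , _) | inj₁ (b , _) = ⊥-elim (both-first y x r q (trans (sym b) (trans (sym e) a)))
      ... | inj₂ (a , _) | inj₂ (b , _) = α-injective (trans (sym a) (trans e b))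

  edgeCount-firsts : ∀ {ρ : Fin n → ℕ} → Injective _≡_ _≡_ ρ → ∀ {p} → EdgePredicate p →
                     edgeCount p ≡ count (λ h → p h ∧ (ρ h <ᵇ ρ (α h))) H
  edgeCount-firsts ρ-injective pα = ℕₚ.≤-antisym
    (count-firsts-≤ Finₚ.toℕ-injective ρ-injective pα) (count-firsts-≤ ρ-injective Finₚ.toℕ-injective pα)

  hasKind : Bool → Vec Bool n → Fin n → Bool
  hasKind true T h = lookup T h
  hasKind false T h = not (lookup T h)

  hasKind⁺ : ∀ {κ T h} → lookup T h ≡ κ → hasKind κ T h ≡ true
  hasKind⁺ {true} h∈ = h∈
  hasKind⁺ {false} h∉ = not⁺ h∉

  hasKind⁻ : ∀ {κ T h} → hasKind κ T h ≡ true → lookup T h ≡ κ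
  hasKind⁻ {true} h∈ = h∈
  hasKind⁻ {false} h∉ = not⁻ h∉

  hasKind-α : ∀ {κ T} → Subgraph T → EdgePredicate (hasKind κ T)
  hasKind-α {true} sub = α-closed sub
  hasKind-α {false} sub h = cong not (α-closed sub h)

  toggledEdge : Bool → Vec Bool n → Vec Bool n → Fin n → Bool
  toggledEdge κ T S h = hasKind κ T h ∧ (lookup S h xor lookup T h)

  activeEdge : Bool → Vec Bool n → Fin n → Bool
  activeEdge κ T h = hasKind κ T h ∧ active T h

  module FirstHalves {T : Vec Bool n} (tree : Tree T) (κ : Bool) {p : Fin n → Bool} (pα : EdgePredicate p) where
    open Tour tree

    private
      q : Fin n → Bool
      q h = hasKind κ T h ∧ p h

      qα : EdgePredicate q
      qα h = cong₂ _∧_ (hasKind-α {κ} subgraph h) (pα h)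

    mark : Fin n → Bool
    mark h = q h ∧ (time h <ᵇ time (α h))

    mark⁺ : ∀ {h} → Half κ h → p h ≡ true → mark h ≡ true
    mark⁺ fh ph = ∧⁺ (∧⁺ (hasKind⁺ (kind fh)) ph) (<ᵇ⁺ (first fh))

    mark⁻ : ∀ {h} → mark h ≡ true → Half κ h × p h ≡ true
    mark⁻ {h} m = half (hasKind⁻ (∧⁻ˡ (∧⁻ˡ m))) (<ᵇ⁻ (∧⁻ʳ (q h) m)) , ∧⁻ʳ (hasKind κ T h) (∧⁻ˡ m)

    edgeCount-marks : edgeCount q ≡ count mark H
    edgeCount-marks = edgeCount-firsts time-injective qα

    none⁻ : edgeCount q ≡ 0 → ∀ {h} → Half κ h → p h ≡ false
    none⁻ e {h} fh = ≢true⇒false (λ ph → 𝔹ₚ.not-¬ (∧⁺ (hasKind⁺ (kind fh)) ph) (edgeCount-0⁻ qα e h))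

    none⁺ : (∀ {h} → Half κ h → p h ≡ false) → edgeCount q ≡ 0
    none⁺ none = edgeCount-0⁺ (half-elim (λ h → q h ≡ false) (λ {h} → trans (qα h)) at-half at-half)
      where
      at-half : ∀ {κ′ h} → Half κ′ h → q h ≡ false
      at-half {h = h} fh = ≢true⇒false λ qh → 𝔹ₚ.not-¬ (∧⁻ʳ (hasKind κ T h) qh)
        (none (half (hasKind⁻ (∧⁻ˡ qh)) (first fh)))

  Crossing : (Fin n → Bool) → Fin n → Set
  Crossing W h = W h ≡ true × W (α h) ≡ false

  firstCrossing-spec : ∀ W hs → (firstCrossing W hs ≡ [] × (∀ {h} → h ∈ hs → Crossing W h → ⊥))
                     ⊎ (∃ λ h → firstCrossing W hs ≡ h ∷ [] × Crossing W h)
  firstCrossing-spec W [] = inj₁ (refl , λ ())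
  firstCrossing-spec W (h ∷ hs) with W h in Wh | W (α h) in Wαh
  ... | true | false = inj₂ (h , refl , Wh , Wαh)
  ... | true | true with firstCrossing-spec W hs
  ... | inj₂ found = inj₂ found
  ... | inj₁ (e , none) = inj₁ (e , λ { (here refl) (_ , αh∉) → 𝔹ₚ.not-¬ Wαh αh∉ ; (there i) → none i })
  firstCrossing-spec W (h ∷ hs) | false | _ with firstCrossing-spec W hs
  ... | inj₂ found = inj₂ found
  ... | inj₁ (e , none) = inj₁ (e , λ { (here refl) (h∈ , _) → 𝔹ₚ.not-¬ h∈ Wh ; (there i) → none i })

  minCrossing-spec : ∀ T W hs best → Crossing W best → let m = minCrossing T W hs best in
    Crossing W m × edgeRank T m ≤ edgeRank T best × (∀ {h} → h ∈ hs → Crossing W h → edgeRank T m ≤ edgeRank T h)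
  minCrossing-spec T W [] best crossing = crossing , ℕₚ.≤-refl , λ ()
  minCrossing-spec T W (h ∷ hs) best crossing
    with (W h ∧ not (W (α h))) ∧ (edgeRank T h <ᵇ edgeRank T best) in improves
  ... | true =
        let αh∉ = not⁻ (∧⁻ʳ (W h) (∧⁻ˡ improves))
            crossing-m , m≤h , least = minCrossing-spec T W hs h (∧⁻ˡ (∧⁻ˡ improves) , αh∉)
            h<best = <ᵇ⁻ (∧⁻ʳ (W h ∧ not (W (α h))) improves)
        in crossing-m , ℕₚ.≤-trans m≤h (ℕₚ.<⇒≤ h<best) , λ { (here refl) _ → m≤h ; (there i) → least i }
  ... | false =
        let crossing-m , m≤best , least = minCrossing-spec T W hs best crossing
        in crossing-m , m≤best , λ where
          (here refl) (h∈ , αh∉) → ℕₚ.≤-trans m≤best (≮ᵇ⁻ (≢true⇒false λ h<best →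
            𝔹ₚ.not-¬ (∧⁺ (∧⁺ h∈ (not⁺ αh∉)) h<best) improves))
          (there i) → least i

  module _ (T : Vec Bool n) (grow : (Fin n → Bool) → Fin n → Fin n → Bool) {fuel : ℕ} {W : Fin n → Bool} where

    countParts-done : firstCrossing W H ≡ [] → countParts T grow (suc fuel) W ≡ 1
    countParts-done e with [] ← firstCrossing W H = refl

    countParts-step : ∀ {h} → firstCrossing W H ≡ h ∷ [] →
      countParts T grow (suc fuel) W ≡ suc (countParts T grow fuel (grow W (α (minCrossing T W H h))))
    countParts-step e with firstCrossing W H | e
    ... | _ ∷ [] | refl = refl

  -- The parts grow along R; the part following an explored set is entered through the earliest
  -- marked internal half-edge leaving it.
  module Growth {T : Vec Bool n} (tree : Tree T) (R : Fin n → Fin n → Bool) (mark : Fin n → Bool) where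
    open Fundamental tree

    grow : (Fin n → Bool) → Fin n → Fin n → Bool
    grow W v x = W x ∨ (R v x ∧ not (W x))

    opaque
      explored : ℕ → Fin n → Bool
      explored k x = R h₀ x ∨ any (λ b → (mark b ∧ (time b <ᵇ k)) ∧ R (α b) x) H

      explored-root : ∀ {k x} → R h₀ x ≡ true → explored k x ≡ true
      explored-root = ∨⁺ˡ

      explored-mark : ∀ {k x b} → mark b ≡ true → time b < k → R (α b) x ≡ true → explored k x ≡ true
      explored-mark {k} {x} {b} m b<k r = ∨⁺ʳ (R h₀ x) (anyFin⁺ _ b (∧⁺ (∧⁺ m (<ᵇ⁺ b<k)) r))

      explored⁻ : ∀ {k x} → explored k x ≡ true →
                  R h₀ x ≡ true ⊎ (∃ λ b → mark b ≡ true × time b < k × R (α b) x ≡ true)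
      explored⁻ {k} {x} e with ∨⁻ (R h₀ x) e
      ... | inj₁ r = inj₁ r
      ... | inj₂ r with anyFin⁻ (λ b → (mark b ∧ (time b <ᵇ k)) ∧ R (α b) x) r
      ... | b , q = inj₂ (b , ∧⁻ˡ (∧⁻ˡ q) , <ᵇ⁻ (∧⁻ʳ (mark b) (∧⁻ˡ q)) , ∧⁻ʳ (mark b ∧ (time b <ᵇ k)) q)

    explored-mono : ∀ {k l x} → (∀ {b} → mark b ≡ true → time b < k → time b < l) → explored k x ≡ true →
      explored l x ≡ true
    explored-mono k⇒l e with explored⁻ e
    ... | inj₁ r = explored-root r
    ... | inj₂ (b , m , b<k , r) = explored-mark m (k⇒l m b<k) r

    remaining : ℕ → ℕ
    remaining k = count (λ h → mark h ∧ (k ≤ᵇ time h)) H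

    Next : ℕ → Fin n → Set
    Next k b = mark b ≡ true × k ≤ time b × (∀ {c} → mark c ≡ true → k ≤ time c → time b ≤ time c)

    next : ∀ k → (∀ {b} → mark b ≡ true → time b < k) ⊎ ∃ (Next k)
    next k with least-satisfying time (λ b → mark b ∧ (k ≤ᵇ time b)) H
    ... | inj₁ none = inj₁ λ {b} m → ≰ᵇ⁻ (≢true⇒false λ k≤b → 𝔹ₚ.not-¬ (∧⁺ m k≤b) (none (∈-allFin b)))
    ... | inj₂ (b , q , least) = inj₂ (b , ∧⁻ˡ q , ≤ᵇ⁻ (∧⁻ʳ (mark b) q) ,
            λ {c} m k≤c → least (∈-allFin c) (∧⁺ m (≤ᵇ⁺ k≤c)))

    remaining-none : ∀ {k} → (∀ {b} → mark b ≡ true → time b < k) → remaining k ≡ 0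
    remaining-none {k} all< = count-none⁺ {xs = H} λ {h} _ → ≢true⇒false λ q →
      ℕₚ.<⇒≱ (all< (∧⁻ˡ q)) (≤ᵇ⁻ {k} (∧⁻ʳ (mark h) q))

    remaining-next : ∀ {k b} → Next k b → remaining k ≡ suc (remaining (suc (time b)))
    remaining-next {k} {b} (m , k≤b , least) = begin
      remaining k                                    ≡⟨ count-split _ _ (_== b) H split ⟩
      remaining (suc (time b)) + count (_== b) H
        ≡⟨ cong (λ c → remaining (suc (time b)) + c) (count-unique allFin-unique (∈-allFin b) (==-refl b) ==⇒≡) ⟩
      remaining (suc (time b)) + 1                   ≡⟨ ℕₚ.+-comm _ 1 ⟩
      suc (remaining (suc (time b)))                 ∎
      where
      open ≡-Reasoning
      split : ∀ h → 𝟙 (mark h ∧ (k ≤ᵇ time h)) ≡ 𝟙 (mark h ∧ (suc (time b) ≤ᵇ time h)) + 𝟙 (h == b)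
      split h with h Finₚ.≟ b
      ... | yes refl = trans (cong 𝟙 (∧⁺ m (≤ᵇ⁺ k≤b)))
              (cong (λ e → 𝟙 e + 1) (sym (≢true⇒false λ q → ℕₚ.<-irrefl refl (≤ᵇ⁻ {suc (time h)} (∧⁻ʳ (mark h) q)))))
      ... | no h≢b = trans (cong 𝟙 (true-ext
                (λ q → ∧⁺ (∧⁻ˡ q) (≤ᵇ⁺ (ℕₚ.≤∧≢⇒< (least (∧⁻ˡ q) (≤ᵇ⁻ (∧⁻ʳ (mark h) q)))
                  (λ e → h≢b (sym (time-injective e))))))
                (λ q → ∧⁺ (∧⁻ˡ q) (≤ᵇ⁺ (ℕₚ.≤-trans k≤b (ℕₚ.<⇒≤ (≤ᵇ⁻ {suc (time b)} (∧⁻ʳ (mark h) q))))))))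
                  (sym (ℕₚ.+-identityʳ _))

    record IsExploration : Set where
      field
        R-≈ : ∀ {u x y} → x ≈ y → R u x ≡ true → R u y ≡ true
        mark-internal : ∀ {b} → mark b ≡ true → Internal b
        mark-unexplored : ∀ {b} → mark b ≡ true → explored (time b) (α b) ≡ false
        visited-explored : ∀ x → explored (time x) x ≡ true
        external-explored : ∀ {b e} → mark b ≡ true → External e → time e < time b → explored (time b) (α e) ≡ true

      explored-≈ : ∀ {k x y} → x ≈ y → explored k x ≡ true → explored k y ≡ true
      explored-≈ v e with explored⁻ e
      ... | inj₁ r = explored-root (R-≈ v r)
      ... | inj₂ (b , m , b<k , r) = explored-mark m b<k (R-≈ v r)

      explored-upto : ∀ {x k} → time x ≤ k → explored k x ≡ true
      explored-upto {x} x≤k = explored-mono (λ _ b<x → ℕₚ.<-≤-trans b<x x≤k) (visited-explored x)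

    module _ (exploration : IsExploration) where
      open IsExploration exploration

      module _ {W : Fin n → Bool} {b : Fin n} (m : mark b ≡ true) (W≗ : ∀ x → W x ≡ explored (time b) x) where

        private
          ib : Internal b
          ib = mark-internal m

        next-crosses : Crossing W b
        next-crosses = trans (W≗ b) (visited-explored b) , trans (W≗ (α b)) (mark-unexplored m)

        minimal-crossing⇒next : ∀ {x} → Crossing W x → rank x ≤ rank b → x ≡ b
        minimal-crossing⇒next {x} (x∈ , αx∉) x≤b = by-side (time-comparable x)
          where
          αx-unexplored : explored (time b) (α x) ≢ true
          αx-unexplored e = 𝔹ₚ.not-¬ e (trans (sym (W≗ (α x))) αx∉)
          by-kind : time x < time (α x) → time x < time b → lookup T x ≡ true ⊎ lookup T x ≡ false → ⊥
          by-kind x<αx x<b (inj₂ x∉T) = αx-unexplored (external-explored m (half x∉T x<αx) x<b)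
          by-kind x<αx x<b (inj₁ x∈T) = αx-unexplored
            (explored-≈ (≈-sym (subst (α x ≈_) (sym (motion-∈ {T} x∈T)) (≈-σ (α x)))) (explored-upto motion≤b))
            where
            motion≤b : time (motion T x) ≤ time b
            motion≤b = subst (_≤ time b) (sym (time-motion (ℕₚ.≤-<-trans x<b (time<n b)))) x<b
          by-side : time x < time (α x) ⊎ time (α x) < time x → x ≡ b
          by-side (inj₂ αx<x) = ⊥-elim (αx-unexplored (explored-upto
            (subst₂ _≤_ (trans (rank-α x) (rank-first (half refl (α-first αx<x)))) (rank-first ib) x≤b)))
          by-side (inj₁ x<αx) with ℕₚ.m≤n⇒m<n∨m≡n (subst₂ _≤_ (rank-first (half refl x<αx)) (rank-first ib) x≤b)
          ... | inj₁ x<b = ⊥-elim (by-kind x<αx x<b (true⊎false (lookup T x)))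
          ... | inj₂ x≡b = time-injective x≡b

        minCrossing≡next : ∀ {h} → Crossing W h → minCrossing T W H h ≡ b
        minCrossing≡next {h} crossing =
          let crossing-m , _ , least = minCrossing-spec T W H h crossing in
          minimal-crossing⇒next crossing-m (subst₂ _≤_ (sym (rank≡edgeRank _)) (sym (rank≡edgeRank b))
            (least (∈-allFin b) next-crosses))

        grow-next : ∀ x → grow W (α b) x ≡ explored (suc (time b)) x
        grow-next x = true-ext to from
          where
          to : grow W (α b) x ≡ true → explored (suc (time b)) x ≡ true
          to e with ∨⁻ (W x) e
          ... | inj₁ x∈ = explored-mono (λ _ → ℕₚ.m<n⇒m<1+n) (trans (sym (W≗ x)) x∈)
          ... | inj₂ r = explored-mark m (ℕₚ.n<1+n (time b)) (∧⁻ˡ r)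
          from : explored (suc (time b)) x ≡ true → grow W (α b) x ≡ true
          from e with true⊎false (W x)
          ... | inj₁ x∈ = ∨⁺ˡ x∈
          ... | inj₂ x∉ with explored⁻ e
          ... | inj₁ r = ⊥-elim (𝔹ₚ.not-¬ (trans (W≗ x) (explored-root r)) x∉)
          ... | inj₂ (c , mc , c≤b , r) with ℕₚ.m≤n⇒m<n∨m≡n (ℕₚ.≤-pred c≤b)
          ... | inj₁ c<b = ⊥-elim (𝔹ₚ.not-¬ (trans (W≗ x) (explored-mark mc c<b r)) x∉)
          ... | inj₂ c≡b with time-injective c≡b
          ... | refl = ∨⁺ʳ (W x) (∧⁺ r (not⁺ x∉))

      explored-next : ∀ {k b} → Next k b → ∀ x → explored k x ≡ explored (time b) x
      explored-next (_ , k≤b , least) x = true-ext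
        (explored-mono (λ _ c<k → ℕₚ.<-≤-trans c<k k≤b))
        (explored-mono (λ mc c<b → ℕₚ.≰⇒> (λ k≤c → ℕₚ.<⇒≱ c<b (least mc k≤c))))

      countParts-from : ∀ fuel k W → (∀ x → W x ≡ explored k x) → remaining k ≤ fuel →
                        countParts T grow fuel W ≡ suc (remaining k)
      countParts-from zero k W W≗ ≤0 = cong suc (sym (ℕₚ.n≤0⇒n≡0 ≤0))
      countParts-from (suc fuel) k W W≗ ≤fuel with next k | firstCrossing-spec W H
      ... | inj₁ all< | inj₁ (e , _) = trans (countParts-done T grow e) (cong suc (sym (remaining-none all<)))
      ... | inj₁ all< | inj₂ (h , _ , _ , αh∉) = ⊥-elim (𝔹ₚ.not-¬
              (explored-mono (λ mb _ → all< mb) (visited-explored (α h))) (trans (sym (W≗ (α h))) αh∉))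
      ... | inj₂ (b , nb) | inj₁ (_ , none) = ⊥-elim (none (∈-allFin b)
              (next-crosses (proj₁ nb) (λ x → trans (W≗ x) (explored-next nb x))))
      ... | inj₂ (b , nb) | inj₂ (h , e , crossing) = begin
              countParts T grow (suc fuel) W                               ≡⟨ countParts-step T grow e ⟩
              suc (countParts T grow fuel (grow W (α (minCrossing T W H h))))
                ≡⟨ cong (λ v → suc (countParts T grow fuel (grow W (α v))))
                  (minCrossing≡next (proj₁ nb) W≗b crossing) ⟩
              suc (countParts T grow fuel (grow W (α b)))
                ≡⟨ cong suc (countParts-from fuel (suc (time b)) (grow W (α b)) (grow-next (proj₁ nb) W≗b)
                     (ℕₚ.≤-pred (subst (_≤ suc fuel) (remaining-next nb) ≤fuel))) ⟩
              suc (suc (remaining (suc (time b))))                         ≡⟨ cong suc (remaining-next nb) ⟨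
              suc (remaining k)                                            ∎
        where
        open ≡-Reasoning
        W≗b : ∀ x → W x ≡ explored (time b) x
        W≗b x = trans (W≗ x) (explored-next nb x)

      countParts≡marks : countParts T grow n (R h₀) ≡ suc (count mark H)
      countParts≡marks = trans
        (countParts-from n 0 (R h₀) (λ x → true-ext explored-root (from x))
          (subst (_≤ n) (sym remaining-0) (count-allFin-≤ mark)))
        (cong suc remaining-0)
        where
        remaining-0 : remaining 0 ≡ count mark H
        remaining-0 = count-cong H (λ {h} _ → 𝔹ₚ.∧-identityʳ (mark h))
        from : ∀ x → explored 0 x ≡ true → R h₀ x ≡ true
        from x e with inj₁ r ← explored⁻ e = r

  module RootComponents {T S O : Vec Bool n} (π : Preimage T S O) where
    open Orientation π public

    tree : Tree T
    tree = interval-tree (interval π)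

    active-α : EdgePredicate (active T)
    active-α h = trans (sym (isActive≡active h)) (trans (isActive-α h) (isActive≡active (α h)))

    module ToggledHalves (κ : Bool) = FirstHalves tree κ toggled-α
    module ActiveHalves (κ : Bool) = FirstHalves tree κ active-α

    NoneToggled : Bool → Set
    NoneToggled κ = ∀ {b} → Half κ b → toggled b ≡ false

    module _ {V : Vec Bool n} (forth : ∀ {b} → Internal b → toggled b ≡ false → b ⇝[ V ] α b) where

      ReachedFromTop : Fin n → Set
      ReachedFromTop x = h₀ ⇝[ V ] x ⊎ (∃ λ b → Internal b × toggled b ≡ true × subtree b x ≡ true × α b ⇝[ V ] x)

      reached-from-top : ∀ x → ReachedFromTop x
      reached-from-top = time-rec ReachedFromTop (λ x rec → by-arrival (arrival x) rec)
        where
        at-vertex : ∀ {x y} → y ≈ x → ReachedFromTop y → ReachedFromTop x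
        at-vertex v (inj₁ r) = inj₁ (⇝-trans r (≈⇒⇝ v))
        at-vertex v (inj₂ (b , ib , t , y∈ , r)) = inj₂ (b , ib , t , trans (sym (subtree-vertexSet ib v)) y∈ ,
          ⇝-trans r (≈⇒⇝ v))
        along : ∀ {c} → Internal c → toggled c ≡ false → ReachedFromTop c → ReachedFromTop (α c)
        along ic ¬t (inj₁ r) = inj₁ (⇝-trans r (forth ic ¬t))
        along {c} ic ¬t (inj₂ (b , ib , t , c∈ , r)) =
          inj₂ (b , ib , t , trans (sym same-side) c∈ , ⇝-trans r (forth ic ¬t))
          where
          same-side : subtree b c ≡ subtree b (α c)
          same-side = subtree-edge ib (kind ic) (λ { refl → 𝔹ₚ.not-¬ t ¬t }) (λ { refl → half-unique ib ic })
        by-arrival : ∀ {x} → Arrival x → (∀ {y} → time y < time x → ReachedFromTop y) → ReachedFromTop x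
        by-arrival (at-root e) rec = inj₁ (subst (h₀ ⇝[ V ]_) (at-root⇒≡ e) ⇝-refl)
        by-arrival (revisit y≈x y<x) rec = at-vertex y≈x (rec y<x)
        by-arrival (descend {c} ic αc≈x x≡1+c) rec = at-vertex αc≈x (through (true⊎false (toggled c)))
          where
          through : toggled c ≡ true ⊎ toggled c ≡ false → ReachedFromTop (α c)
          through (inj₁ t) = inj₂ (c , ic , t , α∈subtree ic , ⇝-refl)
          through (inj₂ ¬t) = along ic ¬t (rec (ℕₚ.≤-reflexive (sym x≡1+c)))

    untoggled-forth-S : ∀ {b} → Internal b → toggled b ≡ false → b ⇝[ S ] α b
    untoggled-forth-S {b} ib ¬t = ∈⇒⇝ (trans (xnor⁻ (not⁺ ¬t)) (kind ib))

    subtree-uncut-S : ∀ {b} → Internal b → toggled b ≡ true → Uncut S (subtree b)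
    subtree-uncut-S {b} ib t {y} y∈ = decidable-stable (_ 𝔹ₚ.≟ _) (crossing-absurd ∘ 𝔹ₚ.¬-not)
      where
      half-absurd : ∀ {κ h} → Half κ h → lookup S h ≡ true → Crosses b h → ⊥
      half-absurd {true} ih h∈ crosses with internal-crosses⇒≡ ib ih crosses
      ... | refl = 𝔹ₚ.not-¬ h∈ (trans (xor⁻ t) (cong not (kind ih)))
      half-absurd {false} eh h∈ crosses with ≡not-cases crosses
      ... | inj₁ b≺h = external-active ib eh (toggled⇒active (xor⁺ (trans h∈ (cong not (sym (kind eh)))))) b≺h
      ... | inj₂ b≻h = internal-active ib eh (toggled⇒active t) b≻h
      crossing-absurd : Crosses b y → ⊥
      crossing-absurd crosses = let h , h∼y , fh = first-half y in
        half-absurd fh (trans (sameEdge-resp (α-closed subgraph-S) h∼y) y∈) (sameEdge-crosses h∼y crosses)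

    numComp≡toggled : numComp S ≡ suc (edgeCount (toggledEdge true T S))
    numComp≡toggled = trans (ℕₚ.≤-antisym (numComp-≤ subgraph-S covers) (numComp-≥ subgraph-S independent))
      (cong suc (trans (Listₚ.length-map α marks) (sym edgeCount-marks)))
      where
      open ToggledHalves true
      marks roots : List (Fin n)
      marks = filterᵇ mark H
      roots = h₀ ∷ map α marks
      covers : ∀ x → ∃ λ m → m ∈ roots × m ⇝[ S ] x
      covers x with reached-from-top untoggled-forth-S x
      ... | inj₁ r = h₀ , here refl , r
      ... | inj₂ (b , ib , t , _ , r) = α b , there (∈-map⁺ α (∈-filterᵇ⁺ mark (∈-allFin b) (mark⁺ ib t))) , r
      marked : ∀ {b} → b ∈ marks → Internal b × toggled b ≡ true
      marked i = mark⁻ (proj₂ (∈-filterᵇ⁻ mark H i))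
      outside-unreached : ∀ {b x} → Internal b × toggled b ≡ true → subtree b x ≡ false → α b ⇝[ S ] x → ⊥
      outside-unreached {b} (ib , t) x∉ r =
        𝔹ₚ.not-¬ (α∈subtree ib) (trans (⇝-uncut (subtree-vertexSet ib) (subtree-uncut-S ib t) r) x∉)
      distinct : ∀ {b c} → Internal b × toggled b ≡ true → Internal c × toggled c ≡ true → b ≢ c → α b ⇝[ S ] α c → ⊥
      distinct {b} {c} b-toggled c-toggled b≢c r with ℕₚ.<-cmp (time b) (time c)
      ... | tri< b<c _ _ = outside-unreached c-toggled (subtree-α-earlier (proj₁ b-toggled) (proj₁ c-toggled) b<c)
            (⇝-sym subgraph-S r)
      ... | tri≈ _ e _ = b≢c (time-injective e)
      ... | tri> _ _ c<b = outside-unreached b-toggled (subtree-α-earlier (proj₁ c-toggled) (proj₁ b-toggled) c<b) r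
      independent : AllPairs (λ x y → reaches S x y ≢ true) roots
      independent = Allₚ.map⁺
        (All.tabulate (λ {b} i r → outside-unreached (marked i) (∉subtree-root b) (⇝-sym subgraph-S r)))
        ∷ AllPairsₚ.map⁺ (unique⇒AllPairs (filterᵇ-unique mark allFin-unique)
          (λ i j → distinct (marked i) (marked j)))

    numE+toggled : numE S + edgeCount (toggledEdge true T S) ≡ numE T + edgeCount (toggledEdge false T S)
    numE+toggled = trans (sym (edgeCount-split union (lookup S) (toggledEdge true T S)
      (λ h → S-part (lookup S h) (lookup T h))))
      (edgeCount-split union (lookup T) (toggledEdge false T S) (λ h → T-part (lookup S h) (lookup T h)))
      where
      union : Fin n → Bool
      union h = lookup S h ∨ lookup T h
      S-part : ∀ s t → 𝟙 (s ∨ t) ≡ 𝟙 s + 𝟙 (t ∧ (s xor t))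
      S-part true true = refl
      S-part true false = refl
      S-part false true = refl
      S-part false false = refl
      T-part : ∀ s t → 𝟙 (s ∨ t) ≡ 𝟙 t + 𝟙 (not t ∧ (s xor t))
      T-part true true = refl
      T-part true false = refl
      T-part false true = refl
      T-part false false = refl

    nullity≡toggled : numE S + numComp S ∸ numV ≡ edgeCount (toggledEdge false T S)
    nullity≡toggled = begin
      numE S + numComp S ∸ numV         ≡⟨ cong₂ (λ c v → numE S + c ∸ v) numComp≡toggled (sym (tree-size tree)) ⟩
      numE S + suc i ∸ (numE T + 1)
        ≡⟨ cong₂ _∸_ (trans (ℕₚ.+-suc (numE S) i) (cong suc numE+toggled)) (ℕₚ.+-comm (numE T) 1) ⟩
      numE T + e ∸ numE T               ≡⟨ ℕₚ.m+n∸m≡n (numE T) e ⟩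
      e                                 ∎
      where
      open ≡-Reasoning
      i e : ℕ
      i = edgeCount (toggledEdge true T S)
      e = edgeCount (toggledEdge false T S)

    v0Connected⁻ : v0Connected O ≡ true → NoneToggled true
    v0Connected⁻ connected {b} ib = ≢true⇒false λ t → subtree-unreachable ib t
      (trans reaches≡reachD (allFin⁻ _ connected (α b))) (∉subtree-root b) (α∈subtree ib)

    v0Connected⁺ : NoneToggled true → v0Connected O ≡ true
    v0Connected⁺ none = allFin⁺ _ (λ x → trans (sym reaches≡reachD) (from-root (reached-from-top untoggled-forth x)))
      where
      from-root : ∀ {x} → ReachedFromTop untoggled-forth x → h₀ ⇝[ O ] x
      from-root (inj₁ r) = r
      from-root (inj₂ (b , ib , t , _)) = ⊥-elim (𝔹ₚ.not-¬ t (none ib))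

    numRootComps≡toggled : numRootComps T O ≡ suc (edgeCount (toggledEdge true T S))
    numRootComps≡toggled = trans as-growth (trans (countParts≡marks exploration) (cong suc (sym edgeCount-marks)))
      where
      open ToggledHalves true
      open Growth tree (reaches O) mark
      opaque
        unfolding reaches
        as-growth : numRootComps T O ≡ countParts T grow n (reaches O h₀)
        as-growth = refl
      exploration : IsExploration
      exploration = record
        { R-≈ = λ v r → ⇝-trans r (≈⇒⇝ v)
        ; mark-internal = λ m → proj₁ (mark⁻ m)
        ; mark-unexplored = λ m → ≢true⇒false (unexplored (mark⁻ m))
        ; visited-explored = λ x → top-explored (reached-from-top untoggled-forth x)
        ; external-explored = λ {b} {e} _ ee e<b → head-explored ee e<b (reached-from-top untoggled-forth (α e))
        }
        where
        unexplored : ∀ {b} → Internal b × toggled b ≡ true → explored (time b) (α b) ≢ true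
        unexplored {b} (ib , t) e with explored⁻ e
        ... | inj₁ r = subtree-unreachable ib t r (∉subtree-root b) (α∈subtree ib)
        ... | inj₂ (c , mc , c<b , r) =
              subtree-unreachable ib t r (subtree-α-earlier (proj₁ (mark⁻ mc)) ib c<b) (α∈subtree ib)
        top-explored : ∀ {x} → ReachedFromTop untoggled-forth x → explored (time x) x ≡ true
        top-explored (inj₁ r) = explored-root r
        top-explored (inj₂ (b , ib , t , x∈ , r)) = explored-mark (mark⁺ ib t) (subtree-lower x∈) r
        head-explored : ∀ {e k} → External e → time e < k → ReachedFromTop untoggled-forth (α e) →
          explored k (α e) ≡ true
        head-explored ee e<k (inj₁ r) = explored-root r
        head-explored {e} {k} ee e<k (inj₂ (c , ic , t , αe∈ , r)) with ℕₚ.<-≤-connex (time c) k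
        ... | inj₁ c<k = explored-mark (mark⁺ ic t) c<k r
        ... | inj₂ k≤c = ⊥-elim (internal-active ic ee (toggled⇒active t)
                (subtree-before (ℕₚ.<⇒≤ (ℕₚ.<-≤-trans e<k k≤c)) , αe∈))

    module _ (none-toggled : NoneToggled true) where

      module _ {b : Fin n} (ib : Internal b) (b-active : isActive b ≡ true) where

        active-cut-inward : ∀ h → Crosses b h → lookup O h ≡ subtree b (α h)
        active-cut-inward = half-elim (λ h → Crosses b h → lookup O h ≡ subtree b (α h))
          (λ {h} inward c → trans (O-α h) (trans (cong not (inward (crosses-α {g = h} c)))
            (trans (cong (not ∘ subtree b) (α-invol h)) (sym (not-sym c)))))
          (λ ih c → by-equality (internal-crosses⇒≡ ib ih c))
          (λ eh c → by-order eh (≡not-cases c))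
          where
          by-equality : ∀ {h} → h ≡ b → lookup O h ≡ subtree b (α h)
          by-equality refl with internal-case ib
          ... | toggled-cut t _ = ⊥-elim (𝔹ₚ.not-¬ t (none-toggled ib))
          ... | downward _ tail = trans tail (sym (α∈subtree ib))
          ... | on-cycle _ _ ea _ b≻a = ⊥-elim (internal-active ib ea b-active b≻a)
          by-order : ∀ {h} → External h → b ≺× h ⊎ b ≻× h → lookup O h ≡ subtree b (α h)
          by-order eh (inj₂ b≻h) = ⊥-elim (internal-active ib eh b-active b≻h)
          by-order eh (inj₁ b≺h) with external-case eh
          ... | toggled-cycle t _ = ⊥-elim (external-active ib eh (toggled⇒active t) b≺h)
          ... | backward _ head _ = trans (O-α _) (trans (cong not head) (sym (proj₂ b≺h)))
          ... | on-cocycle _ _ ic t _ = ⊥-elim (𝔹ₚ.not-¬ t (none-toggled ic))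

        subtree-noExit : NoExit O (subtree b)
        subtree-noExit {h} tail h∈ = ≢false⇒true λ αh∉ →
          𝔹ₚ.not-¬ tail (trans (active-cut-inward h (trans h∈ (cong not (sym αh∉)))) αh∉)

      subtree-reached : ∀ {b y} → Internal b → subtree b y ≡ true → α b ⇝[ O ] y
      subtree-reached {b} {y} ib y∈ = ≢false⇒true λ unreached →
        blocked unreached (separating-edge (reaches O (α b)) (reaches-vertexSet (α b)) (α b) y
          (trans ⇝-refl (cong not (sym unreached))))
        where
        blocked : reaches O (α b) y ≡ false → ∃ (Separating (reaches O (α b)) (α b) y) → ⊥
        blocked unreached (f , if , inj₂ (_ , _ , αf-as-y , f-as-αb)) =
          𝔹ₚ.not-¬ (⇝-trans (trans f-as-αb ⇝-refl) (untoggled-forth if (none-toggled if))) (trans αf-as-y unreached)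
        blocked unreached (f , if , inj₁ (αb-below , y-above , _)) with b Finₚ.≟ f | b Finₚ.≟ α f
        ... | yes refl | _ = 𝔹ₚ.not-¬ y∈ y-above
        ... | no _ | yes refl = half-unique if ib
        ... | no b≢f | no b≢αf =
              𝔹ₚ.not-¬ (subtree⁺ (ℕₚ.<-trans f<b (subtree-lower y∈))
                (ℕₚ.≤-trans (subtree-upper y∈) (subtree-upper αb-below))) y-above
          where
          f<b : time f < time b
          f<b = subtree-lower (trans (subtree-edge if (kind ib) b≢f b≢αf) αb-below)

      external-return : ∀ {e} → External e → α e ⇝[ O ] e
      external-return ee with external-case ee
      ... | toggled-cycle t _ = toggled-return ee t
      ... | backward _ head _ = α∈⇒⇝ head
      ... | on-cocycle _ _ ib t _ = ⊥-elim (𝔹ₚ.not-¬ t (none-toggled ib))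

      ReachesEarlier : Fin n → Set
      ReachesEarlier x = x ⇝[ O ] h₀ ⊎ (∃ λ b → Internal b × isActive b ≡ true × time b < time x × x ⇝[ O ] α b)

      -- From α c with c inactive, go down the subtree of c and out along an external edge to an
      -- earlier half-edge.
      reaches-earlier : ∀ x → ReachesEarlier x
      reaches-earlier = time-rec ReachesEarlier (λ x rec → by-arrival (arrival x) rec)
        where
        via : ∀ {x y} → time y < time x → x ⇝[ O ] y → ReachesEarlier y → ReachesEarlier x
        via y<x r (inj₁ s) = inj₁ (⇝-trans r s)
        via y<x r (inj₂ (b , ib , act , b<y , s)) = inj₂ (b , ib , act , ℕₚ.<-trans b<y y<x , ⇝-trans r s)
        by-arrival : ∀ {x} → Arrival x → (∀ {y} → time y < time x → ReachesEarlier y) → ReachesEarlier x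
        by-arrival {x} (at-root e) rec = inj₁ (subst (x ⇝[ O ]_) (sym (at-root⇒≡ e)) ⇝-refl)
        by-arrival (revisit y≈x y<x) rec = via y<x (≈⇒⇝ (≈-sym y≈x)) (rec y<x)
        by-arrival {x} (descend {c} ic αc≈x x≡1+c) rec = through (true⊎false (isActive c))
          where
          x⇝αc : x ⇝[ O ] α c
          x⇝αc = ≈⇒⇝ (≈-sym αc≈x)
          c<x : time c < time x
          c<x = ℕₚ.≤-reflexive (sym x≡1+c)
          through : isActive c ≡ true ⊎ isActive c ≡ false → ReachesEarlier x
          through (inj₁ act) = inj₂ (c , ic , act , c<x , x⇝αc)
          through (inj₂ inactive) =
            let g , eg , c≻g = internal-inactive ic inactive
                g<x = ℕₚ.<-trans (≻×⇒< ic eg c≻g) c<x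
            in via g<x (⇝-trans x⇝αc (⇝-trans (subtree-reached ic (proj₂ c≻g)) (external-return eg))) (rec g<x)

      numRootStrongComps≡active : numRootStrongComps T O ≡ suc (edgeCount (activeEdge true T))
      numRootStrongComps≡active =
        trans as-growth (trans (countParts≡marks exploration) (cong suc (sym edgeCount-marks)))
        where
        open ActiveHalves true
        open Growth tree (λ u x → reaches O x u) mark
        opaque
          unfolding reaches
          as-growth : numRootStrongComps T O ≡ countParts T grow n (λ x → reaches O x h₀)
          as-growth = refl
        marked : ∀ {b} → mark b ≡ true → Internal b × isActive b ≡ true
        marked m = let ib , act = mark⁻ m in ib , trans (isActive≡active _) act
        mark-active : ∀ {b} → Internal b → isActive b ≡ true → mark b ≡ true
        mark-active ib act = mark⁺ ib (trans (sym (isActive≡active _)) act)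
        unexplored : ∀ {b} → Internal b × isActive b ≡ true → explored (time b) (α b) ≢ true
        unexplored {b} (ib , act) e = 𝔹ₚ.not-¬ (α∈subtree ib) (outside (explored⁻ e))
          where
          outside : reaches O (α b) h₀ ≡ true ⊎
            (∃ λ c → mark c ≡ true × time c < time b × reaches O (α b) (α c) ≡ true) →
                    subtree b (α b) ≡ false
          outside (inj₁ r) = ≢true⇒false λ αb∈ →
            𝔹ₚ.not-¬ (⇝-noExit (subtree-vertexSet ib) (subtree-noExit ib act) r αb∈) (∉subtree-root b)
          outside (inj₂ (c , mc , c<b , r)) = ≢true⇒false λ αb∈ →
            𝔹ₚ.not-¬ (⇝-noExit (subtree-vertexSet ib) (subtree-noExit ib act) r αb∈)
              (subtree-α-earlier (proj₁ (marked mc)) ib c<b)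
        earlier-explored : ∀ {x} → ReachesEarlier x → explored (time x) x ≡ true
        earlier-explored (inj₁ r) = explored-root r
        earlier-explored (inj₂ (b , ib , act , b<x , r)) = explored-mark (mark-active ib act) b<x r
        head-explored : ∀ {e k} → External e → time e < k → ReachesEarlier e → explored k (α e) ≡ true
        head-explored ee e<k (inj₁ r) = explored-root (⇝-trans (external-return ee) r)
        head-explored ee e<k (inj₂ (c , ic , act , c<e , r)) =
          explored-mark (mark-active ic act) (ℕₚ.<-trans c<e e<k) (⇝-trans (external-return ee) r)
        exploration : IsExploration
        exploration = record
          { R-≈ = λ v r → ⇝-trans (≈⇒⇝ (≈-sym v)) r
          ; mark-internal = λ m → proj₁ (marked m)
          ; mark-unexplored = λ m → ≢true⇒false (unexplored (marked m))
          ; visited-explored = λ x → earlier-explored (reaches-earlier x)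
          ; external-explored = λ {b} {e} _ ee e<b → head-explored ee e<b (reaches-earlier e)
          }

  linked-⇝ : ∀ {V x xs z} → All (λ a → lookup V a ≡ true) (x ∷ xs) → Linked (λ a b → sameV (α a) b ≡ true)
    ((x ∷ xs) ∷ʳ z) →
             ∀ {a} → a ∈ (x ∷ xs) → x ⇝[ V ] a × α a ⇝[ V ] z
  linked-⇝ {xs = []} _ (link ∷ _) (here refl) = ⇝-refl , ≈⇒⇝ (sameV⇒≈ link)
  linked-⇝ {xs = y ∷ ys} (_ ∷ tails) (link ∷ links) (here refl) =
    ⇝-refl , ⇝-trans (≈⇒⇝ (sameV⇒≈ link)) (⇝-trans (∈⇒⇝ (All.head tails)) (proj₂ (linked-⇝ tails links (here refl))))
  linked-⇝ {xs = y ∷ ys} (tail ∷ tails) (link ∷ links) (there i) =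
    let y⇝a , αa⇝z = linked-⇝ tails links i in ⇝-trans (∈⇒⇝ tail) (⇝-trans (≈⇒⇝ (sameV⇒≈ link)) y⇝a) , αa⇝z

  module OnDirectedCycle {O h rest} (cycle : DirectedCycle O h rest) where

    C : List (Fin n)
    C = h ∷ rest

    cycle-tail : ∀ {a} → a ∈ C → lookup O a ≡ true
    cycle-tail = All.lookup (proj₁ cycle)

    tailSet : Vec Bool n
    tailSet = tabulate (λ g → any (_== g) C)

    ∈-tailSet⁻ : ∀ {g} → lookup tailSet g ≡ true → g ∈ C
    ∈-tailSet⁻ {g} p = let a , i , e = any⁻ (_== g) C (trans (sym (lookup∘tabulate _ g)) p) in subst (_∈ C) (==⇒≡ e) i

    ∈-tailSet⁺ : ∀ {a} → a ∈ C → lookup tailSet a ≡ true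
    ∈-tailSet⁺ {a} i = trans (lookup∘tabulate _ a) (any⁺ (_== a) i (==-refl a))

    cycle-return : ∀ {a} → a ∈ C → α a ⇝[ tailSet ] a
    cycle-return i = let h⇝a , αa⇝h = linked-⇝ (All.tabulate ∈-tailSet⁺) (proj₁ (proj₂ cycle)) i in ⇝-trans αa⇝h h⇝a

    cycle-leaves : ∀ {X} → VertexSet X → ∀ {a} → a ∈ C → X a ≡ false → X (α a) ≡ true →
                   ∃ λ g → g ∈ C × X g ≡ true × X (α g) ≡ false
    cycle-leaves vs i a∉ αa∈ =
      let g , g∈ , Xg , Xαg = ⇝-exit vs (cycle-return i) αa∈ a∉
      in g , ∈-tailSet⁻ g∈ , Xg , Xαg

    cycle-not-entering : ∀ {X} → VertexSet X → NoEntry O X → ∀ {a} → a ∈ C → X a ≡ X (α a)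
    cycle-not-entering vs noEntry i = true-ext
      (⇝-noEntry {O} vs noEntry (⇝-mono (λ p → cycle-tail (∈-tailSet⁻ p)) (cycle-return i))) (noEntry (cycle-tail i))

  module LoopErasure (V : Vec Bool n) (q : Fin n) where

    data Walk : Fin n → List (Fin n) → Set where
      arrive : ∀ {v} → v ≈ q → Walk v []
      depart : ∀ {v w ws} → v ≈ w → Walk (α w) ws → Walk v (w ∷ ws)

    record SimplePath (v : Fin n) : Set where
      field
        tails : List (Fin n)
        walk : Walk v tails
        tails-∈ : All (λ a → lookup V a ≡ true) tails
        distinct : AllPairs (λ a b → sameV a b ≡ false) tails
        avoids-q : All (λ a → sameV q a ≡ false) tails

    walk-≈ : ∀ {v w ws} → v ≈ w → Walk w ws → Walk v ws
    walk-≈ e (arrive f) = arrive (≈-trans e f)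
    walk-≈ e (depart f walk) = depart (≈-trans e f) walk

    simplePath-≈ : ∀ {v w} → v ≈ w → SimplePath w → SimplePath v
    simplePath-≈ e s = record { SimplePath s ; walk = walk-≈ e (SimplePath.walk s) }

    shortcut : ∀ {y} (s : SimplePath (α y)) → any (sameV y) (SimplePath.tails s) ≡ true → SimplePath y
    shortcut {y} s = cut walk tails-∈ distinct avoids-q
      where
      open SimplePath s
      cut : ∀ {v ws} → Walk v ws → All (λ a → lookup V a ≡ true) ws → AllPairs (λ a b → sameV a b ≡ false) ws →
            All (λ a → sameV q a ≡ false) ws → any (sameV y) ws ≡ true → SimplePath y
      cut {ws = w ∷ ws} (depart _ walk) (w∈ ∷ ws∈) (d ∷ ds) (a ∷ as) e with sameV y w in y≈?w
      ... | true = record { tails = w ∷ ws ; walk = depart (sameV⇒≈ y≈?w) walk ; tails-∈ = w∈ ∷ ws∈ ; distinct =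
            d ∷ ds ; avoids-q = a ∷ as }
      ... | false = cut walk ws∈ ds as e

    prepend : ∀ {y} → lookup V y ≡ true → SimplePath (α y) → SimplePath y
    prepend {y} y∈ s with sameV y q in y≈?q | any (sameV y) (SimplePath.tails s) in revisits
    ... | true | _ = record { tails = [] ; walk = arrive (sameV⇒≈ y≈?q) ; tails-∈ = [] ; distinct = [] ; avoids-q =
          [] }
    ... | false | true = shortcut s revisits
    ... | false | false = record
      { tails = y ∷ tails
      ; walk = depart ≈-refl walk
      ; tails-∈ = y∈ ∷ tails-∈
      ; distinct = All.tabulate (λ i → ≢true⇒false (λ e → 𝔹ₚ.not-¬ (any⁺ (sameV y) i e) revisits)) ∷ distinct
      ; avoids-q = ≢true⇒false (λ e → 𝔹ₚ.not-¬ (≈⇒sameV (≈-sym (sameV⇒≈ e))) y≈?q) ∷ avoids-q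
      }
      where open SimplePath s

    simple-path : ∀ {v} → v ⇝[ V ] q → SimplePath v
    simple-path {v} r = ⇝-ind (λ y → SimplePath y → SimplePath v) id (λ extend v≈w s → extend (simplePath-≈ v≈w s))
      (λ extend y∈ s → extend (prepend y∈ s)) r
      (record { tails = [] ; walk = arrive ≈-refl ; tails-∈ = [] ; distinct = [] ; avoids-q = [] })

    walk⇒linked : ∀ {x ws} → Walk (α x) ws → Linked (λ a b → sameV (α a) b ≡ true) ((x ∷ ws) ∷ʳ q)
    walk⇒linked (arrive e) = ≈⇒sameV e ∷ [-]
    walk⇒linked (depart e walk) = ≈⇒sameV e ∷ walk⇒linked walk

  return⇒cycle : ∀ {O V q} → (∀ {a} → lookup V a ≡ true → lookup O a ≡ true) → lookup O q ≡ true → α q ⇝[ V ] q →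
                 ∃ λ rest → DirectedCycle O q rest × All (λ a → lookup V a ≡ true) rest
  return⇒cycle {O} {V} {q} V⊆O q∈ r =
    tails , (q∈ ∷ All.map V⊆O tails-∈ , walk⇒linked walk , avoids-q ∷ distinct) , tails-∈
    where
    open LoopErasure V q
    open SimplePath (simple-path r)

  module Cycles {T S O : Vec Bool n} (π : Preimage T S O) where
    open RootComponents π public

    module MinimalEdge (none-toggled : NoneToggled false) {h rest} (cycle : DirectedCycle O h rest) where
      open OnDirectedCycle {O} cycle

      cycle-not-leaving-cut : ∀ {c g} → g ∈ C → Internal c → toggled c ≡ true → subtree c g ≡ true →
        subtree c (α g) ≡ false → ⊥
      cycle-not-leaving-cut i ic t g∈ αg∉ =
        𝔹ₚ.not-¬ (trans (sym (cycle-not-entering (subtree-vertexSet ic) (subtree-noEntry ic t) i)) g∈) αg∉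

      external-tail-impossible : ∀ {e} → External e → e ∈ C → ⊥
      external-tail-impossible ee i with external-case ee
      ... | toggled-cycle t _ = 𝔹ₚ.not-¬ t (none-toggled ee)
      ... | backward _ head _ = O-antisym (cycle-tail i) head
      ... | on-cocycle _ _ ic t (e∈ , αe∉) = cycle-not-leaving-cut i ic t e∈ αe∉

      EarlyExit : Fin n → Set
      EarlyExit f = ∃ λ g → g ∈ C × (g ≡ α f ⊎ rank g < time f)

      leaves-early : ∀ {f a} → Internal f → a ∈ C → subtree f a ≡ false → subtree f (α a) ≡ true →
                     EarlyExit f
      leaves-early {f} if i a∉ αa∈ =
        let g , j , g∈ , αg∉ = cycle-leaves (subtree-vertexSet if) i a∉ αa∈
            h , h∼g , fh = first-half g
        in g , j , by-half j g∈ αg∉ h∼g fh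
        where
        by-half : ∀ {κ g h} → g ∈ C → subtree f g ≡ true → subtree f (α g) ≡ false → SameEdge h g → Half κ h →
                  g ≡ α f ⊎ rank g < time f
        by-half {true} j g∈ αg∉ h∼g ih with internal-crosses⇒≡ if ih
          (sameEdge-crosses h∼g (≺×⇒crosses (g∈ , αg∉))) | h∼g
        ... | refl | inj₁ refl = ⊥-elim (𝔹ₚ.not-¬ g∈ (∉subtree-self f))
        ... | refl | inj₂ refl = inj₁ (sym (α-invol _))
        by-half {false} j g∈ αg∉ (inj₁ refl) eg = ⊥-elim (external-tail-impossible eg j)
        by-half {false} {g} j g∈ αg∉ (inj₂ refl) eαg =
          inj₂ (subst (_< time f) (sym (trans (rank-α g) (rank-first eαg)))
          (≻×⇒< if eαg (αg∉ , trans (cong (subtree f) (α-invol g)) g∈)))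

      module _ {m : Fin n} (i : m ∈ C) (least : ∀ {g} → g ∈ C → rank m ≤ rank g) where

        internal-not-minimal : Internal m → ⊥
        internal-not-minimal im = absurd (leaves-early im i (∉subtree-self m) (α∈subtree im))
          where
          absurd : EarlyExit m → ⊥
          absurd (g , j , inj₁ refl) = O-antisym (cycle-tail i) (cycle-tail j)
          absurd (g , j , inj₂ g<m) = ℕₚ.<⇒≱ g<m (subst (_≤ rank g) (rank-first im) (least j))

        α-internal-not-minimal : Internal (α m) → ⊥
        α-internal-not-minimal iαm with internal-case iαm
        ... | toggled-cut t _ = cycle-not-leaving-cut i iαm t (subst (λ x → subtree (α m) x ≡ true) (α-invol m)
              (α∈subtree iαm)) (∉subtree-self (α m))
        ... | downward _ head = O-antisym (cycle-tail i) head
        ... | on-cycle _ _ ea t _ = 𝔹ₚ.not-¬ t (none-toggled ea)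

        minimal-active : External (α m) → isActive (α m) ≡ true
        minimal-active eαm = ≢false⇒true λ inactive → absurd (external-inactive eαm inactive)
          where
          rank-m : rank m ≡ time (α m)
          rank-m = trans (rank-α m) (rank-first eαm)
          smaller : ∀ {f} → Internal f → time f < time (α m) → EarlyExit f → ⊥
          smaller if f<αm (g , j , inj₂ g<f) = ℕₚ.<⇒≱ (ℕₚ.<-trans g<f f<αm) (subst (_≤ rank g) rank-m (least j))
          smaller {f} if f<αm (g , j , inj₁ refl) =
            ℕₚ.<⇒≱ f<αm (subst₂ _≤_ rank-m (trans (sym (rank-α f)) (rank-first if)) (least j))
          absurd : (∃ λ f → Internal f × f ≺× α m) → ⊥
          absurd (f , if , αm∈ , ααm∉) =
            smaller if (subtree-lower αm∈)
              (leaves-early if i (subst (λ x → subtree f x ≡ false) (α-invol m) ααm∉) αm∈)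

        minimal-edge : External (α m) × isActive (α m) ≡ true
        minimal-edge with first-half m
        ... | h , h∼m , fh = by-half h∼m fh
          where
          by-half : ∀ {κ h} → SameEdge h m → Half κ h → External (α m) × isActive (α m) ≡ true
          by-half {true} (inj₁ refl) im = ⊥-elim (internal-not-minimal im)
          by-half {true} (inj₂ refl) iαm = ⊥-elim (α-internal-not-minimal iαm)
          by-half {false} (inj₁ refl) em = ⊥-elim (external-tail-impossible em i)
          by-half {false} (inj₂ refl) eαm = eαm , minimal-active eαm

    minimal⁺ : NoneToggled false → MinimalWrt T O
    minimal⁺ none-toggled h rest cycle smallest with find smallest
    ... | m , i , le = ℕₚ.<-asym m<αm
          (subst (λ x → time (α m) < time x) (α-invol m) (first (proj₁ (minimal-edge i least))))
      where
      open MinimalEdge none-toggled cycle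
      m≤ : ∀ {g} → g ∈ (h ∷ rest) → time m ≤ time g
      m≤ {g} j = subst₂ _≤_ (sym (time≡pos m)) (sym (time≡pos g)) (proj₁ (All.lookup le j))
      m<α : ∀ {g} → g ∈ (h ∷ rest) → time m < time (α g)
      m<α {g} j = subst₂ _<_ (sym (time≡pos m)) (sym (time≡pos (α g))) (proj₂ (All.lookup le j))
      m<αm : time m < time (α m)
      m<αm = m<α i
      least : ∀ {g} → g ∈ (h ∷ rest) → rank m ≤ rank g
      least {g} j with first-half g
      ... | _ , inj₁ refl , fg = subst₂ _≤_ (sym (rank-first (half refl m<αm))) (sym (rank-first fg)) (m≤ j)
      ... | _ , inj₂ refl , fαg = subst₂ _≤_ (sym (rank-first (half refl m<αm)))
            (sym (trans (rank-α g) (rank-first fαg))) (ℕₚ.<⇒≤ (m<α j))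

    acyclic⁺ : (∀ {e} → External e → isActive e ≡ false) → Acyclic O
    acyclic⁺ none-active h rest cycle =
      let m , i , least = argmin-∈ rank h rest
          eαm , act = MinimalEdge.minimal-edge (λ ee → ≢true⇒false λ t → 𝔹ₚ.not-¬ (toggled⇒active t)
            (none-active ee)) cycle i least
      in 𝔹ₚ.not-¬ act (none-active eαm)

    module FundamentalCycle {a : Fin n} (ea : External a) (a-toggled : toggled a ≡ true) where

      onPath : Fin n → Bool
      onPath y = hasKind true T y ∧ (time (α y) <ᵇ time y) ∧ not (subtree (α y) a) ∧ subtree (α y) (α a)

      onPath⁺ : ∀ {f} → Internal f → f ≻× a → onPath (α f) ≡ true
      onPath⁺ {f} if (a∉ , αa∈) rewrite α-invol f =
        ∧⁺ (trans (sym (α-closed subgraph f)) (kind if)) (∧⁺ (<ᵇ⁺ (first if)) (∧⁺ (not⁺ a∉) αa∈))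

      onPath⁻ : ∀ {y} → onPath y ≡ true → Internal (α y) × α y ≻× a
      onPath⁻ {y} p =
        let q = ∧⁻ʳ (lookup T y) p ; r = ∧⁻ʳ (time (α y) <ᵇ time y) q in
        half (trans (sym (α-closed subgraph y)) (∧⁻ˡ p)) (α-first (<ᵇ⁻ (∧⁻ˡ q))) , not⁻ (∧⁻ˡ r) ,
          ∧⁻ʳ (not (subtree (α y) a)) r

      path : Vec Bool n
      path = tabulate (λ y → lookup O y ∧ onPath y)

      path⁻ : ∀ {y} → lookup path y ≡ true → lookup O y ≡ true × onPath y ≡ true
      path⁻ {y} p = let q = trans (sym (lookup∘tabulate _ y)) p in ∧⁻ˡ q , ∧⁻ʳ (lookup O y) q

      path-return : α a ⇝[ path ] a
      path-return = ≢false⇒true λ unreached →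
        let f , if , f≻a , αf-reached , f-unreached , tail =
              cycle-exit ea a-toggled (reaches path (α a)) (reaches-vertexSet (α a)) ⇝-refl unreached
            αf∈ = trans (lookup∘tabulate _ (α f)) (∧⁺ tail (onPath⁺ if f≻a))
        in 𝔹ₚ.not-¬ (⇝-trans αf-reached (α∈⇒⇝ αf∈)) f-unreached

      path-later : ∀ {b} → lookup path b ≡ true → time a < time b × time a < time (α b)
      path-later {b} p =
        let iαb , αb≻a = onPath⁻ (proj₂ (path⁻ p)) ; a<αb = ≻×⇒< iαb ea αb≻a
        in ℕₚ.<-trans a<αb (subst (λ x → time (α b) < time x) (α-invol b) (first iαb)) , a<αb

      toggled-cycle-exists : ∃ λ rest → DirectedCycle O a rest ×
        All (λ b → time a < time b × time a < time (α b)) rest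
      toggled-cycle-exists =
        let rest , cycle , onPath = return⇒cycle {O} (λ p → proj₁ (path⁻ p)) (toggled-tail ea a-toggled) path-return
        in rest , cycle , All.map path-later onPath
    open FundamentalCycle using (toggled-cycle-exists)

    minimal⁻ : MinimalWrt T O → NoneToggled false
    minimal⁻ minimal {a} ea = ≢true⇒false λ t →
      let rest , cycle , later = toggled-cycle-exists ea t in
      minimal a rest cycle (here
        ((ℕₚ.≤-refl , toPos (first ea)) ∷ All.map (λ (a<b , a<αb) → ℕₚ.<⇒≤ (toPos a<b) , toPos a<αb) later))
      where
      toPos : ∀ {y z} → time y < time z → pos T y < pos T z
      toPos {y} {z} = subst₂ _<_ (time≡pos y) (time≡pos z)

    acyclic⁻ : Acyclic O → ∀ {e} → External e → isActive e ≡ false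
    acyclic⁻ acyclic {e} ee = ≢true⇒false (by-case (external-case ee))
      where
      none-toggled : NoneToggled false
      none-toggled ea = ≢true⇒false λ t → let rest , cycle , _ = toggled-cycle-exists ea t in acyclic _ rest cycle
      tree-path : isActive e ≡ true → e ⇝[ O ] α e
      tree-path act = ≢false⇒true λ unreached →
        blocked unreached (separating-edge (reaches O e) (reaches-vertexSet e) e (α e)
          (trans ⇝-refl (cong not (sym unreached))))
        where
        blocked : reaches O e (α e) ≡ false → ∃ (Separating (reaches O e) e (α e)) → ⊥
        blocked _ (f , if , inj₁ (e∈ , αe∉ , _)) = external-active if ee act (e∈ , αe∉)
        blocked unreached (f , if , inj₂ (αe∈ , e∉ , αf-as-αe , f-as-e)) with internal-case if
        ... | toggled-cut t _ = internal-active if ee (toggled⇒active t) (e∉ , αe∈)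
        ... | downward _ tail = 𝔹ₚ.not-¬ (⇝-trans (trans f-as-e ⇝-refl) (∈⇒⇝ tail)) (trans αf-as-αe unreached)
        ... | on-cycle _ _ ea t _ = 𝔹ₚ.not-¬ t (none-toggled ea)
      by-case : ExternalCase e → isActive e ≢ true
      by-case (toggled-cycle t _) _ = 𝔹ₚ.not-¬ t (none-toggled ee)
      by-case (on-cocycle _ _ ib _ b≺e) act = external-active ib ee act b≺e
      by-case (backward _ head _) act =
        let rest , cycle , _ = return⇒cycle {O} id head (subst (_⇝[ O ] α e) (sym (α-invol e)) (tree-path act))
        in acyclic (α e) rest cycle

  ∈-allSubgraphs⁺ : ∀ {S} → Subgraph S → S ∈ allSubgraphs
  ∈-allSubgraphs⁺ {S} sub = ∈-filterᵇ⁺ isSubgraph (∈-allVecs S) (isSubgraph⁺ sub)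

  ∈-allSubgraphs⁻ : ∀ {S} → S ∈ allSubgraphs → Subgraph S
  ∈-allSubgraphs⁻ {S} i = isSubgraph⁻ S (proj₂ (∈-filterᵇ⁻ isSubgraph (allVecs n) i))

  allSubgraphs-unique : Unique allSubgraphs
  allSubgraphs-unique = filterᵇ-unique isSubgraph (allVecs-unique n)

  orientations : List (Vec Bool n)
  orientations = filterᵇ isOrientation (allVecs n)

  ∈-orientations⁺ : ∀ {O} → isOrientation O ≡ true → O ∈ orientations
  ∈-orientations⁺ {O} = ∈-filterᵇ⁺ isOrientation (∈-allVecs O)

  -- An orientation corresponds to the set of edges whose canonical half-edge is not the tail.
  length-orientations-≤ : length orientations ≤ length allSubgraphs
  length-orientations-≤ = subst (_≤ length allSubgraphs) (Listₚ.length-map toSubgraph orientations)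
    (unique⊆⇒length-≤ (map-unique toSubgraph (filterᵇ-unique isOrientation (allVecs-unique n))
      (λ {O} {O′} _ _ → toSubgraph-injective O O′)) image)
    where
    toSubgraph : Vec Bool n → Vec Bool n
    toSubgraph O = tabulate (λ h → lookup O h xor canonical h)
    toSubgraph-subgraph : ∀ {O} → isOrientation O ≡ true → Subgraph (toSubgraph O)
    toSubgraph-subgraph {O} oriented .α-closed h = begin
      lookup (toSubgraph O) h                         ≡⟨ lookup∘tabulate _ h ⟩
      lookup O h xor canonical h
        ≡⟨ cong₂ _xor_ (xor⁻ {lookup O h} (allFin⁻ _ oriented h)) (not-sym {canonical (α h)} (canonical-α h)) ⟩
      not (lookup O (α h)) xor not (canonical (α h))  ≡⟨ 𝔹ₚ.xor-annihilates-not (lookup O (α h)) (canonical (α h)) ⟩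
      lookup O (α h) xor canonical (α h)              ≡⟨ lookup∘tabulate _ (α h) ⟨
      lookup (toSubgraph O) (α h)                     ∎
      where open ≡-Reasoning
    toSubgraph-injective : ∀ O O′ → toSubgraph O ≡ toSubgraph O′ → O ≡ O′
    toSubgraph-injective O O′ e = lookup-ext λ h → xor-cancelʳ (canonical h)
      (trans (sym (lookup∘tabulate _ h)) (trans (cong (λ S → lookup S h) e) (lookup∘tabulate _ h)))
    image : ∀ {S} → S ∈ map toSubgraph orientations → S ∈ allSubgraphs
    image i with ∈-map⁻ toSubgraph i
    ... | O , j , refl = ∈-allSubgraphs⁺ (toSubgraph-subgraph {O} (proj₂ (∈-filterᵇ⁻ isOrientation (allVecs n) j)))

  opaque
    -- Arbitrary when S is not a subgraph.
    intervalTree : Vec Bool n → Vec Bool n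
    intervalTree S = [ (λ p → proj₁ (IntervalOf.interval-tree-exists (isSubgraph⁻ S p))) , (λ _ → S) ]′
      (true⊎false (isSubgraph S))

    intervalTree-interval : ∀ {S} → Subgraph S → Interval (intervalTree S) S
    intervalTree-interval {S} sub with true⊎false (isSubgraph S)
    ... | inj₁ p = proj₂ (IntervalOf.interval-tree-exists (isSubgraph⁻ S p))
    ... | inj₂ p = ⊥-elim (𝔹ₚ.not-¬ (isSubgraph⁺ sub) p)

    orient : Vec Bool n → Vec Bool n
    orient S = Φ (intervalTree S) S

    orient-preimage : ∀ {S} → Subgraph S → Preimage (intervalTree S) S (orient S)
    orient-preimage sub = mkPreimage (intervalTree-interval sub) refl

  preimage-oriented : ∀ {T S O} → Preimage T S O → isOrientation O ≡ true
  preimage-oriented π = allFin⁺ _ (λ h → xor⁺ (Orientation.O-α π h))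

  orient-injective : ∀ {S S′} → Subgraph S → Subgraph S′ → orient S ≡ orient S′ → S ≡ S′
  orient-injective sub sub′ e =
    proj₂ (preimage-unique (orient-preimage sub) (subst (Preimage _ _) (sym e) (orient-preimage sub′)))

  orient-surjective : ∀ {O} → isOrientation O ≡ true → ∃ λ S → Subgraph S × orient S ≡ O
  orient-surjective {O} oriented with any? (λ V → ≡-dec 𝔹ₚ._≟_ O V) (map orient allSubgraphs)
  ... | yes i = let S , j , e = ∈-map⁻ orient i in S , ∈-allSubgraphs⁻ j , sym e
  ... | no O∉ = ⊥-elim (ℕₚ.<⇒≱ too-many length-orientations-≤)
    where
    image : ∀ {V} → V ∈ (O ∷ map orient allSubgraphs) → V ∈ orientations
    image (here refl) = ∈-orientations⁺ oriented
    image (there i) with ∈-map⁻ orient i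
    ... | S , j , refl = ∈-orientations⁺ (preimage-oriented (orient-preimage (∈-allSubgraphs⁻ j)))
    images-unique : Unique (map orient allSubgraphs)
    images-unique = map-unique orient allSubgraphs-unique
      (λ i j → orient-injective (∈-allSubgraphs⁻ i) (∈-allSubgraphs⁻ j))
    too-many : length allSubgraphs < length orientations
    too-many = subst (λ k → suc k ≤ length orientations) (Listₚ.length-map orient allSubgraphs)
      (unique⊆⇒length-≤ (All.tabulate
        (λ i O≡V → O∉ (subst (_∈ map orient allSubgraphs) (sym O≡V) i)) ∷ images-unique) image)

  interval-unique : ∀ {T S} → Interval T S → T ≡ intervalTree S
  interval-unique {T} {S} interval with orient-surjective (preimage-oriented (mkPreimage interval refl))
  ... | S′ , sub′ , e with preimage-unique (mkPreimage interval (sym e)) (orient-preimage sub′)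
  ... | T≡ , S≡ = trans T≡ (cong intervalTree (sym S≡))

  treeOf-orient : ∀ {S} → Subgraph S → ∀ {Q : Vec Bool n → Set} →
    Q (intervalTree S) ⇔ (∃ λ T → TreeOf (orient S) T × Q T)
  treeOf-orient {S} sub {Q} = mk⇔ (λ q → intervalTree S , treeOf , q) from
    where
    treeOf : TreeOf (orient S) (intervalTree S)
    treeOf = S , inInterval⁺ (intervalTree-interval sub) , Φ-image (orient-preimage sub)
    from : (∃ λ T → TreeOf (orient S) T × Q T) → Q (intervalTree S)
    from (T , (S′ , p , e) , q) =
      subst Q (proj₁ (preimage-unique (mkPreimage (inInterval⁻ {T} {S′} p) e) (orient-preimage sub))) q

  nToggled nActive : Bool → Vec Bool n → ℕ
  nToggled κ S = edgeCount (toggledEdge κ (intervalTree S) S)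
  nActive κ S = edgeCount (activeEdge κ (intervalTree S))

  activeIn : Bool → Vec Bool n → Fin n → Bool
  activeIn κ S = activeEdge κ (intervalTree S)

  toggledIn : Bool → Vec Bool n → Fin n → Bool
  toggledIn κ S = toggledEdge κ (intervalTree S) S

  flip : Fin n → Vec Bool n → Vec Bool n
  flip e S = tabulate (λ h → lookup S h xor sameEdge h e)

  lookup-flip : ∀ e S h → lookup (flip e S) h ≡ lookup S h xor sameEdge h e
  lookup-flip e S h = lookup∘tabulate _ h

  lookup-flip-≁ : ∀ {e S h} → sameEdge h e ≡ false → lookup (flip e S) h ≡ lookup S h
  lookup-flip-≁ {e} {S} {h} h≁e = trans (lookup-flip e S h) (trans (cong (lookup S h xor_) h≁e) (𝔹ₚ.xor-identityʳ _))

  flip-involutive : ∀ e S → flip e (flip e S) ≡ S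
  flip-involutive e S = lookup-ext λ h → trans (lookup-flip e (flip e S) h)
    (trans (cong (_xor sameEdge h e) (lookup-flip e S h)) (xor-cancel (lookup S h) (sameEdge h e)))

  flip-subgraph : ∀ {e S} → Subgraph S → Subgraph (flip e S)
  flip-subgraph {e} {S} sub .α-closed h = trans (lookup-flip e S h)
    (trans (cong₂ _xor_ (α-closed sub h) (sym (sameEdge-αˡ h e))) (sym (lookup-flip e S (α h))))

  module _ {κ : Bool} {T : Vec Bool n} where

    toggledEdge-not : ∀ {S h} → hasKind κ T h ≡ true → toggledEdge (not κ) T S h ≡ false
    toggledEdge-not {S} {h} p = cong (_∧ (lookup S h xor lookup T h)) (other-kind κ p)
      where
      other-kind : ∀ κ → hasKind κ T h ≡ true → hasKind (not κ) T h ≡ false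
      other-kind true p = cong not p
      other-kind false p = not⁻ p

    toggledEdge-flip-≁ : ∀ {e S h} → sameEdge h e ≡ false → toggledEdge κ T (flip e S) h ≡ toggledEdge κ T S h
    toggledEdge-flip-≁ {e} {S} {h} h≁e = cong (λ s → hasKind κ T h ∧ (s xor lookup T h)) (lookup-flip-≁ {e} {S} h≁e)

    toggledEdge-flip-self : ∀ {e S} → hasKind κ T e ≡ true → toggledEdge κ T (flip e S) e ≡ not (toggledEdge κ T S e)
    toggledEdge-flip-self {e} {S} p = begin
      hasKind κ T e ∧ (lookup (flip e S) e xor lookup T e)   ≡⟨ cong₂ (λ k s → k ∧ (s xor lookup T e)) p flipped ⟩
      not (lookup S e) xor lookup T e                        ≡⟨ 𝔹ₚ.not-distribˡ-xor (lookup S e) (lookup T e) ⟨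
      not (lookup S e xor lookup T e)                        ≡⟨ cong (λ k → not (k ∧ (lookup S e xor lookup T e))) p ⟨
      not (hasKind κ T e ∧ (lookup S e xor lookup T e))      ∎
      where
      open ≡-Reasoning
      flipped : lookup (flip e S) e ≡ not (lookup S e)
      flipped = trans (lookup-flip e S e) (trans (cong (lookup S e xor_) (sameEdge-refl e))
        (𝔹ₚ.xor-comm (lookup S e) true))

  module _ {S : Vec Bool n} (sub : Subgraph S) {κ : Bool} {e : Fin n} (e-active : activeIn κ S e ≡ true) where
    private
      T : Vec Bool n
      T = intervalTree S
      tree-interval : Interval T S
      tree-interval = intervalTree-interval sub
      module R = RootComponents (orient-preimage sub)

    flip-intervalTree : intervalTree (flip e S) ≡ T
    flip-intervalTree = sym
      (interval-unique (mkInterval R.tree (flip-subgraph sub) (λ {h} → toggled-active′ h (sameEdge h e) refl)))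
      where
      toggled-active′ : ∀ h s → sameEdge h e ≡ s → lookup (flip e S) h xor lookup T h ≡ true → active T h ≡ true
      toggled-active′ h true h∼e _ = trans (sameEdge-resp R.active-α (sameEdge⁻ h e h∼e))
        (∧⁻ʳ (hasKind κ T e) e-active)
      toggled-active′ h false h≁e t = toggled-active tree-interval
        (trans (cong (_xor lookup T h) (sym (lookup-flip-≁ {e} {S} h≁e))) t)

    flip-activeIn : ∀ κ′ h → activeIn κ′ (flip e S) h ≡ activeIn κ′ S h
    flip-activeIn κ′ h = cong (λ T → activeEdge κ′ T h) flip-intervalTree

    private
      toggledIn-flip : ∀ κ′ h → toggledIn κ′ (flip e S) h ≡ toggledEdge κ′ T (flip e S) h
      toggledIn-flip κ′ h = cong (λ T → toggledEdge κ′ T (flip e S) h) flip-intervalTree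

      e-kind : hasKind κ T e ≡ true
      e-kind = ∧⁻ˡ e-active

    flip-toggledIn : toggledIn κ (flip e S) e ≡ not (toggledIn κ S e)
    flip-toggledIn = trans (toggledIn-flip κ e) (toggledEdge-flip-self {κ} {T} {e} {S} e-kind)

    flip-toggledIn-≁ : ∀ {κ′ h} → sameEdge h e ≡ false → toggledIn κ′ (flip e S) h ≡ toggledIn κ′ S h
    flip-toggledIn-≁ {κ′} {h} h≁e = trans (toggledIn-flip κ′ h) (toggledEdge-flip-≁ {κ′} {T} {e} {S} h≁e)

    flip-toggledIn-not : ∀ h → toggledIn (not κ) (flip e S) h ≡ toggledIn (not κ) S h
    flip-toggledIn-not h = by-edge (sameEdge h e) refl
      where
      by-edge : ∀ s → sameEdge h e ≡ s → toggledIn (not κ) (flip e S) h ≡ toggledIn (not κ) S h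
      by-edge false h≁e = flip-toggledIn-≁ {not κ} {h} h≁e
      by-edge true h∼e = trans (toggledIn-flip (not κ) h)
        (trans (toggledEdge-not {κ} {T} {flip e S} h-kind) (sym (toggledEdge-not {κ} {T} {S} h-kind)))
        where
        h-kind : hasKind κ T h ≡ true
        h-kind = trans (sameEdge-resp (hasKind-α {κ} R.subgraph) (sameEdge⁻ h e h∼e)) e-kind

    flip-nToggled-not : nToggled (not κ) (flip e S) ≡ nToggled (not κ) S
    flip-nToggled-not = count-cong H (λ {h} _ → cong (_∧ canonical h) (flip-toggledIn-not h))

    flip-nActive : ∀ κ′ → nActive κ′ (flip e S) ≡ nActive κ′ S
    flip-nActive κ′ = count-cong H (λ {h} _ → cong (_∧ canonical h) (flip-activeIn κ′ h))

  edges : List (Fin n)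
  edges = filterᵇ canonical H

  edge-toggles : ∀ κ → ToggleSystem allSubgraphs edges (toggledIn κ) (activeIn κ) flip
  edge-toggles κ = record
    { states-unique = allSubgraphs-unique
    ; elements-unique = filterᵇ-unique canonical allFin-unique
    ; toggled⇒active = λ {S} {e} S∈ t → ∧⁺ (∧⁻ˡ t)
        (toggled-active (intervalTree-interval (∈-allSubgraphs⁻ S∈)) (∧⁻ʳ (hasKind κ (intervalTree S) e) t))
    ; flip-∈ = λ S∈ _ → ∈-allSubgraphs⁺ (flip-subgraph (∈-allSubgraphs⁻ S∈))
    ; flip-involutive = λ {S} {e} _ _ → flip-involutive e S
    ; flip-active = λ S∈ act → flip-activeIn (∈-allSubgraphs⁻ S∈) {κ} act κ
    ; flip-toggled = λ S∈ act → flip-toggledIn (∈-allSubgraphs⁻ S∈) {κ} act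
    ; flip-toggled-≢ = λ S∈ e∈ f∈ f≢e act → flip-toggledIn-≁ (∈-allSubgraphs⁻ S∈) {κ} act {κ}
        (distinct-edges e∈ f∈ f≢e)
    }
    where
    distinct-edges : ∀ {e f} → e ∈ edges → f ∈ edges → f ≢ e → sameEdge f e ≡ false
    distinct-edges {e} e∈ f∈ f≢e = ≢⇒¬sameEdge f≢e λ { refl → 𝔹ₚ.not-¬ (proj₂ (∈-filterᵇ⁻ canonical H f∈))
      (trans (canonical-α e) (cong not (proj₂ (∈-filterᵇ⁻ canonical H e∈)))) }

  sumSubgraphs : (Vec Bool n → ℤ) → ℤ
  sumSubgraphs f = sumOver f allSubgraphs

  FlipInvariant : ∀ {A : Set} → Bool → (Vec Bool n → A) → Set
  FlipInvariant κ f = ∀ {S e} → Subgraph S → activeIn κ S e ≡ true → f (flip e S) ≡ f S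

  sum-untoggled : ∀ κ (w : Vec Bool n → ℕ → ℕ → ℤ) → (∀ S u m → w S (suc u) m +ℤ w S u m ≡ w S u (suc m)) →
    (∀ u m → FlipInvariant κ (λ S → w S u m)) →
    sumSubgraphs (λ S → w S (nToggled κ S) 0) ≡ sumSubgraphs
      (λ S → if nToggled κ S ≡ᵇ 0 then w S 0 (nActive κ S) else + 0)
  sum-untoggled κ w w-split w-flip = begin
    sumSubgraphs (λ S → w S (nToggled κ S) 0)
      ≡⟨ sumOver-cong allSubgraphs (λ {S} _ → cong (λ u → w S u 0) (count-filterᵇ (toggledIn κ S) canonical H)) ⟨
    sumSubgraphs (λ S → w S (count (toggledIn κ S) edges) 0)
      ≡⟨ UntoggledSum.sumOver-untoggled (edge-toggles κ) w w-split
        (λ S∈ act u m → w-flip u m (∈-allSubgraphs⁻ S∈) act) ⟩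
    sumSubgraphs (λ S → if count (toggledIn κ S) edges ≡ᵇ 0 then w S 0 (count (activeIn κ S) edges) else + 0)
      ≡⟨ sumOver-cong allSubgraphs (λ {S} _ → cong₂ (λ u m → if u ≡ᵇ 0 then w S 0 m else + 0)
           (count-filterᵇ (toggledIn κ S) canonical H) (count-filterᵇ (activeIn κ S) canonical H)) ⟩
    sumSubgraphs (λ S → if nToggled κ S ≡ᵇ 0 then w S 0 (nActive κ S) else + 0) ∎
    where open ≡-Reasoning

  Characterizes : (Vec Bool n → Bool) → (Vec Bool n → Set) → Set
  Characterizes χ P = ∀ {S} → Subgraph S → χ S ≡ true ⇔ P (orient S)

  record RootStatistic (X : Poly) (R : ℕ → Vec Bool n → Set) : Set where
    field
      indicator : ℕ → Vec Bool n → Bool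
      indicator-flip : ∀ i → FlipInvariant false (indicator i)
      characterizes : ∀ i → Characterizes (indicator i) (R i)
      expansion : ∀ i (w : Vec Bool n → ℤ) → FlipInvariant true w →
        sumSubgraphs (λ S → coeff ((X +P constP (- + 1)) ^P nToggled true S) i *ℤ w S) ≡
        sumSubgraphs (λ S → ⟦ indicator i S ⟧ *ℤ w S)

  record CycleStatistic (y : ℤ) (C : Vec Bool n → Set) : Set where
    field
      indicator : Vec Bool n → Bool
      characterizes : Characterizes indicator C
      expansion : ∀ (χ : Vec Bool n → Bool) → FlipInvariant false χ →
        sumSubgraphs (λ S → ⟦ χ S ⟧ *ℤ (y -ℤ + 1) ^ℤ nToggled false S) ≡ sumSubgraphs (λ S → ⟦ χ S ∧ indicator S ⟧)

  coeff-tutteAt : ∀ X y i → coeff (tutteAt X y) i ≡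
    sumSubgraphs (λ S → coeff ((X +P constP (- + 1)) ^P nToggled true S) i *ℤ (y -ℤ + 1) ^ℤ nToggled false S)
  coeff-tutteAt X y i = trans (coeff-sumP _ allSubgraphs i) (sumOver-cong allSubgraphs term)
    where
    term : ∀ {S} → S ∈ allSubgraphs →
      coeff (((X +P constP (- + 1)) ^P (numComp S ∸ 1)) *P constP ((y -ℤ + 1) ^ℤ (numE S + numComp S ∸ numV))) i ≡
      coeff ((X +P constP (- + 1)) ^P nToggled true S) i *ℤ (y -ℤ + 1) ^ℤ nToggled false S
    term {S} S∈ = trans (coeff-*constP ((X +P constP (- + 1)) ^P (numComp S ∸ 1)) _ i)
      (cong₂ (λ k l → coeff ((X +P constP (- + 1)) ^P k) i *ℤ (y -ℤ + 1) ^ℤ l)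
        (cong (_∸ 1) numComp≡toggled) nullity≡toggled)
      where open RootComponents (orient-preimage (∈-allSubgraphs⁻ S∈))

  hasCount-orient : ∀ {χ P} → Characterizes χ P → HasCount (λ O → isOrientation O ≡ true × P O) (count χ allSubgraphs)
  hasCount-orient {χ} {P} characterizes = map orient selected ,
    map-unique orient (filterᵇ-unique χ allSubgraphs-unique)
      (λ i j → orient-injective (selected-subgraph i) (selected-subgraph j)) ,
    (λ O → mk⇔ (to {O}) (from {O})) , Listₚ.length-map orient selected
    where
    selected : List (Vec Bool n)
    selected = filterᵇ χ allSubgraphs
    selected-subgraph : ∀ {S} → S ∈ selected → Subgraph S
    selected-subgraph i = ∈-allSubgraphs⁻ (proj₁ (∈-filterᵇ⁻ χ allSubgraphs i))
    to : ∀ {O} → O ∈ map orient selected → isOrientation O ≡ true × P O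
    to j with ∈-map⁻ orient j
    ... | S , i , refl = preimage-oriented (orient-preimage (selected-subgraph i)) ,
                         Equivalence.to (characterizes (selected-subgraph i)) (proj₂ (∈-filterᵇ⁻ χ allSubgraphs i))
    from : ∀ {O} → isOrientation O ≡ true × P O → O ∈ map orient selected
    from {O} (oriented , p) with orient-surjective {O} oriented
    ... | S , sub , refl = ∈-map⁺ orient (∈-filterᵇ⁺ χ (∈-allSubgraphs⁺ sub) (Equivalence.from (characterizes sub) p))

  coeffsCount : ∀ {X y R C} {Q : ℕ → Vec Bool n → Set} → RootStatistic X R → CycleStatistic y C →
    (∀ {i O} → (C O × R i O) ⇔ Q i O) →
                CoeffsCount (tutteAt X y) (λ i O → isOrientation O ≡ true × Q i O)
  coeffsCount {X} {y} {R} {C} {Q} root cycle C×R⇔Q i = count χ allSubgraphs ,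
    hasCount-orient {χ} {Q i} χ-characterizes , (begin
    coeff (tutteAt X y) i                            ≡⟨ coeff-tutteAt X y i ⟩
    sumSubgraphs (λ S → coeff ((X +P constP (- + 1)) ^P nToggled true S) i *ℤ (y -ℤ + 1) ^ℤ nToggled false S)
      ≡⟨ Root.expansion i (λ S → (y -ℤ + 1) ^ℤ nToggled false S)
        (λ sub act → cong ((y -ℤ + 1) ^ℤ_) (flip-nToggled-not sub {true} act)) ⟩
    sumSubgraphs (λ S → ⟦ Root.indicator i S ⟧ *ℤ (y -ℤ + 1) ^ℤ nToggled false S)
      ≡⟨ Cycle.expansion (Root.indicator i) (Root.indicator-flip i) ⟩
    sumSubgraphs (λ S → ⟦ χ S ⟧)                     ≡⟨ sumOver-indicator χ allSubgraphs ⟩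
    + count χ allSubgraphs                           ∎)
    where
    open ≡-Reasoning
    module Root = RootStatistic root
    module Cycle = CycleStatistic cycle
    χ : Vec Bool n → Bool
    χ S = Root.indicator i S ∧ Cycle.indicator S
    χ-characterizes : Characterizes χ (Q i)
    χ-characterizes {S} sub = C×R⇔Q {i} {orient S} ⇔-∘ mk⇔
      (λ p → Equivalence.to (Cycle.characterizes sub) (∧⁻ʳ (Root.indicator i S) p) ,
             Equivalence.to (Root.characterizes i sub) (∧⁻ˡ p))
      (λ (c , r) → ∧⁺ (Equivalence.from (Root.characterizes i sub) r) (Equivalence.from (Cycle.characterizes sub) c))

  rootComponents : RootStatistic onePlusX RC
  rootComponents = record
    { indicator = λ i S → nToggled true S ≡ᵇ i
    ; indicator-flip = λ i sub act → cong (_≡ᵇ i) (flip-nToggled-not sub {false} act)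
    ; characterizes = λ i → characterizes
    ; expansion = λ i w _ → sumOver-cong allSubgraphs (λ {S} _ → cong (_*ℤ w S) (coeff-x^ (nToggled true S) i))
    }
    where
    characterizes : ∀ {i} → Characterizes (λ S → nToggled true S ≡ᵇ i) (RC i)
    characterizes sub = mk⇔
      (λ p → Equivalence.to (treeOf-orient sub) (trans numRootComps≡toggled (cong suc (≡ᵇ⁻ p))))
      (λ rc → ≡ᵇ⁺ (ℕₚ.suc-injective (trans (sym numRootComps≡toggled) (Equivalence.from (treeOf-orient sub) rc))))
      where open RootComponents (orient-preimage sub)

  rootStrongComponents : RootStatistic varX (λ i O → v0Connected O ≡ true × RSC i O)
  rootStrongComponents = record
    { indicator = indicator
    ; indicator-flip = λ i sub act → cong₂ (λ t a → (t ≡ᵇ 0) ∧ (a ≡ᵇ i)) (flip-nToggled-not sub {false} act)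
        (flip-nActive sub {false} act true)
    ; characterizes = λ i → characterizes
    ; expansion = expansion
    }
    where
    indicator : ℕ → Vec Bool n → Bool
    indicator i S = (nToggled true S ≡ᵇ 0) ∧ (nActive true S ≡ᵇ i)
    characterizes : ∀ {i} → Characterizes (indicator i) (λ O → v0Connected O ≡ true × RSC i O)
    characterizes {i} {S} sub = mk⇔
      (λ p → let none = none⁻ (≡ᵇ⁻ (∧⁻ˡ p)) in v0Connected⁺ none ,
        Equivalence.to (treeOf-orient sub)
          (trans (numRootStrongComps≡active none) (cong suc (≡ᵇ⁻ (∧⁻ʳ (nToggled true S ≡ᵇ 0) p)))))
      (λ (connected , rsc) → let none = v0Connected⁻ connected in ∧⁺ (≡ᵇ⁺ (none⁺ none))
        (≡ᵇ⁺ (ℕₚ.suc-injective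
          (trans (sym (numRootStrongComps≡active none)) (Equivalence.from (treeOf-orient sub) rsc)))))
      where
      open RootComponents (orient-preimage sub)
      open ToggledHalves true using (none⁺; none⁻)
    expansion : ∀ i (w : Vec Bool n → ℤ) → FlipInvariant true w →
      sumSubgraphs (λ S → coeff (x-1 ^P nToggled true S) i *ℤ w S) ≡ sumSubgraphs (λ S → ⟦ indicator i S ⟧ *ℤ w S)
    expansion i w w-flip = begin
      sumSubgraphs (λ S → coeff (x-1 ^P nToggled true S) i *ℤ w S)
        ≡⟨ sumOver-cong allSubgraphs (λ {S} _ → cong (_*ℤ w S) (coeff-[x-1]^ (nToggled true S) i)) ⟩
      sumSubgraphs (λ S → expansionCoeff (nToggled true S) 0 i *ℤ w S)
        ≡⟨ sum-untoggled true (λ S u m → expansionCoeff u m i *ℤ w S)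
             (λ S u m → solve 3 (λ a b c → (a :- b) :* c :+ b :* c := a :* c) refl
               (expansionCoeff u (suc m) i) (expansionCoeff u m i) (w S))
             (λ u m sub act → cong (expansionCoeff u m i *ℤ_) (w-flip sub act)) ⟩
      sumSubgraphs (λ S → if nToggled true S ≡ᵇ 0 then ⟦ nActive true S ≡ᵇ i ⟧ *ℤ w S else + 0)
        ≡⟨ sumOver-cong allSubgraphs (λ {S} _ → if-⟦⟧-* (nToggled true S ≡ᵇ 0) (nActive true S ≡ᵇ i) (w S)) ⟩
      sumSubgraphs (λ S → ⟦ indicator i S ⟧ *ℤ w S) ∎
      where
      open ≡-Reasoning
      open +-*-Solver using (solve; con; _:=_; _:+_; _:-_; _:*_)
      if-⟦⟧-* : ∀ a b z → (if a then ⟦ b ⟧ *ℤ z else + 0) ≡ ⟦ a ∧ b ⟧ *ℤ z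
      if-⟦⟧-* true b z = refl
      if-⟦⟧-* false b z = refl

  unrestricted : CycleStatistic (+ 2) (λ _ → ⊤)
  unrestricted = record
    { indicator = λ _ → true
    ; characterizes = λ _ → mk⇔ _ (λ _ → refl)
    ; expansion = λ χ _ → sumOver-cong allSubgraphs (λ {S} _ → begin
        ⟦ χ S ⟧ *ℤ (+ 1) ^ℤ nToggled false S     ≡⟨ cong (⟦ χ S ⟧ *ℤ_) (ℤₚ.^-zeroˡ (nToggled false S)) ⟩
        ⟦ χ S ⟧ *ℤ + 1                           ≡⟨ ⟦⟧-∧ (χ S) true ⟩
        ⟦ χ S ∧ true ⟧                           ∎)
    }
    where open ≡-Reasoning

  minimalOrientations : CycleStatistic (+ 1) Minimal
  minimalOrientations = record
    { indicator = λ S → nToggled false S ≡ᵇ 0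
    ; characterizes = characterizes
    ; expansion = λ χ _ → sumOver-cong allSubgraphs (λ {S} _ →
        trans (cong (⟦ χ S ⟧ *ℤ_) (0^ (nToggled false S))) (⟦⟧-∧ (χ S) (nToggled false S ≡ᵇ 0)))
    }
    where
    characterizes : Characterizes (λ S → nToggled false S ≡ᵇ 0) Minimal
    characterizes sub = mk⇔
      (λ p → Equivalence.to (treeOf-orient sub) (minimal⁺ (none⁻ (≡ᵇ⁻ p))))
      (λ minimal → ≡ᵇ⁺ (none⁺ (minimal⁻ (Equivalence.from (treeOf-orient sub) minimal))))
      where
      open Cycles (orient-preimage sub)
      open ToggledHalves false

  acyclicOrientations : CycleStatistic (+ 0) Acyclic
  acyclicOrientations = record { indicator = indicator ; characterizes = characterizes ; expansion = expansion }
    where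
    indicator : Vec Bool n → Bool
    indicator S = (nToggled false S ≡ᵇ 0) ∧ (nActive false S ≡ᵇ 0)
    characterizes : Characterizes indicator Acyclic
    characterizes {S} sub = mk⇔
      (λ p → acyclic⁺ (λ ee → trans (isActive≡active _) (Active.none⁻ (≡ᵇ⁻ (∧⁻ʳ (nToggled false S ≡ᵇ 0) p)) ee)))
      (λ acyclic → let inactive = acyclic⁻ acyclic in ∧⁺
        (≡ᵇ⁺ (Toggled.none⁺ (λ ee → ≢true⇒false λ t → 𝔹ₚ.not-¬ (toggled⇒active t) (inactive ee))))
        (≡ᵇ⁺ (Active.none⁺ (λ ee → trans (sym (isActive≡active _)) (inactive ee)))))
      where
      open Cycles (orient-preimage sub)
      module Active = ActiveHalves false
      module Toggled = ToggledHalves false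
    expansion : ∀ χ → FlipInvariant false χ →
      sumSubgraphs (λ S → ⟦ χ S ⟧ *ℤ (- + 1) ^ℤ nToggled false S) ≡ sumSubgraphs (λ S → ⟦ χ S ∧ indicator S ⟧)
    expansion χ χ-flip = begin
      sumSubgraphs (λ S → ⟦ χ S ⟧ *ℤ (- + 1) ^ℤ nToggled false S)
        ≡⟨ sumOver-cong allSubgraphs (λ {S} _ → ℤₚ.*-identityʳ (⟦ χ S ⟧ *ℤ (- + 1) ^ℤ nToggled false S)) ⟨
      sumSubgraphs (λ S → w S (nToggled false S) 0)
        ≡⟨ sum-untoggled false w
             (λ S u m → solve 3
               (λ c a b → c :* (con (- + 1) :* a) :* b :+ c :* a :* b := c :* a :* (con (+ 0) :* b)) refl
               ⟦ χ S ⟧ ((- + 1) ^ℤ u) ((+ 0) ^ℤ m))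
             (λ u m sub act → cong (λ b → ⟦ b ⟧ *ℤ (- + 1) ^ℤ u *ℤ (+ 0) ^ℤ m) (χ-flip sub act)) ⟩
      sumSubgraphs (λ S → if nToggled false S ≡ᵇ 0 then w S 0 (nActive false S) else + 0)
        ≡⟨ sumOver-cong allSubgraphs (λ {S} _ → evaluate (χ S) (nToggled false S ≡ᵇ 0) (nActive false S)) ⟩
      sumSubgraphs (λ S → ⟦ χ S ∧ indicator S ⟧) ∎
      where
      open ≡-Reasoning
      open +-*-Solver using (solve; con; _:=_; _:+_; _:-_; _:*_)
      -- (y - 1)^u y^m at y = 0
      w : Vec Bool n → ℕ → ℕ → ℤ
      w S u m = ⟦ χ S ⟧ *ℤ (- + 1) ^ℤ u *ℤ (+ 0) ^ℤ m
      evaluate : ∀ c t m → (if t then ⟦ c ⟧ *ℤ + 1 *ℤ (+ 0) ^ℤ m else + 0) ≡ ⟦ c ∧ (t ∧ (m ≡ᵇ 0)) ⟧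
      evaluate c true m = trans (cong₂ _*ℤ_ (ℤₚ.*-identityʳ ⟦ c ⟧) (0^ m)) (⟦⟧-∧ c (m ≡ᵇ 0))
      evaluate c false m = cong ⟦_⟧ (sym (𝔹ₚ.∧-zeroʳ c))

theorem47 : ∀ {n : ℕ} (M : RootedMap n) → let open MapDefs M in
    CoeffsCount (tutteAt onePlusX (+ 2)) (λ i O → isOrientation O ≡ true × RC i O)
    × CoeffsCount (tutteAt onePlusX (+ 1)) (λ i O → isOrientation O ≡ true × Minimal O × RC i O)
    × CoeffsCount (tutteAt onePlusX (+ 0)) (λ i O → isOrientation O ≡ true × Acyclic O × RC i O)
    × CoeffsCount (tutteAt varX (+ 2)) (λ i O → isOrientation O ≡ true × v0Connected O ≡ true × RSC i O)
    × CoeffsCount (tutteAt varX (+ 1)) (λ i O → isOrientation O ≡ true × v0Connected O ≡ true × Minimal O × RSC i O)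
    × CoeffsCount (tutteAt varX (+ 0)) (λ i O → isOrientation O ≡ true × v0Connected O ≡ true × Acyclic O × RSC i O)
theorem47 M =
      coeffsCount rootComponents unrestricted drop-⊤
    , coeffsCount rootComponents minimalOrientations (⇔-id _)
    , coeffsCount rootComponents acyclicOrientations (⇔-id _)
    , coeffsCount rootStrongComponents unrestricted drop-⊤
    , coeffsCount rootStrongComponents minimalOrientations exchange
    , coeffsCount rootStrongComponents acyclicOrientations exchange
  where
  open MapDefs M
  open Map M
  drop-⊤ : ∀ {A : Set} → (⊤ × A) ⇔ A
  drop-⊤ = mk⇔ proj₂ (tt ,_)
  exchange : ∀ {A B C : Set} → (A × B × C) ⇔ (B × A × C)
  exchange = mk⇔ (λ (a , b , c) → b , a , c) (λ (b , a , c) → a , b , c)
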